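{- Let $n,k$ be positive integers. (1) If $n\geq 2$ is even and $0\leq k\leq n-1$, then $s(n,k)=\frac{nk}{2}$. (2) If $n\geq 5$ is odd and $4\leq k\leq 2n-6$, then $$\frac{n(n-1)k}{4n-6}\leq s(n,k)\leq \min\left\{\left\lceil\frac{k}{3}\right\rceil,\frac{n-1}{2}\right\}n.$$ Moreover, if in addition $n\geq 13$ (and $n$ is odd), then $s(n,2n-3)=\frac{n(n-1)}{2}$, $s(n,2n-4)=\frac{n(n-1)}{2}-1$, $s(n,2n-5)=\frac{n(n-1)}{2}-\frac{n-1}{2}$, $s(n,0)=0$, $s(n,1)=\frac{n-1}{2}$, $s(n,2)=n-1$, and $s(n,3)=n$.
   Context: All graphs are finite, simple and undirected. A perfect matching is a set of edges covering every vertex exactly once; an almost-perfect matching is a set of edges covering every vertex except one exactly once and missing the remaining vertex. The matching preclusion number $\mathrm{mp}(G)$ is the minimum number of edges whose deletion leaves a graph with neither a perfect matching nor an almost-perfect matching ($\mathrm{mp}(G)=0$ if $G$ has neither). For integers $n,k$, let $\mathscr{G}(n,k)$ be the set of all graphs on $n$ vertices with $\mathrm{mp}(G)=k$, and $s(n,k)=\min\{|E(G)|: G\in\mathscr{G}(n,k)\}$. -}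

module Defs where

open import Data.Nat using (ℕ; zero; suc; _+_; _*_; _<ᵇ_; _≤_; _<_)
open import Data.Bool using (Bool; true; false; _∧_; not; if_then_else_)
open import Data.Fin using (Fin; toℕ)
open import Data.Product using (Σ; _×_; ∃)
open import Data.Sum using (_⊎_)
open import Relation.Nullary using (¬_)
open import Relation.Binary.PropositionalEquality using (_≡_; _≢_)

count : ∀ {n} → (Fin n → Bool) → ℕ
count {zero}  f = 0
count {suc n} f = (if f Fin.zero then 1 else 0) + count (λ i → f (Fin.suc i))

sumFin : ∀ {n} → (Fin n → ℕ) → ℕ
sumFin {zero}  f = 0
sumFin {suc n} f = f Fin.zero + sumFin (λ i → f (Fin.suc i))

record Graph (n : ℕ) : Set where
  field
    adj    : Fin n → Fin n → Bool
    sym    : ∀ i j → adj i j ≡ adj j i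
    irrefl : ∀ i → adj i i ≡ false
open Graph public

edges : ∀ {n} → Graph n → ℕ
edges G = sumFin (λ i → count (λ j → adj G i j ∧ (toℕ i <ᵇ toℕ j)))

degree : ∀ {n} → Graph n → Fin n → ℕ
degree G v = count (adj G v)

_⊆G_ : ∀ {n} → Graph n → Graph n → Set
H ⊆G G = ∀ i j → adj H i j ≡ true → adj G i j ≡ true

delete : ∀ {n} → Graph n → Graph n → Graph n
delete G F = record
  { adj = λ i j → adj G i j ∧ not (adj F i j)
  ; sym = λ i j → lemma i j
  ; irrefl = λ i → irr i }
  where
  open import Relation.Binary.PropositionalEquality using (cong₂)
  lemma : ∀ i j → (adj G i j ∧ not (adj F i j)) ≡ (adj G j i ∧ not (adj F j i))
  lemma i j = cong₂ (λ a b → a ∧ not b) (sym G i j) (sym F i j)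
  irr : ∀ i → (adj G i i ∧ not (adj F i i)) ≡ false
  irr i with adj G i i | irrefl G i
  ... | .false | _≡_.refl = _≡_.refl

HasPerfectMatching : ∀ {n} → Graph n → Set
HasPerfectMatching {n} H = Σ (Graph n) λ M → M ⊆G H × (∀ v → degree M v ≡ 1)

HasAlmostPerfectMatching : ∀ {n} → Graph n → Set
HasAlmostPerfectMatching {n} H =
  Σ (Graph n) λ M → M ⊆G H × (Σ (Fin n) λ w → degree M w ≡ 0 × (∀ v → v ≢ w → degree M v ≡ 1))

HasPMorAPM : ∀ {n} → Graph n → Set
HasPMorAPM H = HasPerfectMatching H ⊎ HasAlmostPerfectMatching H

MP : ∀ {n} → Graph n → ℕ → Set
MP {n} G k =
  (Σ (Graph n) λ F → F ⊆G G × edges F ≡ k × ¬ HasPMorAPM (delete G F))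
  × (∀ (F : Graph n) → F ⊆G G → edges F < k → HasPMorAPM (delete G F))

SIs : ℕ → ℕ → ℕ → Set
SIs n k m = (Σ (Graph n) λ G → MP G k × edges G ≡ m)
          × (∀ (G : Graph n) → MP G k → m ≤ edges G)

-- L ≤ s(n,k) ≤ U, with s(n,k) defined (𝒢(n,k) nonempty):
-- lower bound given as a predicate on |E(G)|, upper bound as a number
SBounds : ℕ → ℕ → (ℕ → Set) → ℕ → Set
SBounds n k Low U = (∀ (G : Graph n) → MP G k → Low (edges G))
                  × (Σ (Graph n) λ G → MP G k × edges G ≤ U)

{-# OPTIONS --safe #-}
-- Write mp(G) ≥ k as: every graph obtained from G by deleting fewer than k edges still has a matching of the
-- required kind.  Erasing an edge lowers mp by at most one, so a graph with mp(G) ≥ k contains one with mp = k,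
-- and s(n,k) = m as soon as mp(G) ≥ k forces m edges and some G with mp(G) ≥ k has at most m.
--
-- Lower bounds: deleting all edges at one vertex (n even), or at two vertices u, v (n odd), destroys every
-- matching, so deg u + deg v - [uv] ≥ k for u ≢ v; this is averaged over all pairs, or, for k close to 2n - 3,
-- read as a condition on the complement.  For k = 2 and k = 3 leaves are removed together with their neighbours.
--
-- Constructions: for n even, k classes of a 1-factorization.  For n odd, ⌈k/3⌉ Hamiltonian cycles of Walecki's
-- decomposition: of fewer than 3m deleted edges some cycle loses at most two, and an odd cycle minus two edges
-- has an almost perfect matching.  For K_n and K_n minus a near perfect matching, the pairs u v absent from the
-- graph are restored one at a time as long as their degrees in the complement add up to at most n (a
-- Bondy–Chvátal closure); counting edges shows that the complement cannot get stuck before it is empty.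
module Submission where

open import Defs
open import Data.Nat as ℕ hiding (_≟_)
open import Data.Nat.DivMod
open import Data.Nat.Properties hiding (_≟_)
open import Data.Nat.Tactic.RingSolver using (solve-∀)
open import Data.Bool using (Bool; true; false; _∧_; _∨_; not; if_then_else_)
import Data.Bool.Properties as 𝔹
open import Data.Fin using (Fin; zero; suc; toℕ; fromℕ<; _≟_; combine; remQuot; opposite; splitAt; _↑ˡ_; _↑ʳ_)
open import Data.Fin.Properties as Fin
  using ( toℕ-fromℕ<; toℕ-injective; toℕ<n; toℕ-↑ˡ; toℕ-↑ʳ; toℕ-combine; all?; any?; opposite-prop
        ; opposite-involutive; remQuot-combine; combine-remQuot; splitAt-↑ˡ; splitAt-↑ʳ; splitAt⁻¹-↑ˡ; splitAt⁻¹-↑ʳ )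
open import Data.Fin.Permutation
  using (Permutation; Permutation′; permutation; flip; lift₀; transpose; _∘ₚ_; _⟨$⟩ʳ_; _⟨$⟩ˡ_; inverseˡ; inverseʳ)
open import Data.Fin.Subset using (Subset)
open import Data.Fin.Subset.Properties using (anySubset?)
open import Data.Vec using (lookup; tabulate)
open import Data.Vec.Properties using (lookup∘tabulate)
open import Data.Product using (Σ; ∃; ∃₂; _×_; _,_; proj₁; proj₂; uncurry)
open import Data.Sum using (_⊎_; inj₁; inj₂; [_,_]′)
open import Data.Empty using (⊥; ⊥-elim)
open import Function using (_∘_; mk⇔)
open import Relation.Binary.Definitions using (tri<; tri≈; tri>)
open import Relation.Nullary
open import Relation.Nullary.Decidable
  using (dec-true; dec-false; does-⇔; map′; toSum; _×-dec_; _⊎-dec_; _→-dec_; decidable-stable)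
open import Relation.Binary.PropositionalEquality hiding ([_]) renaming (sym to ≡-sym)
import Algebra.Properties.Semiring.Sum +-*-semiring as Sum

-- Averaging the condition on pairs is too weak at both ends of the range of k. For k = 2 and k = 3
-- it yields about n/2 and 3n/4 edges instead of n - 1 and n, because it tolerates leaves. A leaf,
-- however, forces at least k edges at its neighbour, so the two vertices taken away together carry
-- at least as many edges as vertices. For k = 2n - 4 averaging misses the true value by about n/4,
-- whereas in the complement the same condition leaves room for one edge only. The dense
-- constructions share one argument with a parameter μ, which is 0 or 1. The graph lacks from the
-- start a set of edges of maximum degree at most μ, and fewer than k further edges F are deleted,
-- so that every vertex v has degree at most deg F v + μ in the complement of what remains. The
-- count works for k ≤ 2n - 3 - 2μ and (n - 1)/2 + μ ≥ 6; for μ = 0 the latter is n ≥ 13.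

private variable
  n m k : ℕ

-- Finite sums and degrees

-- Linear arithmetic: a ≤ b follows from x ≤ y once b - a exceeds y - x by s.
linear : ∀ {x y} a b s → x ≤ y → a + y + s ≡ b + x → a ≤ b
linear {x} {y} a b s x≤y eq = +-cancelʳ-≤ y a b (begin
  a + y      ≤⟨ m≤m+n (a + y) s ⟩
  a + y + s  ≡⟨ eq ⟩
  b + x      ≤⟨ +-monoʳ-≤ b x≤y ⟩
  b + y      ∎)
  where open ≤-Reasoning

⟦_⟧ : Bool → ℕ
⟦ b ⟧ = if b then 1 else 0

⟦⟧≤1 : ∀ b → ⟦ b ⟧ ≤ 1
⟦⟧≤1 false = z≤n
⟦⟧≤1 true  = ≤-refl

⟦⟧≡0 : ∀ {b} → ⟦ b ⟧ ≡ 0 → b ≡ false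
⟦⟧≡0 {false} _ = refl

_==_ : Fin n → Fin n → Bool
i == j = does (i ≟ j)

==-refl : (i : Fin n) → (i == i) ≡ true
==-refl i = dec-true (i ≟ i) refl

≢⇒== : {i j : Fin n} → i ≢ j → (i == j) ≡ false
≢⇒== {i = i} {j} = dec-false (i ≟ j)

==⇒≡ : {i j : Fin n} → (i == j) ≡ true → i ≡ j
==⇒≡ {i = i} {j} eq with i ≟ j
... | yes p = p

==-sym : (i j : Fin n) → (i == j) ≡ (j == i)
==-sym i j with i ≟ j
... | yes refl = ≡-sym (==-refl i)
... | no i≢j   = ≡-sym (≢⇒== (i≢j ∘ ≡-sym))

sumFin≡sum : (f : Fin n → ℕ) → sumFin f ≡ Sum.sum f
sumFin≡sum {zero}  f = refl
sumFin≡sum {suc n} f = cong (f zero +_) (sumFin≡sum (f ∘ suc))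

sum-cong : {f g : Fin n → ℕ} → (∀ i → f i ≡ g i) → sumFin f ≡ sumFin g
sum-cong {zero}  f≡g = refl
sum-cong {suc n} f≡g = cong₂ _+_ (f≡g zero) (sum-cong (f≡g ∘ suc))

sum-mono-≤ : {f g : Fin n → ℕ} → (∀ i → f i ≤ g i) → sumFin f ≤ sumFin g
sum-mono-≤ {zero}  f≤g = z≤n
sum-mono-≤ {suc n} f≤g = +-mono-≤ (f≤g zero) (sum-mono-≤ (f≤g ∘ suc))

sum-const : ∀ n c → sumFin {n} (λ _ → c) ≡ n * c
sum-const zero    c = refl
sum-const (suc n) c = cong (c +_) (sum-const n c)

sum-+ : (f g : Fin n → ℕ) → sumFin (λ i → f i + g i) ≡ sumFin f + sumFin g
sum-+ {n} f g = trans (sumFin≡sum {n} _) (trans (Sum.∑-distrib-+ {n} f g)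
  (≡-sym (cong₂ _+_ (sumFin≡sum f) (sumFin≡sum g))))

sum-*ˡ : ∀ c (f : Fin n → ℕ) → sumFin (λ i → c * f i) ≡ c * sumFin f
sum-*ˡ {n} c f = trans (sumFin≡sum {n} _) (trans (≡-sym (Sum.*-distribˡ-sum {n} c f))
  (cong (c *_) (≡-sym (sumFin≡sum f))))

sum-comm : (f : Fin m → Fin n → ℕ) →
           sumFin (λ i → sumFin (f i)) ≡ sumFin (λ j → sumFin (λ i → f i j))
sum-comm {m} {n} f = trans (double f) (trans (Sum.∑-comm f) (≡-sym (double (λ j i → f i j))))
  where
  double : ∀ {k l} (g : Fin k → Fin l → ℕ) → sumFin (λ i → sumFin (g i)) ≡ Sum.sum (λ i → Sum.sum (g i))
  double g = trans (sumFin≡sum (λ i → sumFin (g i))) (Sum.sum-cong-≗ (λ i → sumFin≡sum (g i)))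

sum-permute : (f : Fin n → ℕ) (σ : Permutation m n) → sumFin (λ i → f (σ ⟨$⟩ʳ i)) ≡ sumFin f
sum-permute {n} {m} f σ = trans (sumFin≡sum {m} _) (trans (≡-sym (Sum.sum-permute f σ)) (≡-sym (sumFin≡sum f)))

count≡sum : (f : Fin n → Bool) → count f ≡ sumFin (λ i → ⟦ f i ⟧)
count≡sum {zero}  f = refl
count≡sum {suc n} f = cong (⟦ f zero ⟧ +_) (count≡sum (f ∘ suc))

sum-≡0 : {f : Fin n → ℕ} → sumFin f ≡ 0 → ∀ i → f i ≡ 0
sum-≡0 {f = f} eq zero    = m+n≡0⇒m≡0 (f zero) eq
sum-≡0 {f = f} eq (suc i) = sum-≡0 (m+n≡0⇒n≡0 (f zero) eq) i

sum-zero : (f : Fin n → ℕ) → (∀ i → f i ≡ 0) → sumFin f ≡ 0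
sum-zero {n} f f≡0 = trans (sum-cong f≡0) (trans (sum-const n 0) (*-zeroʳ n))

sum-δ : ∀ a (f : Fin n → ℕ) → sumFin (λ i → ⟦ i == a ⟧ * f i) ≡ f a
sum-δ zero f = trans
  (cong₂ _+_ (+-identityʳ (f zero)) (sum-zero (λ i → ⟦ suc i == zero ⟧ * f (suc i)) (λ _ → refl)))
  (+-identityʳ (f zero))
sum-δ (suc a) f = sum-δ a (f ∘ suc)

sum-== : (a : Fin n) → sumFin (λ i → ⟦ i == a ⟧) ≡ 1
sum-== a = trans (sum-cong λ i → ≡-sym (*-identityʳ ⟦ i == a ⟧)) (sum-δ a (λ _ → 1))

term≤sum : (f : Fin n → ℕ) (a : Fin n) → f a ≤ sumFin f
term≤sum f zero    = m≤m+n (f zero) _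
term≤sum f (suc a) = ≤-trans (term≤sum (f ∘ suc) a) (m≤n+m _ (f zero))

two-terms≤sum : (f : Fin n → ℕ) {a b : Fin n} → a ≢ b → f a + f b ≤ sumFin f
two-terms≤sum f {a} {b} a≢b = begin
  f a + f b                                              ≡⟨ cong₂ _+_ (sum-δ a f) (sum-δ b f) ⟨
  sumFin (λ i → ⟦ i == a ⟧ * f i) + sumFin (λ i → ⟦ i == b ⟧ * f i)  ≡⟨ sum-+ _ (λ i → ⟦ i == b ⟧ * f i) ⟨
  sumFin (λ i → ⟦ i == a ⟧ * f i + ⟦ i == b ⟧ * f i)        ≤⟨ sum-mono-≤ bound ⟩
  sumFin f                                                  ∎
  where
  open ≤-Reasoning
  bound : ∀ i → ⟦ i == a ⟧ * f i + ⟦ i == b ⟧ * f i ≤ f i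
  bound i with i ≟ a | i ≟ b
  ... | yes refl | yes refl = ⊥-elim (a≢b refl)
  ... | yes refl | no _ = ≤-reflexive (trans (+-identityʳ _) (+-identityʳ _))
  ... | no _ | yes refl = ≤-reflexive (+-identityʳ _)
  ... | no _ | no _ = z≤n

-- Pigeonhole principle, applied both to the colour classes of a union and to the rotations of a
-- matching along a cycle.
exists-small : ∀ (x : Fin m → ℕ) t → sumFin x < m * t → ∃ λ c → x c < t
exists-small {zero} x t ()
exists-small {suc m} x t lt with x zero <? t
... | yes p = zero , p
... | no ¬p with exists-small (x ∘ suc) t (+-cancelˡ-< t _ _ (≤-trans (s≤s (+-monoˡ-≤ _ (≮⇒≥ ¬p))) lt))
...   | c , p = suc c , p

find : (f : Fin n → Bool) → (∃ λ i → f i ≡ true) ⊎ (∀ i → f i ≡ false)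
find {zero} f = inj₂ λ ()
find {suc n} f with f zero in eq | find (f ∘ suc)
... | true  | _              = inj₁ (zero , eq)
... | false | inj₁ (i , p)   = inj₁ (suc i , p)
... | false | inj₂ all-false = inj₂ λ { zero → eq ; (suc i) → all-false i }

deg : Graph n → Fin n → ℕ
deg G v = sumFin (λ j → ⟦ adj G v j ⟧)

degree≡deg : (G : Graph n) (v : Fin n) → degree G v ≡ deg G v
degree≡deg G v = count≡sum (adj G v)

-- `edges` counts a pair in increasing order, so `up` plus its transpose is the adjacency matrix.
-- Later counts go through degree sums because these do not depend on the order of the vertices.
handshake : (G : Graph n) → 2 * edges G ≡ sumFin (deg G)
handshake {n} G = begin
  2 * edges G                                            ≡⟨ cong (λ e → e + (e + 0)) edges≡ ⟩
  sumFin (λ i → sumFin (up i)) + (sumFin (λ i → sumFin (up i)) + 0)  ≡⟨ cong (sumFin (λ i → sumFin (up i)) +_) (+-identityʳ _) ⟩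
  sumFin (λ i → sumFin (up i)) + sumFin (λ i → sumFin (up i))        ≡⟨ cong (sumFin (λ i → sumFin (up i)) +_) (sum-comm up) ⟩
  sumFin (λ i → sumFin (up i)) + sumFin (λ i → sumFin (λ j → up j i)) ≡⟨ sum-+ _ (λ i → sumFin (λ j → up j i)) ⟨
  sumFin (λ i → sumFin (up i) + sumFin (λ j → up j i))            ≡⟨ sum-cong (λ i → ≡-sym (sum-+ (up i) (λ j → up j i))) ⟩
  sumFin (λ i → sumFin (λ j → up i j + up j i))                ≡⟨ sum-cong (λ i → sum-cong (both i)) ⟩
  sumFin (deg G)                                            ∎
  where
  open ≡-Reasoning
  up : Fin n → Fin n → ℕ
  up i j = ⟦ adj G i j ∧ (toℕ i <ᵇ toℕ j) ⟧
  edges≡ : edges G ≡ sumFin (λ i → sumFin (up i))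
  edges≡ = sum-cong {n} λ i → count≡sum {n} _
  <ᵇ-yes : ∀ {x y} → x < y → (x <ᵇ y) ≡ true
  <ᵇ-yes {x} {y} = dec-true (x <? y)
  <ᵇ-no : ∀ {x y} → ¬ x < y → (x <ᵇ y) ≡ false
  <ᵇ-no {x} {y} = dec-false (x <? y)
  both : ∀ i j → up i j + up j i ≡ ⟦ adj G i j ⟧
  both i j with <-cmp (toℕ i) (toℕ j)
  ... | tri≈ _ eq _ rewrite toℕ-injective eq | irrefl G j = refl
  ... | tri< lt _ ngt rewrite <ᵇ-yes lt | <ᵇ-no ngt | 𝔹.∧-identityʳ (adj G i j) | 𝔹.∧-zeroʳ (adj G j i) = +-identityʳ _
  ... | tri> nlt _ gt rewrite <ᵇ-yes gt | <ᵇ-no nlt | 𝔹.∧-identityʳ (adj G j i) | 𝔹.∧-zeroʳ (adj G i j) = cong ⟦_⟧ (sym G j i)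

edges-≤-from : (G H : Graph n) → sumFin (deg G) ≤ sumFin (deg H) → edges G ≤ edges H
edges-≤-from G H le = *-cancelˡ-≤ 2 (subst₂ _≤_ (≡-sym (handshake G)) (≡-sym (handshake H)) le)

⟦⟧-mono : ∀ {a b} → (a ≡ true → b ≡ true) → ⟦ a ⟧ ≤ ⟦ b ⟧
⟦⟧-mono {false} f = z≤n
⟦⟧-mono {true}  f rewrite f refl = ≤-refl

deg-mono : (G H : Graph n) → G ⊆G H → ∀ v → deg G v ≤ deg H v
deg-mono G H G⊆H v = sum-mono-≤ λ j → ⟦⟧-mono (G⊆H v j)

edges-mono : (G H : Graph n) → G ⊆G H → edges G ≤ edges H
edges-mono G H G⊆H = edges-≤-from G H (sum-mono-≤ (deg-mono G H G⊆H))

edges-cong : (G H : Graph n) → (∀ i j → adj G i j ≡ adj H i j) → edges G ≡ edges H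
edges-cong G H eq = ≤-antisym (edges-mono G H λ i j → subst (_≡ true) (eq i j))
                              (edges-mono H G λ i j → subst (_≡ true) (≡-sym (eq i j)))

deg-≡0 : (G : Graph n) {v : Fin n} → deg G v ≡ 0 → ∀ j → adj G v j ≡ false
deg-≡0 G eq j = ⟦⟧≡0 (sum-≡0 eq j)

edges-≡0 : (G : Graph n) → edges G ≡ 0 → ∀ i j → adj G i j ≡ false
edges-≡0 G eq i = deg-≡0 G (sum-≡0 (trans (≡-sym (handshake G)) (cong (2 *_) eq)) i)

true≢false : ∀ {b} → b ≡ true → b ≡ false → ⊥
true≢false refl ()

∧-true : ∀ {a b} → a ∧ b ≡ true → a ≡ true × b ≡ true
∧-true {true} {true} _ = refl , refl

∧-intro : ∀ {a b} → a ≡ true → b ≡ true → a ∧ b ≡ true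
∧-intro refl refl = refl

not-true : ∀ {a} → not a ≡ true → a ≡ false
not-true {false} _ = refl

adj⇒≢ : (G : Graph n) {i j : Fin n} → adj G i j ≡ true → i ≢ j
adj⇒≢ G {i} e refl = true≢false e (irrefl G i)

delete-⊆ : (G F : Graph n) → delete G F ⊆G G
delete-⊆ G F i j e = proj₁ (∧-true e)

delete-avoids : (G F : Graph n) {i j : Fin n} → adj (delete G F) i j ≡ true → adj F i j ≡ false
delete-avoids G F {i} {j} e = not-true (proj₂ (∧-true {adj G i j} e))

delete-intro : (G F : Graph n) {i j : Fin n} → adj G i j ≡ true → adj F i j ≡ false → adj (delete G F) i j ≡ true
delete-intro G F e f rewrite e | f = refl

edges-delete : (G F : Graph n) → F ⊆G G → edges (delete G F) + edges F ≡ edges G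
edges-delete G F F⊆G = *-cancelˡ-≡ _ _ 2 (begin
  2 * (edges (delete G F) + edges F)                ≡⟨ *-distribˡ-+ 2 (edges (delete G F)) (edges F) ⟩
  2 * edges (delete G F) + 2 * edges F              ≡⟨ cong₂ _+_ (handshake (delete G F)) (handshake F) ⟩
  sumFin (deg (delete G F)) + sumFin (deg F)              ≡⟨ sum-+ _ (deg F) ⟨
  sumFin (λ i → deg (delete G F) i + deg F i)          ≡⟨ sum-cong (λ i → ≡-sym (sum-+ _ (λ j → ⟦ adj F i j ⟧))) ⟩
  sumFin (λ i → sumFin (λ j → ⟦ adj (delete G F) i j ⟧ + ⟦ adj F i j ⟧)) ≡⟨ sum-cong (λ i → sum-cong (split i)) ⟩
  sumFin (deg G)                                       ≡⟨ handshake G ⟨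
  2 * edges G                                       ∎)
  where
  open ≡-Reasoning
  split : ∀ i j → ⟦ adj G i j ∧ not (adj F i j) ⟧ + ⟦ adj F i j ⟧ ≡ ⟦ adj G i j ⟧
  split i j with adj F i j in eF
  ... | true rewrite F⊆G i j eF = refl
  ... | false rewrite 𝔹.∧-identityʳ (adj G i j) = +-identityʳ _

-- Subgraphs, decidability and the descent to mp(G) = k

fromRelation : (p : Fin n → Fin n → Bool) → (∀ i j → p i j ≡ p j i) → Graph n
fromRelation p p-sym = record
  { adj    = λ i j → not (i == j) ∧ p i j
  ; sym    = λ i j → cong₂ (λ a b → not a ∧ b) (==-sym i j) (p-sym i j)
  ; irrefl = λ i → cong (λ b → not b ∧ p i i) (==-refl i)
  }

fromRelation-intro : {p : Fin n → Fin n → Bool} {i j : Fin n} → i ≢ j → p i j ≡ true → not (i == j) ∧ p i j ≡ true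
fromRelation-intro i≢j e rewrite ≢⇒== i≢j = e

restrict : Graph n → (p : Fin n → Fin n → Bool) → (∀ i j → p i j ≡ p j i) → Graph n
restrict G p p-sym = record
  { adj    = λ i j → adj G i j ∧ p i j
  ; sym    = λ i j → cong₂ _∧_ (sym G i j) (p-sym i j)
  ; irrefl = λ i → cong (_∧ p i i) (irrefl G i)
  }

isolate : Graph n → Fin n → Graph n
isolate G u = restrict G (λ i j → not ((i == u) ∨ (j == u))) (λ i j → cong not (𝔹.∨-comm (i == u) (j == u)))

deg-isolate-self : (G : Graph n) (u : Fin n) → deg (isolate G u) u ≡ 0
deg-isolate-self G u = sum-zero _ λ j →
  trans (cong (λ b → ⟦ adj G u j ∧ not (b ∨ (j == u)) ⟧) (==-refl u)) (cong ⟦_⟧ (𝔹.∧-zeroʳ (adj G u j)))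

deg-isolate : (G : Graph n) {u v : Fin n} → v ≢ u → deg (isolate G u) v + ⟦ adj G u v ⟧ ≡ deg G v
deg-isolate {n} G {u} {v} v≢u = begin
  deg (isolate G u) v + ⟦ adj G u v ⟧                            ≡⟨ cong (λ b → deg (isolate G u) v + ⟦ b ⟧) (sym G u v) ⟩
  deg (isolate G u) v + ⟦ adj G v u ⟧                            ≡⟨ cong (deg (isolate G u) v +_) (sum-δ u (λ j → ⟦ adj G v j ⟧)) ⟨
  deg (isolate G u) v + sumFin (λ j → ⟦ j == u ⟧ * ⟦ adj G v j ⟧)   ≡⟨ sum-+ (λ j → ⟦ adj (isolate G u) v j ⟧) (λ j → ⟦ j == u ⟧ * ⟦ adj G v j ⟧) ⟨
  sumFin (λ j → ⟦ adj (isolate G u) v j ⟧ + ⟦ j == u ⟧ * ⟦ adj G v j ⟧) ≡⟨ sum-cong split ⟩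
  deg G v                                                        ∎
  where
  open ≡-Reasoning
  split : ∀ j → ⟦ adj (isolate G u) v j ⟧ + ⟦ j == u ⟧ * ⟦ adj G v j ⟧ ≡ ⟦ adj G v j ⟧
  split j rewrite ≢⇒== v≢u with j == u
  ... | true  rewrite 𝔹.∧-zeroʳ (adj G v j) = +-identityʳ _
  ... | false rewrite 𝔹.∧-identityʳ (adj G v j) = +-identityʳ _

isolate-⊆ : (G : Graph n) (u : Fin n) → isolate G u ⊆G G
isolate-⊆ G u i j e = proj₁ (∧-true e)

sum-deg-isolate : (G : Graph n) (u : Fin n) → sumFin (deg (isolate G u)) + 2 * deg G u ≡ sumFin (deg G)
sum-deg-isolate {n} G u = begin
  sumFin (deg (isolate G u)) + 2 * deg G u                       ≡⟨ cong (λ d → sumFin (deg (isolate G u)) + (deg G u + d)) (+-identityʳ (deg G u)) ⟩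
  sumFin (deg (isolate G u)) + (deg G u + deg G u)               ≡⟨ cong (λ d → sumFin (deg (isolate G u)) + (d + deg G u)) (sum-δ u (deg G)) ⟨
  sumFin (deg (isolate G u)) + (sumFin (λ v → ⟦ v == u ⟧ * deg G v) + deg G u) ≡⟨ cong (sumFin (deg (isolate G u)) +_) (sum-+ (λ v → ⟦ v == u ⟧ * deg G v) (λ v → ⟦ adj G u v ⟧)) ⟨
  sumFin (deg (isolate G u)) + sumFin (λ v → ⟦ v == u ⟧ * deg G v + ⟦ adj G u v ⟧) ≡⟨ sum-+ (deg (isolate G u)) (λ v → ⟦ v == u ⟧ * deg G v + ⟦ adj G u v ⟧) ⟨
  sumFin (λ v → deg (isolate G u) v + (⟦ v == u ⟧ * deg G v + ⟦ adj G u v ⟧)) ≡⟨ sum-cong row ⟩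
  sumFin (deg G)                                                 ∎
  where
  open ≡-Reasoning
  row : ∀ v → deg (isolate G u) v + (⟦ v == u ⟧ * deg G v + ⟦ adj G u v ⟧) ≡ deg G v
  row v with toSum (v ≟ u)
  ... | inj₁ refl = cong₂ _+_ (deg-isolate-self G u)
    (trans (cong₂ _+_ (trans (cong (λ b → ⟦ b ⟧ * deg G u) (==-refl u)) (+-identityʳ _)) (cong ⟦_⟧ (irrefl G u))) (+-identityʳ _))
  ... | inj₂ v≢u = trans (cong (λ b → deg (isolate G u) v + (⟦ b ⟧ * deg G v + ⟦ adj G u v ⟧)) (≢⇒== v≢u)) (deg-isolate G v≢u)

edges-isolate : (G : Graph n) (u : Fin n) → edges (isolate G u) + deg G u ≡ edges G
edges-isolate G u = *-cancelˡ-≡ _ _ 2 (trans (*-distribˡ-+ 2 (edges (isolate G u)) (deg G u))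
  (trans (cong (_+ 2 * deg G u) (handshake (isolate G u)))
  (trans (sum-deg-isolate G u) (≡-sym (handshake G)))))

isolate-intro : (G : Graph n) {u i j : Fin n} → i ≢ u → j ≢ u → adj G i j ≡ true → adj (isolate G u) i j ≡ true
isolate-intro G i≢u j≢u e rewrite e | ≢⇒== i≢u | ≢⇒== j≢u = refl

singleEdge : (u v : Fin n) → Graph n
singleEdge u v = fromRelation (λ i j → ((i == u) ∧ (j == v)) ∨ ((j == u) ∧ (i == v)))
  (λ i j → 𝔹.∨-comm ((i == u) ∧ (j == v)) ((j == u) ∧ (i == v)))

edges-singleEdge : {u v : Fin n} → u ≢ v → edges (singleEdge u v) ≡ 1
edges-singleEdge {n} {u} {v} u≢v = *-cancelˡ-≡ _ _ 2 (trans (handshake (singleEdge u v))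
  (trans (sum-cong row) (trans (sum-+ (λ i → ⟦ i == u ⟧) (λ i → ⟦ i == v ⟧)) (cong₂ _+_ (sum-== u) (sum-== v)))))
  where
  row : ∀ i → deg (singleEdge u v) i ≡ ⟦ i == u ⟧ + ⟦ i == v ⟧
  row i with i ≟ u | i ≟ v
  ... | yes refl | yes refl = ⊥-elim (u≢v refl)
  ... | yes refl | no _ = trans (sum-cong cell) (sum-== v)
    where
    cell : ∀ j → ⟦ not (i == j) ∧ ((j == v) ∨ ((j == i) ∧ false)) ⟧ ≡ ⟦ j == v ⟧
    cell j with j ≟ v
    ... | yes refl rewrite ≢⇒== u≢v = refl
    ... | no _ rewrite 𝔹.∧-zeroʳ (j == i) | 𝔹.∧-zeroʳ (not (i == j)) = refl
  ... | no _ | yes refl = trans (sum-cong cell) (sum-== u)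
    where
    cell : ∀ j → ⟦ not (i == j) ∧ ((j == u) ∧ true) ⟧ ≡ ⟦ j == u ⟧
    cell j with j ≟ u
    ... | yes refl rewrite ≢⇒== (u≢v ∘ ≡-sym) = refl
    ... | no _ rewrite 𝔹.∧-zeroʳ (not (i == j)) = refl
  ... | no _ | no _ = sum-zero _ λ j → cong ⟦_⟧ (trans (cong (not (i == j) ∧_) (𝔹.∧-zeroʳ (j == u))) (𝔹.∧-zeroʳ (not (i == j))))

singleEdge-⊆ : (G : Graph n) {u v : Fin n} → adj G u v ≡ true → singleEdge u v ⊆G G
singleEdge-⊆ G {u} {v} e i j s with i ≟ u | j ≟ v | j ≟ u | i ≟ v | proj₂ (∧-true {not (i == j)} s)
... | yes refl | yes refl | _ | _ | _ = e
... | _ | _ | yes refl | yes refl | _ = trans (sym G i j) e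
... | no _ | _ | no _ | _ | ()
... | no _ | _ | yes _ | no _ | ()
... | yes _ | no _ | no _ | _ | ()
... | yes _ | no _ | yes _ | no _ | ()

eraseEdge : Graph n → Fin n → Fin n → Graph n
eraseEdge G u v = delete G (singleEdge u v)

edges-eraseEdge : (G : Graph n) {u v : Fin n} → adj G u v ≡ true → edges (eraseEdge G u v) + 1 ≡ edges G
edges-eraseEdge G {u} {v} e = trans (cong (edges (eraseEdge G u v) +_) (≡-sym (edges-singleEdge (adj⇒≢ G e))))
  (edges-delete G (singleEdge u v) (singleEdge-⊆ G e))

HasPMorAPM-mono : (H K : Graph n) → H ⊆G K → HasPMorAPM H → HasPMorAPM K
HasPMorAPM-mono H K H⊆K (inj₁ (M , M⊆H , d))     = inj₁ (M , (λ i j → H⊆K i j ∘ M⊆H i j) , d)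
HasPMorAPM-mono H K H⊆K (inj₂ (M , M⊆H , w , d)) = inj₂ (M , (λ i j → H⊆K i j ∘ M⊆H i j) , w , d)

-- Deciding the existence of subgraphs and matchings

_≗G_ : Graph n → Graph n → Set
G ≗G H = ∀ i j → adj G i j ≡ adj H i j

≗G⇒⊆ : (G H : Graph n) → G ≗G H → G ⊆G H
≗G⇒⊆ G H G≗H i j e = trans (≡-sym (G≗H i j)) e

degree-cong : (G H : Graph n) → G ≗G H → ∀ v → degree G v ≡ degree H v
degree-cong G H G≗H v = trans (degree≡deg G v)
  (trans (sum-cong (λ j → cong ⟦_⟧ (G≗H v j))) (≡-sym (degree≡deg H v)))

-- A graph is a function with proofs, so the search runs over bit vectors of length n * n. `decode`
-- symmetrises by conjunction, so every vector yields a graph; `encode` followed by `decode` returns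
-- the graph only up to `≗G`, hence the demand that P respect this relation.
anyGraph? : (P : Graph n → Set) → (∀ G H → G ≗G H → P G → P H) → (∀ G → Dec (P G)) → Dec (Σ (Graph n) P)
anyGraph? {n} P respects P? = map′ (λ (p , q) → decode p , q) (λ (G , q) → encode G , respects G (decode (encode G)) (encode-decode G) q) (anySubset? (P? ∘ decode))
  where
  decode : Subset (n * n) → Graph n
  decode p = fromRelation (λ i j → lookup p (combine i j) ∧ lookup p (combine j i))
    (λ i j → 𝔹.∧-comm (lookup p (combine i j)) (lookup p (combine j i)))
  encode : Graph n → Subset (n * n)
  encode G = tabulate (λ x → uncurry (adj G) (remQuot {n} n x))
  lookup-encode : ∀ G i j → lookup (encode G) (combine i j) ≡ adj G i j
  lookup-encode G i j = trans (lookup∘tabulate _ (combine i j)) (cong (uncurry (adj G)) (remQuot-combine {n} i j))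
  encode-decode : ∀ G → G ≗G decode (encode G)
  encode-decode G i j rewrite lookup-encode G i j | lookup-encode G j i | sym G j i with i ≟ j
  ... | yes refl = irrefl G i
  ... | no _     = ≡-sym (𝔹.∧-idem (adj G i j))

_⊆G?_ : (F G : Graph n) → Dec (F ⊆G G)
F ⊆G? G = all? λ i → all? λ j → (adj F i j 𝔹.≟ true) →-dec (adj G i j 𝔹.≟ true)

HasPMorAPM? : (H : Graph n) → Dec (HasPMorAPM H)
HasPMorAPM? {n} H =
  anyGraph? _ (λ G K G≗K (s , d) → ⊆-respects G K G≗K s , λ v → trans (≡-sym (degree-cong G K G≗K v)) (d v))
    (λ M → (M ⊆G? H) ×-dec all? λ v → degree M v ℕ.≟ 1)
  ⊎-dec
  anyGraph? _ (λ G K G≗K (s , w , d₀ , d₁) → ⊆-respects G K G≗K s , w , trans (≡-sym (degree-cong G K G≗K w)) d₀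
                , λ v v≢w → trans (≡-sym (degree-cong G K G≗K v)) (d₁ v v≢w))
    (λ M → (M ⊆G? H) ×-dec any? λ w → (degree M w ℕ.≟ 0)
                            ×-dec all? λ v → ¬? (v ≟ w) →-dec (degree M v ℕ.≟ 1))
  where
  ⊆-respects : (G K : Graph n) → G ≗G K → G ⊆G H → K ⊆G H
  ⊆-respects G K G≗K G⊆H i j e = G⊆H i j (trans (G≗K i j) e)

true⊎false : ∀ b → b ≡ true ⊎ b ≡ false
true⊎false true  = inj₁ refl
true⊎false false = inj₂ refl

-- Allows a subgraph H to stand for the deleted set `delete G H`: a matching that survives this
-- deletion lies in H.
delete-delete-⊆ : (G H : Graph n) → delete G (delete G H) ⊆G H
delete-delete-⊆ G H i j e with true⊎false (adj H i j)
... | inj₁ h = h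
... | inj₂ ¬h = ⊥-elim (true≢false (delete-intro G H (delete-⊆ G (delete G H) i j e) ¬h)
                                   (delete-avoids G (delete G H) e))

-- mp(G) ≥ k, phrased in terms of the graphs left after deletion.
Robust : Graph n → ℕ → Set
Robust G k = ∀ H → H ⊆G G → edges G < edges H + k → HasPMorAPM H

MP⇒Robust : (G : Graph n) → MP G k → Robust G k
MP⇒Robust {k = k} G (_ , survives) H H⊆G lt = HasPMorAPM-mono (delete G (delete G H)) H (delete-delete-⊆ G H) (survives (delete G H) (delete-⊆ G H) small)
  where
  small : edges (delete G H) < k
  small = +-cancelʳ-< (edges H) _ _ (subst₂ _<_ (≡-sym (edges-delete G H H⊆G)) (+-comm (edges H) k) lt)

∃-edge : (G : Graph n) → 0 < edges G → ∃₂ λ u v → adj G u v ≡ true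
∃-edge G pos with find (λ i → does (any? λ j → adj G i j 𝔹.≟ true))
... | inj₁ (u , e) with any? (λ j → adj G u j 𝔹.≟ true) | e
...   | yes (v , a) | _ = u , v , a
∃-edge {n} G pos | inj₂ none = ⊥-elim (<⇒≢ pos (≡-sym (*-cancelˡ-≡ _ 0 2 (trans (handshake G) (sum-zero _ λ i → sum-zero _ λ j → cong ⟦_⟧ (noEdge i j))))))
  where
  noEdge : ∀ i j → adj G i j ≡ false
  noEdge i j with any? (λ j → adj G i j 𝔹.≟ true) | none i
  ... | no ¬e | _ = 𝔹.¬-not (λ a → ¬e (j , a))

-- With two or more vertices some vertex has to be covered. On a single vertex the empty graph does
-- have an almost perfect matching, which is why the descent below starts at two vertices.
HasPMorAPM⇒edge : (H : Graph (suc (suc n))) → HasPMorAPM H → 0 < edges H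
HasPMorAPM⇒edge {n} H pm = n≢0⇒n>0 λ e≡0 → contradict pm (edges-≡0 H e≡0)
  where
  unmatched : ∀ (M : Graph (suc (suc n))) → M ⊆G H → (∀ i j → adj H i j ≡ false) → ∀ v → degree M v ≢ 1
  unmatched M M⊆H none v d = contradiction (trans (≡-sym d) (trans (degree≡deg M v) (sum-zero _ λ j → cong ⟦_⟧ (𝔹.¬-not λ e → true≢false (M⊆H v j e) (none v j))))) λ ()
  contradict : HasPMorAPM H → (∀ i j → adj H i j ≡ false) → ⊥
  contradict (inj₁ (M , s , d)) none = unmatched M s none zero (d zero)
  contradict (inj₂ (M , s , zero , _ , d)) none = unmatched M s none (suc zero) (d (suc zero) λ ())
  contradict (inj₂ (M , s , suc w , _ , d)) none = unmatched M s none zero (d zero λ ())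

-- The erased edge is charged as one of the k deletions that `Robust G (suc k)` tolerates.
Robust-eraseEdge : (G : Graph n) {u v : Fin n} → adj G u v ≡ true → Robust G (suc k) → Robust (eraseEdge G u v) k
Robust-eraseEdge {k = k} G {u} {v} e rob H H⊆ lt = rob H (λ i j → delete-⊆ G (singleEdge u v) i j ∘ H⊆ i j)
  (subst₂ _<_ (trans (+-comm 1 _) (edges-eraseEdge G e)) (≡-sym (+-suc (edges H) k)) (s≤s lt))

-- Erasing one edge lowers mp by at most one, so mp takes the value k on the way down to the empty graph.
exactSubgraph : (G : Graph (suc (suc n))) → Robust G k → Σ (Graph (suc (suc n))) λ G' → MP G' k × edges G' ≤ edges G
exactSubgraph {n} {k} G = go (edges G) G refl
  where
  Breaks : Graph (suc (suc n)) → Graph (suc (suc n)) → Set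
  Breaks G F = F ⊆G G × edges F ≡ k × ¬ HasPMorAPM (delete G F)
  Breaks? : ∀ G → Dec (Σ _ (Breaks G))
  Breaks? G = anyGraph? (Breaks G) respects λ F → (F ⊆G? G) ×-dec ((edges F ℕ.≟ k) ×-dec ¬? (HasPMorAPM? (delete G F)))
    where
    respects : ∀ F F' → F ≗G F' → Breaks G F → Breaks G F'
    respects F F' F≗F' (s , e , ¬pm) = (λ i j a → s i j (trans (F≗F' i j) a))
      , trans (edges-cong F' F (λ i j → ≡-sym (F≗F' i j))) e
      , λ pm → ¬pm (HasPMorAPM-mono (delete G F') (delete G F) (≗G⇒⊆ (delete G F') (delete G F) (λ i j → cong (λ b → adj G i j ∧ not b) (≡-sym (F≗F' i j)))) pm)
  go : ∀ e G → edges G ≡ e → Robust G k → Σ (Graph (suc (suc n))) λ G' → MP G' k × edges G' ≤ edges G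
  go e G eq rob = decide (Breaks? G)
    where
    decide : Dec (Σ _ (Breaks G)) → Σ (Graph (suc (suc n))) λ G' → MP G' k × edges G' ≤ edges G
    decide (yes breaks) = G , (breaks , survives) , ≤-refl
      where
      survives : ∀ F → F ⊆G G → edges F < k → HasPMorAPM (delete G F)
      survives F F⊆G lt = rob (delete G F) (delete-⊆ G F)
        (subst (_< edges (delete G F) + k) (edges-delete G F F⊆G) (+-monoʳ-< (edges (delete G F)) lt))
    decide (no none) = descend e eq
      where
      -- As no k edges break G, deleting exactly k edges also leaves a matching; decidability
      -- removes the double negation.
      rob⁺ : Robust G (suc k)
      rob⁺ H H⊆G lt with m≤n⇒m<n∨m≡n (s≤s⁻¹ (subst (edges G <_) (+-suc (edges H) k) lt))
      ... | inj₁ lt' = rob H H⊆G lt'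
      ... | inj₂ eq' = HasPMorAPM-mono (delete G (delete G H)) H (delete-delete-⊆ G H)
        (decidable-stable (HasPMorAPM? (delete G (delete G H)))
          λ ¬pm → none (delete G H , delete-⊆ G H , edges≡k , ¬pm))
        where
        edges≡k : edges (delete G H) ≡ k
        edges≡k = +-cancelʳ-≡ (edges H) _ _ (trans (edges-delete G H H⊆G) (trans eq' (+-comm (edges H) k)))
      -- With nothing deleted G has a matching, hence an edge that can be erased next.
      pos : 0 < edges G
      pos = HasPMorAPM⇒edge G (rob⁺ G (λ _ _ a → a) (m<m+n (edges G) z<s))
      descend : ∀ e → edges G ≡ e → Σ (Graph (suc (suc n))) λ G' → MP G' k × edges G' ≤ edges G
      descend zero    eq = ⊥-elim (<⇒≢ pos (≡-sym eq))
      descend (suc e) eq =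
        let u , v , a = ∃-edge G pos
            G' , mp , le = go e (eraseEdge G u v)
              (suc-injective (trans (+-comm 1 _) (trans (edges-eraseEdge G a) eq))) (Robust-eraseEdge G a rob⁺)
        in G' , mp , ≤-trans le (edges-mono (eraseEdge G u v) G (delete-⊆ G (singleEdge u v)))

SIs-intro : ∀ m → (∀ (G : Graph (suc (suc n))) → Robust G k → m ≤ edges G) →
  (G : Graph (suc (suc n))) → Robust G k → edges G ≤ m → SIs (suc (suc n)) k m
SIs-intro m lower G rob le =
  let G' , mp , le' = exactSubgraph G rob
  in (G' , mp , ≤-antisym (≤-trans le' le) (lower G' (MP⇒Robust G' mp))) , λ H mpH → lower H (MP⇒Robust H mpH)

-- Lower bounds on the number of edges

∣_∣ : (Fin n → Bool) → ℕ
∣ A ∣ = sumFin (λ i → ⟦ A i ⟧)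

-- Covers perfect and almost perfect matchings at once: at most one vertex of A is missed.
-- Relativising to A keeps the vertex type fixed while leaves are removed, since an induction can
-- shrink A instead of `Fin n`.
NearPerfectOn : (Fin n → Bool) → Graph n → Set
NearPerfectOn {n} A H = Σ (Graph n) λ M → M ⊆G H
  × (∀ v → A v ≡ true → deg M v ≤ 1)
  × (∀ u v → A u ≡ true → A v ≡ true → deg M u ≡ 0 → deg M v ≡ 0 → u ≡ v)

RobustOn : (Fin n → Bool) → Graph n → ℕ → Set
RobustOn A G k = ∀ H → H ⊆G G → edges G < edges H + k → NearPerfectOn A H

HasPMorAPM⇒NearPerfectOn : (A : Fin n → Bool) (H : Graph n) → HasPMorAPM H → NearPerfectOn A H
HasPMorAPM⇒NearPerfectOn A H (inj₁ (M , s , d)) = M , s , (λ v _ → ≤-reflexive (deg≡1 v))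
  , λ u v _ _ u≡0 _ → contradiction (trans (≡-sym u≡0) (deg≡1 u)) λ ()
  where
  deg≡1 : ∀ v → deg M v ≡ 1
  deg≡1 v = trans (≡-sym (degree≡deg M v)) (d v)
HasPMorAPM⇒NearPerfectOn {n} A H (inj₂ (M , s , w , d₀ , d₁)) = M , s
  , (λ v _ → ≤1 v) , λ u v _ _ u≡0 v≡0 → trans (is-w u u≡0) (≡-sym (is-w v v≡0))
  where
  deg≡1 : ∀ v → v ≢ w → deg M v ≡ 1
  deg≡1 v v≢w = trans (≡-sym (degree≡deg M v)) (d₁ v v≢w)
  ≤1 : ∀ v → deg M v ≤ 1
  ≤1 v with toSum (v ≟ w)
  ... | inj₁ refl = ≤-trans (≤-reflexive (trans (≡-sym (degree≡deg M v)) d₀)) z≤n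
  ... | inj₂ v≢w  = ≤-reflexive (deg≡1 v v≢w)
  is-w : ∀ v → deg M v ≡ 0 → v ≡ w
  is-w v v≡0 with toSum (v ≟ w)
  ... | inj₁ v≡w = v≡w
  ... | inj₂ v≢w = contradiction (trans (≡-sym v≡0) (deg≡1 v v≢w)) λ ()

Robust⇒RobustOn : (A : Fin n → Bool) (G : Graph n) → Robust G k → RobustOn A G k
Robust⇒RobustOn A G rob H H⊆G lt = HasPMorAPM⇒NearPerfectOn A H (rob H H⊆G lt)

RobustOn-pred : (A : Fin n → Bool) (G : Graph n) → RobustOn A G (suc k) → RobustOn A G k
RobustOn-pred A G rob H H⊆G lt = rob H H⊆G (<-≤-trans lt (+-monoʳ-≤ (edges H) (n≤1+n _)))

⊆-isolated : (M H : Graph n) {v : Fin n} → M ⊆G H → deg H v ≡ 0 → deg M v ≡ 0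
⊆-isolated M H {v} M⊆H v≡0 = n≤0⇒n≡0 (subst (deg M v ≤_) v≡0 (deg-mono M H M⊆H v))

-- Deleting all the edges at u and v leaves two vertices uncovered.
two-stars : (A : Fin n → Bool) (G : Graph n) → RobustOn A G k → {u v : Fin n} → A u ≡ true → A v ≡ true → u ≢ v →
  k + ⟦ adj G u v ⟧ ≤ deg G u + deg G v
two-stars {n} {k} A G rob {u} {v} Au Av u≢v = ≮⇒≥ λ lt →
  let M , M⊆H , _ , unique = rob H H⊆G (enough lt)
  in u≢v (unique u v Au Av (⊆-isolated M H M⊆H (⊆-isolated H G' (isolate-⊆ G' v) (deg-isolate-self G u)))
                           (⊆-isolated M H M⊆H (deg-isolate-self G' v)))
  where
  G' H : Graph n
  G' = isolate G u
  H = isolate G' v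
  H⊆G : H ⊆G G
  H⊆G i j = isolate-⊆ G u i j ∘ isolate-⊆ G' v i j
  enough : deg G u + deg G v < k + ⟦ adj G u v ⟧ → edges G < edges H + k
  enough lt = +-cancelʳ-< ⟦ adj G u v ⟧ _ _ (begin-strict
    edges G + ⟦ adj G u v ⟧                          ≡⟨ cong (_+ ⟦ adj G u v ⟧) (edges-isolate G u) ⟨
    edges G' + deg G u + ⟦ adj G u v ⟧               ≡⟨ cong (λ e → e + deg G u + ⟦ adj G u v ⟧) (edges-isolate G' v) ⟨
    edges H + deg G' v + deg G u + ⟦ adj G u v ⟧     ≡⟨ shuffle (edges H) (deg G' v) (deg G u) _ ⟩
    edges H + (deg G u + (deg G' v + ⟦ adj G u v ⟧)) ≡⟨ cong (λ d → edges H + (deg G u + d)) (deg-isolate G (u≢v ∘ ≡-sym)) ⟩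
    edges H + (deg G u + deg G v)                    <⟨ +-monoʳ-< (edges H) lt ⟩
    edges H + (k + ⟦ adj G u v ⟧)                    ≡⟨ +-assoc (edges H) k _ ⟨
    edges H + k + ⟦ adj G u v ⟧                      ∎)
    where
    open ≤-Reasoning
    shuffle : ∀ a b c d → a + b + c + d ≡ a + (c + (b + d))
    shuffle = solve-∀

deg≤1-unique : (G : Graph n) {v a b : Fin n} → deg G v ≤ 1 → adj G v a ≡ true → adj G v b ≡ true → a ≡ b
deg≤1-unique G {v} {a} {b} d≤1 ea eb with toSum (a ≟ b)
... | inj₁ a≡b = a≡b
... | inj₂ a≢b = contradiction (≤-trans (two-terms≤sum (λ j → ⟦ adj G v j ⟧) a≢b) d≤1)
  (subst₂ (λ x y → ¬ ⟦ x ⟧ + ⟦ y ⟧ ≤ 1) (≡-sym ea) (≡-sym eb) λ { (s≤s ()) })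

deg>0⇒adj : (G : Graph n) {v : Fin n} → 0 < deg G v → ∃ λ j → adj G v j ≡ true
deg>0⇒adj G {v} pos with find (adj G v)
... | inj₁ x = x
... | inj₂ none = contradiction (sum-zero _ λ j → cong ⟦_⟧ (none j)) (>⇒≢ pos)

adj⇒deg>0 : (G : Graph n) {v j : Fin n} → adj G v j ≡ true → 0 < deg G v
adj⇒deg>0 G {v} {j} e = subst (_≤ deg G v) (cong ⟦_⟧ e) (term≤sum (λ j → ⟦ adj G v j ⟧) j)

without₂ : (Fin n → Bool) → Fin n → Fin n → Fin n → Bool
without₂ A u v i = A i ∧ not ((i == u) ∨ (i == v))

without₂⇒ : (A : Fin n → Bool) (u v i : Fin n) → without₂ A u v i ≡ true → A i ≡ true × i ≢ u × i ≢ v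
without₂⇒ A u v i e = proj₁ (∧-true e)
  , (λ { refl → true≢false (cong (_∨ (i == v)) (==-refl i)) (not-true (proj₂ (∧-true {A i} e))) })
  , (λ { refl → true≢false (trans (cong ((i == u) ∨_) (==-refl i)) (𝔹.∨-zeroʳ (i == u))) (not-true (proj₂ (∧-true {A i} e))) })

∣without₂∣ : (A : Fin n → Bool) {u v : Fin n} → A u ≡ true → A v ≡ true → u ≢ v → ∣ without₂ A u v ∣ + 2 ≡ ∣ A ∣
∣without₂∣ A {u} {v} Au Av u≢v = begin
  ∣ without₂ A u v ∣ + 2                                                 ≡⟨ cong (∣ without₂ A u v ∣ +_) (cong₂ _+_ (sum-== u) (sum-== v)) ⟨
  ∣ without₂ A u v ∣ + (sumFin (λ i → ⟦ i == u ⟧) + sumFin (λ i → ⟦ i == v ⟧)) ≡⟨ cong (∣ without₂ A u v ∣ +_) (sum-+ (λ i → ⟦ i == u ⟧) (λ i → ⟦ i == v ⟧)) ⟨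
  ∣ without₂ A u v ∣ + sumFin (λ i → ⟦ i == u ⟧ + ⟦ i == v ⟧)            ≡⟨ sum-+ (λ i → ⟦ without₂ A u v i ⟧) (λ i → ⟦ i == u ⟧ + ⟦ i == v ⟧) ⟨
  sumFin (λ i → ⟦ without₂ A u v i ⟧ + (⟦ i == u ⟧ + ⟦ i == v ⟧))        ≡⟨ sum-cong split ⟩
  ∣ A ∣                                                                  ∎
  where
  open ≡-Reasoning
  split : ∀ i → ⟦ without₂ A u v i ⟧ + (⟦ i == u ⟧ + ⟦ i == v ⟧) ≡ ⟦ A i ⟧
  split i with i ≟ u | i ≟ v
  ... | yes refl | yes refl = ⊥-elim (u≢v refl)
  ... | yes refl | no _ rewrite Au = refl
  ... | no _ | yes refl rewrite Av = refl
  ... | no _ | no _ rewrite 𝔹.∧-identityʳ (A i) = +-identityʳ _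

-- By symmetry of the adjacency, the condition on the first end covers both.
Inside : (Fin n → Bool) → Graph n → Set
Inside A G = ∀ i j → adj G i j ≡ true → A i ≡ true

-- A leaf v and its neighbour u can be removed: a near perfect matching of G must cover u,
-- and what it does not cover outside {u , v} after losing its edge at u is again at most one vertex.
module Peel (A : Fin n → Bool) (G : Graph n) (inside : Inside A G) (rob : RobustOn A G k)
            {v : Fin n} (Av : A v ≡ true) (leaf : deg G v ≡ 1) where

  private
    nbr = deg>0⇒adj G {v} (≤-reflexive (≡-sym leaf))
    u = proj₁ nbr
    v~u = proj₂ nbr
    Au : A u ≡ true
    Au = inside u v (trans (sym G u v) v~u)
    u≢v : u ≢ v
    u≢v = adj⇒≢ G v~u ∘ ≡-sym
    only-u : ∀ {j} → adj G v j ≡ true → j ≡ u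
    only-u e = deg≤1-unique G (≤-reflexive leaf) e v~u

  A' : Fin n → Bool
  A' = without₂ A u v

  G' : Graph n
  G' = isolate G u

  size : ∣ A' ∣ + 2 ≡ ∣ A ∣
  size = ∣without₂∣ A Au Av u≢v

  fewer-edges : edges G' + k ≤ edges G
  fewer-edges = begin
    edges G' + k        ≤⟨ +-monoʳ-≤ (edges G') k≤degu ⟩
    edges G' + deg G u  ≡⟨ edges-isolate G u ⟩
    edges G             ∎
    where
    open ≤-Reasoning
    -- For adjacent vertices `two-stars` gains one, which is exactly the degree of the leaf.
    k≤degu : k ≤ deg G u
    k≤degu = +-cancelʳ-≤ 1 _ _ (subst₂ (λ a b → k + ⟦ a ⟧ ≤ deg G u + b) (trans (sym G u v) v~u) leaf
      (two-stars A G rob Au Av u≢v))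

  inside' : Inside A' G'
  inside' i j e with toSum (i ≟ u) | toSum (i ≟ v)
  ... | inj₁ refl | _ = ⊥-elim (true≢false e (deg-≡0 G' (deg-isolate-self G u) j))
  ... | inj₂ _ | inj₁ refl = ⊥-elim (true≢false (trans (sym G' u i) (subst (λ j → adj G' i j ≡ true) (only-u (isolate-⊆ G u i j e)) e))
                                                (deg-≡0 G' (deg-isolate-self G u) i))
  ... | inj₂ i≢u | inj₂ i≢v = ∧-intro (inside i j (isolate-⊆ G u i j e)) (cong not (cong₂ _∨_ (≢⇒== i≢u) (≢⇒== i≢v)))

  robust' : RobustOn A' G' k
  robust' H' H'⊆G' lt =
    let M , M⊆H , ≤1 , unique = rob H (delete-⊆ G F) enough
    in isolate M u , survives M M⊆H , (λ y A'y → ≤-trans (deg-mono (isolate M u) M (isolate-⊆ M u) y) (≤1 y (proj₁ (without₂⇒ A u v y A'y))))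
     , uncovered M M⊆H ≤1 unique
    where
    -- The edges missing from H' are deleted from G rather than from G', so H keeps all the edges at
    -- u.
    F H : Graph n
    F = delete G' H'
    H = delete G F
    F⊆G : F ⊆G G
    F⊆G i j e = isolate-⊆ G u i j (delete-⊆ G' H' i j e)
    enough : edges G < edges H + k
    enough = +-cancelʳ-< (edges G') _ _ (begin-strict
      edges G + edges G'                      <⟨ +-monoʳ-< (edges G) lt ⟩
      edges G + (edges H' + k)                ≡⟨ cong (_+ (edges H' + k)) (edges-delete G F F⊆G) ⟨
      edges H + edges F + (edges H' + k)      ≡⟨ shuffle (edges H) (edges F) (edges H') k ⟩
      edges H + k + (edges F + edges H')      ≡⟨ cong (edges H + k +_) (edges-delete G' H' H'⊆G') ⟩
      edges H + k + edges G'                  ∎)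
      where
      open ≤-Reasoning
      shuffle : ∀ a b c d → a + b + (c + d) ≡ a + d + (b + c)
      shuffle = solve-∀
    survives : ∀ M → M ⊆G H → isolate M u ⊆G H'
    survives M M⊆H i j e with toSum (i ≟ u) | toSum (j ≟ u) | true⊎false (adj H' i j)
    ... | _ | _ | inj₁ h = h
    ... | inj₁ refl | _ | _ = ⊥-elim (true≢false e (deg-≡0 (isolate M u) (deg-isolate-self M u) j))
    ... | _ | inj₁ refl | _ = ⊥-elim (true≢false (trans (sym (isolate M u) u i) e) (deg-≡0 (isolate M u) (deg-isolate-self M u) i))
    ... | inj₂ i≢u | inj₂ j≢u | inj₂ ¬h = ⊥-elim (true≢false
      (delete-intro G' H' (isolate-intro G i≢u j≢u (delete-⊆ G F i j h)) ¬h) (delete-avoids G F h))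
      where
      h : adj H i j ≡ true
      h = M⊆H i j (isolate-⊆ M u i j e)
    uncovered : ∀ M → M ⊆G H → (∀ y → A y ≡ true → deg M y ≤ 1)
      → (∀ y z → A y ≡ true → A z ≡ true → deg M y ≡ 0 → deg M z ≡ 0 → y ≡ z)
      → ∀ y z → A' y ≡ true → A' z ≡ true → deg (isolate M u) y ≡ 0 → deg (isolate M u) z ≡ 0 → y ≡ z
    uncovered M M⊆H ≤1 unique y z A'y A'z y≡0 z≡0 with true⊎false (adj M u v)
    -- If M contains the edge u v, then isolating u uncovers nothing else outside the pair.
    ... | inj₁ uv = unique y z (A⁻ A'y) (A⁻ A'z) (free A'y y≡0) (free A'z z≡0)
      where
      A⁻ : ∀ {y} → A' y ≡ true → A y ≡ true
      A⁻ {y} = proj₁ ∘ without₂⇒ A u v y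
      free : ∀ {y} → A' y ≡ true → deg (isolate M u) y ≡ 0 → deg M y ≡ 0
      free {y} A'y y≡0 = let _ , y≢u , y≢v = without₂⇒ A u v y A'y in
        trans (≡-sym (deg-isolate M y≢u)) (cong₂ _+_ y≡0
          (cong ⟦_⟧ (𝔹.¬-not λ uy → y≢v (deg≤1-unique M (≤1 u Au) uy uv))))
    -- Otherwise v, whose only neighbour is u, is the vertex that M misses. Any other vertex left
    -- uncovered after isolating u must be the partner of u, and there is at most one.
    ... | inj₂ ¬uv = deg≤1-unique M (≤1 u Au) (matched A'y y≡0) (matched A'z z≡0)
      where
      v≡0 : deg M v ≡ 0
      v≡0 = sum-zero _ λ j → cong ⟦_⟧ (𝔹.¬-not λ vj →
        true≢false (trans (sym M u v) (subst (λ j → adj M v j ≡ true) (only-u (delete-⊆ G F v j (M⊆H v j vj))) vj)) ¬uv)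
      matched : ∀ {y} → A' y ≡ true → deg (isolate M u) y ≡ 0 → adj M u y ≡ true
      matched {y} A'y y≡0 with without₂⇒ A u v y A'y | true⊎false (adj M u y)
      ... | _ | inj₁ uy = uy
      ... | Ay , y≢u , y≢v | inj₂ ¬uy = ⊥-elim (y≢v (unique y v Ay Av
        (trans (≡-sym (deg-isolate M y≢u)) (cong₂ _+_ y≡0 (cong ⟦_⟧ ¬uy))) v≡0))

deg-sum-bound : (A : Fin n → Bool) (G : Graph n) (c : ℕ) → (∀ v → A v ≡ true → c ≤ deg G v) → c * ∣ A ∣ ≤ 2 * edges G
deg-sum-bound A G c c≤ = begin
  c * ∣ A ∣                       ≡⟨ sum-*ˡ c (λ i → ⟦ A i ⟧) ⟨
  sumFin (λ i → c * ⟦ A i ⟧)      ≤⟨ sum-mono-≤ bound ⟩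
  sumFin (deg G)                  ≡⟨ handshake G ⟨
  2 * edges G                     ∎
  where
  open ≤-Reasoning
  bound : ∀ i → c * ⟦ A i ⟧ ≤ deg G i
  bound i with true⊎false (A i)
  ... | inj₁ Ai = ≤-trans (≤-reflexive (trans (cong (λ b → c * ⟦ b ⟧) Ai) (*-identityʳ c))) (c≤ i Ai)
  ... | inj₂ ¬Ai = ≤-trans (≤-reflexive (trans (cong (λ b → c * ⟦ b ⟧) ¬Ai) (*-zeroʳ c))) z≤n

deg-sum-bound-except : (A : Fin n → Bool) (G : Graph n) (c : ℕ) {w : Fin n} → (∀ v → A v ≡ true → v ≢ w → c ≤ deg G v) →
  c * ∣ A ∣ ≤ 2 * edges G + c
deg-sum-bound-except A G c {w} c≤ = begin
  c * ∣ A ∣                                  ≡⟨ sum-*ˡ c (λ i → ⟦ A i ⟧) ⟨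
  sumFin (λ i → c * ⟦ A i ⟧)                 ≤⟨ sum-mono-≤ bound ⟩
  sumFin (λ i → deg G i + c * ⟦ i == w ⟧)    ≡⟨ sum-+ (deg G) (λ i → c * ⟦ i == w ⟧) ⟩
  sumFin (deg G) + sumFin (λ i → c * ⟦ i == w ⟧) ≡⟨ cong₂ _+_ (≡-sym (handshake G)) (trans (sum-*ˡ c (λ i → ⟦ i == w ⟧)) (cong (c *_) (sum-== w))) ⟩
  2 * edges G + c * 1                        ≡⟨ cong (2 * edges G +_) (*-identityʳ c) ⟩
  2 * edges G + c                            ∎
  where
  open ≤-Reasoning
  bound : ∀ i → c * ⟦ A i ⟧ ≤ deg G i + c * ⟦ i == w ⟧
  bound i with toSum (i ≟ w) | true⊎false (A i)
  ... | _ | inj₂ ¬Ai = ≤-trans (≤-reflexive (trans (cong (λ b → c * ⟦ b ⟧) ¬Ai) (*-zeroʳ c))) z≤n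
  ... | inj₁ refl | _ = ≤-trans (*-monoʳ-≤ c (⟦⟧≤1 (A i)))
    (≤-trans (≤-reflexive (cong (λ b → c * ⟦ b ⟧) (≡-sym (==-refl i)))) (m≤n+m _ (deg G i)))
  ... | inj₂ i≢w | inj₁ Ai = ≤-trans (*-monoʳ-≤ c (⟦⟧≤1 (A i)))
    (≤-trans (≤-reflexive (*-identityʳ c)) (≤-trans (c≤ i Ai i≢w) (m≤m+n _ _)))

-- In `two-stars` an isolated w leaves the whole of k to the other vertex.
isolated⇒others : (A : Fin n → Bool) (G : Graph n) → RobustOn A G k → {w : Fin n} → A w ≡ true → deg G w ≡ 0 →
  ∀ v → A v ≡ true → v ≢ w → k ≤ deg G v
isolated⇒others {k = k} A G rob {w} Aw w≡0 v Av v≢w = begin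
  k                          ≤⟨ m≤m+n k _ ⟩
  k + ⟦ adj G v w ⟧          ≤⟨ two-stars A G rob Av Aw v≢w ⟩
  deg G v + deg G w          ≡⟨ cong (deg G v +_) w≡0 ⟩
  deg G v + 0                ≡⟨ +-identityʳ _ ⟩
  deg G v                    ∎
  where open ≤-Reasoning

degree-cases : (A : Fin n → Bool) (G : Graph n) →
  (∃ λ v → A v ≡ true × deg G v ≡ 0) ⊎ (∃ λ v → A v ≡ true × deg G v ≡ 1) ⊎ (∀ v → A v ≡ true → 2 ≤ deg G v)
degree-cases A G with any? (λ v → (A v 𝔹.≟ true) ×-dec (deg G v ℕ.≟ 0)) | any? (λ v → (A v 𝔹.≟ true) ×-dec (deg G v ℕ.≟ 1))
... | yes x | _ = inj₁ x
... | no _ | yes y = inj₂ (inj₁ y)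
... | no ¬x | no ¬y = inj₂ (inj₂ λ v Av → ≤∧≢⇒< (n≢0⇒n>0 λ d → ¬x (v , Av , d)) λ d → ¬y (v , Av , ≡-sym d))

-- Induction on the size of A, bounded by `fuel`. Without leaves all degrees are at least 2, up to
-- one isolated vertex, which accounts for the summand 1; peeling a leaf takes away two vertices and
-- at least two edges.
robust-2⇒edges : ∀ fuel (A : Fin n → Bool) (G : Graph n) → ∣ A ∣ ≤ fuel → Inside A G → RobustOn A G 2 → ∣ A ∣ ≤ edges G + 1
robust-2⇒edges fuel A G le inside rob with degree-cases A G
... | inj₁ (w , Aw , w≡0) = *-cancelˡ-≤ 2 (≤-trans (deg-sum-bound-except A G 2 (isolated⇒others A G rob Aw w≡0))
  (≤-reflexive (≡-sym (*-distribˡ-+ 2 (edges G) 1))))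
... | inj₂ (inj₂ 2≤) = ≤-trans (*-cancelˡ-≤ 2 (deg-sum-bound A G 2 2≤)) (m≤m+n (edges G) 1)
robust-2⇒edges zero A G le inside rob | inj₂ (inj₁ _) = ≤-trans le z≤n
robust-2⇒edges (suc fuel) A G le inside rob | inj₂ (inj₁ (v , Av , leaf)) = begin
  ∣ A ∣                     ≡⟨ P.size ⟨
  ∣ P.A' ∣ + 2              ≤⟨ +-monoˡ-≤ 2 (robust-2⇒edges fuel P.A' P.G' smaller P.inside' P.robust') ⟩
  edges P.G' + 1 + 2        ≡⟨ shuffle (edges P.G') ⟩
  edges P.G' + 2 + 1        ≤⟨ +-monoˡ-≤ 1 P.fewer-edges ⟩
  edges G + 1               ∎
  where
  open ≤-Reasoning
  module P = Peel A G inside rob Av leaf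
  shuffle : ∀ a → a + 1 + 2 ≡ a + 2 + 1
  shuffle = solve-∀
  smaller : ∣ P.A' ∣ ≤ fuel
  smaller = linear _ _ 1 (subst (_≤ suc fuel) (≡-sym P.size) le) (eq ∣ P.A' ∣ fuel)
    where
    eq : ∀ a f → a + suc f + 1 ≡ f + (a + 2)
    eq = solve-∀

everywhere : Fin n → Bool
everywhere _ = true

∣everywhere∣ : ∣ everywhere {n} ∣ ≡ n
∣everywhere∣ {n} = trans (sum-const n 1) (*-identityʳ n)

module _ {n : ℕ} (G : Graph n) where

  lower-1 : Robust G 1 → n ≤ 2 * edges G + 1
  lower-1 rob with Robust⇒RobustOn everywhere G rob G (λ _ _ e → e) (m<m+n (edges G) z<s)
  ... | M , M⊆G , _ , unique with any? (λ v → deg M v ℕ.≟ 0)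
  ... | yes (w , w≡0) = begin
    n                      ≡⟨ trans (*-identityˡ _) ∣everywhere∣ ⟨
    1 * ∣ everywhere {n} ∣ ≤⟨ deg-sum-bound-except everywhere M 1 (λ v _ v≢w → n≢0⇒n>0 λ v≡0 → v≢w (unique v w refl refl v≡0 w≡0)) ⟩
    2 * edges M + 1        ≤⟨ +-monoˡ-≤ 1 (*-monoʳ-≤ 2 (edges-mono M G M⊆G)) ⟩
    2 * edges G + 1        ∎
    where open ≤-Reasoning
  ... | no none = begin
    n                      ≡⟨ trans (*-identityˡ _) ∣everywhere∣ ⟨
    1 * ∣ everywhere {n} ∣ ≤⟨ deg-sum-bound everywhere M 1 (λ v _ → n≢0⇒n>0 λ v≡0 → none (v , v≡0)) ⟩
    2 * edges M            ≤⟨ *-monoʳ-≤ 2 (edges-mono M G M⊆G) ⟩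
    2 * edges G            ≤⟨ m≤m+n _ 1 ⟩
    2 * edges G + 1        ∎
    where open ≤-Reasoning

  lower-2 : Robust G 2 → n ≤ edges G + 1
  lower-2 rob = subst (_≤ edges G + 1) ∣everywhere∣
    (robust-2⇒edges _ everywhere G ≤-refl (λ _ _ _ → refl) (Robust⇒RobustOn everywhere G rob))

  lower-3 : 3 ≤ n → Robust G 3 → n ≤ edges G
  lower-3 3≤n rob = subst (_≤ edges G) ∣everywhere∣ (bound (degree-cases everywhere G))
    where
    open ≤-Reasoning
    rob′ : RobustOn everywhere G 3
    rob′ = Robust⇒RobustOn everywhere G rob
    bound : _ → ∣ everywhere {n} ∣ ≤ edges G
    -- The other n - 1 vertices have degree at least 3, and 3 (n - 1) ≥ 2 n as soon as n ≥ 3.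
    bound (inj₁ (w , _ , w≡0)) = *-cancelˡ-≤ 2 (+-cancelʳ-≤ 3 _ _ (begin
      2 * ∣ everywhere {n} ∣ + 3                       ≤⟨ +-monoʳ-≤ _ (subst (3 ≤_) (≡-sym ∣everywhere∣) 3≤n) ⟩
      2 * ∣ everywhere {n} ∣ + ∣ everywhere {n} ∣      ≡⟨ eq ∣ everywhere {n} ∣ ⟩
      3 * ∣ everywhere {n} ∣                           ≤⟨ deg-sum-bound-except everywhere G 3 (isolated⇒others everywhere G rob′ refl w≡0) ⟩
      2 * edges G + 3                                  ∎))
      where
      eq : ∀ a → 2 * a + a ≡ 3 * a
      eq = solve-∀
    bound (inj₂ (inj₂ 2≤)) = *-cancelˡ-≤ 2 (deg-sum-bound everywhere G 2 2≤)
    -- A single peeling suffices: it takes at least three edges for two vertices, which pays for the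
    -- summand 1 in the bound for k = 2.
    bound (inj₂ (inj₁ (v , _ , leaf))) = begin
      ∣ everywhere {n} ∣  ≡⟨ P.size ⟨
      ∣ P.A' ∣ + 2        ≤⟨ +-monoˡ-≤ 2 (robust-2⇒edges _ P.A' P.G' ≤-refl P.inside' (RobustOn-pred P.A' P.G' P.robust')) ⟩
      edges P.G' + 1 + 2  ≡⟨ +-assoc (edges P.G') 1 2 ⟩
      edges P.G' + 3      ≤⟨ P.fewer-edges ⟩
      edges G             ∎
      where module P = Peel everywhere G (λ _ _ _ → refl) rob′ refl leaf

  two-stars′ : Robust G k → ∀ {u v} → u ≢ v → k + ⟦ adj G u v ⟧ ≤ deg G u + deg G v
  two-stars′ rob = two-stars everywhere G (Robust⇒RobustOn everywhere G rob) refl refl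

  -- The bound of two-stars′ summed over all ordered pairs u ≢ v, without subtraction.
  lower-average : Robust G k → n * (n * k) + 6 * edges G ≤ 4 * (n * edges G) + n * k
  lower-average {k} rob = begin
    n * (n * k) + 6 * edges G ≡⟨ lhs ⟨
    sumFin (λ u → sumFin (λ v → k + ⟦ adj G u v ⟧ + ⟦ v == u ⟧ * (deg G u + deg G v))) ≤⟨ sum-mono-≤ (λ u → sum-mono-≤ (cell u)) ⟩
    sumFin (λ u → sumFin (λ v → deg G u + deg G v + ⟦ v == u ⟧ * k)) ≡⟨ rhs ⟩
    4 * (n * edges G) + n * k ∎
    where
    open ≤-Reasoning
    -- The diagonal terms are exchanged between the two sides, so that the inequality is an equality
    -- at v = u.
    cell : ∀ u v → k + ⟦ adj G u v ⟧ + ⟦ v == u ⟧ * (deg G u + deg G v) ≤ deg G u + deg G v + ⟦ v == u ⟧ * k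
    cell u v with toSum (v ≟ u)
    ... | inj₁ refl = ≤-reflexive (trans (cong₂ (λ a b → k + ⟦ a ⟧ + ⟦ b ⟧ * (deg G u + deg G u)) (irrefl G u) (==-refl u))
      (trans (eq k (deg G u + deg G u)) (cong (λ b → deg G u + deg G u + ⟦ b ⟧ * k) (≡-sym (==-refl u)))))
      where
      eq : ∀ a b → a + 0 + 1 * b ≡ b + 1 * a
      eq = solve-∀
    ... | inj₂ v≢u = subst (λ b → k + ⟦ adj G u v ⟧ + ⟦ b ⟧ * (deg G u + deg G v) ≤ deg G u + deg G v + ⟦ b ⟧ * k) (≡-sym (≢⇒== v≢u))
      (+-monoˡ-≤ 0 (two-stars′ rob (v≢u ∘ ≡-sym)))
    row-l : ∀ u → sumFin (λ v → k + ⟦ adj G u v ⟧ + ⟦ v == u ⟧ * (deg G u + deg G v)) ≡ n * k + 3 * deg G u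
    row-l u = trans (sum-+ (λ v → k + ⟦ adj G u v ⟧) (λ v → ⟦ v == u ⟧ * (deg G u + deg G v)))
      (trans (cong₂ _+_ (trans (sum-+ (λ _ → k) (λ v → ⟦ adj G u v ⟧)) (cong (_+ deg G u) (sum-const n k))) (sum-δ u (λ v → deg G u + deg G v)))
      (eq (n * k) (deg G u)))
      where
      eq : ∀ a d → a + d + (d + d) ≡ a + 3 * d
      eq = solve-∀
    lhs : sumFin (λ u → sumFin (λ v → k + ⟦ adj G u v ⟧ + ⟦ v == u ⟧ * (deg G u + deg G v))) ≡ n * (n * k) + 6 * edges G
    lhs = trans (sum-cong row-l) (trans (sum-+ (λ _ → n * k) (λ u → 3 * deg G u))
      (cong₂ _+_ (sum-const n (n * k)) (trans (sum-*ˡ 3 (deg G)) (trans (cong (3 *_) (≡-sym (handshake G))) (eq (edges G))))))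
      where
      eq : ∀ e → 3 * (2 * e) ≡ 6 * e
      eq = solve-∀
    row-r : ∀ u → sumFin (λ v → deg G u + deg G v + ⟦ v == u ⟧ * k) ≡ n * deg G u + (2 * edges G + k)
    row-r u = trans (sum-+ (λ v → deg G u + deg G v) (λ v → ⟦ v == u ⟧ * k))
      (trans (cong₂ _+_ (trans (sum-+ (λ _ → deg G u) (deg G)) (cong₂ _+_ (sum-const n (deg G u)) (≡-sym (handshake G)))) (sum-δ u (λ _ → k)))
      (+-assoc (n * deg G u) (2 * edges G) k))
    rhs : sumFin (λ u → sumFin (λ v → deg G u + deg G v + ⟦ v == u ⟧ * k)) ≡ 4 * (n * edges G) + n * k
    rhs = trans (sum-cong row-r) (trans (sum-+ (λ u → n * deg G u) (λ _ → 2 * edges G + k))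
      (trans (cong₂ _+_ (trans (sum-*ˡ n (deg G)) (cong (n *_) (≡-sym (handshake G)))) (sum-const n (2 * edges G + k)))
      (eq n (edges G) k)))
      where
      eq : ∀ n e k → n * (2 * e) + n * (2 * e + k) ≡ 4 * (n * e) + n * k
      eq = solve-∀

-- Lower bounds for k close to 2n - 3, read in the complement

complement : Graph n → Graph n
complement G = fromRelation (λ i j → not (adj G i j)) (λ i j → cong not (sym G i j))

complement-intro : (G : Graph n) {u v : Fin n} → u ≢ v → adj G u v ≡ false → adj (complement G) u v ≡ true
complement-intro G u≢v e = fromRelation-intro {p = λ i j → not (adj G i j)} u≢v (cong not e)

adj+complement : (G : Graph n) {u v : Fin n} → u ≢ v → ⟦ adj G u v ⟧ + ⟦ adj (complement G) u v ⟧ ≡ 1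
adj+complement G {u} {v} u≢v rewrite ≢⇒== u≢v with adj G u v
... | true  = refl
... | false = refl

deg+complement : (G : Graph n) (v : Fin n) → deg G v + deg (complement G) v + 1 ≡ n
deg+complement {n} G v = begin
  deg G v + deg (complement G) v + 1 ≡⟨ cong₂ _+_ (sum-+ (λ j → ⟦ adj G v j ⟧) (λ j → ⟦ adj (complement G) v j ⟧)) (sum-== v) ⟨
  sumFin (λ j → ⟦ adj G v j ⟧ + ⟦ adj (complement G) v j ⟧) + sumFin (λ j → ⟦ j == v ⟧) ≡⟨ sum-+ _ (λ j → ⟦ j == v ⟧) ⟨
  sumFin (λ j → ⟦ adj G v j ⟧ + ⟦ adj (complement G) v j ⟧ + ⟦ j == v ⟧) ≡⟨ sum-cong cell ⟩
  sumFin {n} (λ _ → 1) ≡⟨ ∣everywhere∣ ⟩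
  n ∎
  where
  open ≡-Reasoning
  cell : ∀ j → ⟦ adj G v j ⟧ + ⟦ adj (complement G) v j ⟧ + ⟦ j == v ⟧ ≡ 1
  cell j with toSum (j ≟ v)
  ... | inj₁ refl rewrite ==-refl j | irrefl G j = refl
  ... | inj₂ j≢v = trans (cong₂ _+_ (adj+complement G (j≢v ∘ ≡-sym)) (cong ⟦_⟧ (≢⇒== j≢v))) refl

edges+complement : (G : Graph n) → 2 * (edges G + edges (complement G)) + n ≡ n * n
edges+complement {n} G = begin
  2 * (edges G + edges (complement G)) + n ≡⟨ cong (_+ n) (*-distribˡ-+ 2 (edges G) (edges (complement G))) ⟩
  2 * edges G + 2 * edges (complement G) + n ≡⟨ cong₂ _+_ (cong₂ _+_ (handshake G) (handshake (complement G))) (≡-sym (∣everywhere∣ {n})) ⟩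
  sumFin (deg G) + sumFin (deg (complement G)) + sumFin {n} (λ _ → 1) ≡⟨ cong (_+ sumFin {n} (λ _ → 1)) (sum-+ (deg G) (deg (complement G))) ⟨
  sumFin (λ v → deg G v + deg (complement G) v) + sumFin {n} (λ _ → 1) ≡⟨ sum-+ {n} _ (λ _ → 1) ⟨
  sumFin (λ v → deg G v + deg (complement G) v + 1) ≡⟨ sum-cong (deg+complement G) ⟩
  sumFin {n} (λ _ → n) ≡⟨ sum-const n n ⟩
  n * n ∎
  where open ≡-Reasoning

-- For s = 2n - 3 - k this is `two-stars′` translated to the complement C: degrees become n - 1
-- minus the old ones, and the correction for adjacency changes sides.
SparsePairs : Graph n → ℕ → Set
SparsePairs C s = ∀ {u v} → u ≢ v → deg C u + deg C v ≤ s + ⟦ adj C u v ⟧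

robust⇒sparse-complement : (G : Graph n) (s : ℕ) → k + 3 + s ≡ 2 * n → Robust G k → SparsePairs (complement G) s
robust⇒sparse-complement {n} {k} G s k+3+s≡2n rob {u} {v} u≢v =
  linear _ _ 0 (two-stars′ G rob u≢v) (identity (deg G u) (deg G v) (deg C u) (deg C v) ⟦ adj G u v ⟧ ⟦ adj C u v ⟧
    (deg+complement G u) (deg+complement G v) (adj+complement G u≢v) k+3+s≡2n)
  where
  C = complement G
  identity : ∀ d d' c c' a b → d + c + 1 ≡ n → d' + c' + 1 ≡ n → a + b ≡ 1 → k + 3 + s ≡ 2 * n →
    c + c' + (d + d') + 0 ≡ s + b + (k + a)
  identity d d' c c' a b p q r t = +-cancelʳ-≡ 2 _ _ (begin
    c + c' + (d + d') + 0 + 2         ≡⟨ eq₁ c c' d d' ⟩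
    (d + c + 1) + (d' + c' + 1)       ≡⟨ cong₂ _+_ p q ⟩
    n + n                             ≡⟨ cong (n +_) (+-identityʳ n) ⟨
    2 * n                             ≡⟨ t ⟨
    k + 3 + s                         ≡⟨ eq₂ k s ⟩
    s + k + 1 + 2                     ≡⟨ cong (λ x → s + k + x + 2) r ⟨
    s + k + (a + b) + 2               ≡⟨ eq₃ s k a b ⟩
    s + b + (k + a) + 2               ∎)
    where
    open ≡-Reasoning
    eq₁ : ∀ c c' d d' → c + c' + (d + d') + 0 + 2 ≡ (d + c + 1) + (d' + c' + 1)
    eq₁ = solve-∀
    eq₂ : ∀ k s → k + 3 + s ≡ s + k + 1 + 2
    eq₂ = solve-∀
    eq₃ : ∀ s k a b → s + k + (a + b) + 2 ≡ s + b + (k + a) + 2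
    eq₃ = solve-∀

-- If u has degree at least s, only u and its neighbours can have positive degree.
sparse⇒edges≤ : (C : Graph n) (s : ℕ) → SparsePairs C s → {u : Fin n} → s ≤ deg C u → 0 < deg C u → edges C ≤ s
sparse⇒edges≤ C s sparse {u} s≤ pos = *-cancelˡ-≤ 2 (begin
  2 * edges C                                      ≡⟨ handshake C ⟩
  sumFin (deg C)                                   ≤⟨ sum-mono-≤ cell ⟩
  sumFin (λ v → ⟦ v == u ⟧ * deg C v + ⟦ adj C u v ⟧) ≡⟨ trans (sum-+ (λ v → ⟦ v == u ⟧ * deg C v) (λ v → ⟦ adj C u v ⟧)) (cong (_+ deg C u) (sum-δ u (deg C))) ⟩
  deg C u + deg C u                                ≤⟨ +-mono-≤ ≤s ≤s ⟩
  s + s                                            ≡⟨ cong (s +_) (+-identityʳ s) ⟨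
  2 * s                                            ∎)
  where
  open ≤-Reasoning
  ≤s : deg C u ≤ s
  ≤s = let x , ux = deg>0⇒adj C pos in +-cancelʳ-≤ 1 _ _ (begin
    deg C u + 1          ≤⟨ +-monoʳ-≤ (deg C u) (adj⇒deg>0 C (trans (sym C x u) ux)) ⟩
    deg C u + deg C x    ≤⟨ sparse (adj⇒≢ C ux) ⟩
    s + ⟦ adj C u x ⟧    ≤⟨ +-monoʳ-≤ s (⟦⟧≤1 _) ⟩
    s + 1                ∎)
  cell : ∀ v → deg C v ≤ ⟦ v == u ⟧ * deg C v + ⟦ adj C u v ⟧
  cell v with toSum (v ≟ u)
  ... | inj₁ refl = subst (λ b → deg C v ≤ ⟦ b ⟧ * deg C v + ⟦ adj C v v ⟧) (≡-sym (==-refl v)) (≤-trans (m≤m+n _ 0) (m≤m+n _ _))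
  ... | inj₂ v≢u = subst (λ b → deg C v ≤ ⟦ b ⟧ * deg C v + ⟦ adj C u v ⟧) (≡-sym (≢⇒== v≢u))
    (+-cancelˡ-≤ s _ _ (≤-trans (+-monoˡ-≤ (deg C v) s≤) (sparse (v≢u ∘ ≡-sym))))

-- When s ≤ 1, every vertex of positive degree has degree at least s, so `sparse⇒edges≤` applies at
-- any of them.
sparse≤1 : (C : Graph n) {s : ℕ} → s ≤ 1 → SparsePairs C s → edges C ≤ s
sparse≤1 C {s} s≤1 sparse with any? (λ u → 1 ≤? deg C u)
... | yes (u , 1≤) = sparse⇒edges≤ C s sparse (≤-trans s≤1 1≤) 1≤
... | no none = ≤-trans (*-cancelˡ-≤ 2 (≤-reflexive (trans (handshake C) (sum-zero _ λ u → n<1⇒n≡0 (≰⇒> λ 1≤ → none (u , 1≤)))))) z≤n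

-- Either C is a matching, with at most n/2 edges, or some degree is at least 2 and C has at most
-- two edges, which n ≥ 4 makes small enough.
sparse-2 : (C : Graph n) → 4 ≤ n → SparsePairs C 2 → 2 * edges C ≤ n
sparse-2 {n} C 4≤n sparse with any? (λ u → 2 ≤? deg C u)
... | yes (u , 2≤) = ≤-trans (*-monoʳ-≤ 2 (sparse⇒edges≤ C 2 sparse 2≤ (<⇒≤ 2≤))) 4≤n
... | no none = begin
  2 * edges C     ≡⟨ handshake C ⟩
  sumFin (deg C)  ≤⟨ sum-mono-≤ (λ u → s≤s⁻¹ (≰⇒> λ 2≤ → none (u , 2≤))) ⟩
  sumFin {n} (λ _ → 1) ≡⟨ ∣everywhere∣ ⟩
  n               ∎
  where open ≤-Reasoning

lower-even : ∀ h (G : Graph n) → n ≡ 2 * h → Robust G k → n * k ≤ 2 * edges G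
lower-even {n} {k} h G n≡2h rob = begin
  n * k                   ≡⟨ *-comm n k ⟩
  k * n                   ≡⟨ cong (k *_) ∣everywhere∣ ⟨
  k * ∣ everywhere {n} ∣  ≤⟨ deg-sum-bound everywhere G k (λ v _ → ≮⇒≥ (low v)) ⟩
  2 * edges G             ∎
  where
  open ≤-Reasoning
  low : ∀ v → ¬ deg G v < k
  low v lt = case (rob H (isolate-⊆ G v) (subst (_< edges H + k) (edges-isolate G v) (+-monoʳ-< (edges H) lt)))
    where
    H = isolate G v
    case : HasPMorAPM H → ⊥
    case (inj₁ (M , M⊆H , d)) = contradiction
      (trans (≡-sym (d v)) (trans (degree≡deg M v) (⊆-isolated M H M⊆H (deg-isolate-self G v)))) λ ()
    -- An almost perfect matching would make n odd: its degrees add up to n - 1.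
    case (inj₂ (M , _ , w , d₀ , d₁)) = even≢odd h (edges M)
      (trans (≡-sym n≡2h) (trans (≡-sym ∣everywhere∣) (trans (sum-cong (≡-sym ∘ cell))
        (trans (sum-+ (deg M) (λ u → ⟦ u == w ⟧)) (trans (cong₂ _+_ (≡-sym (handshake M)) (sum-== w)) (+-comm _ 1))))))
      where
      cell : ∀ u → deg M u + ⟦ u == w ⟧ ≡ 1
      cell u with toSum (u ≟ w)
      ... | inj₁ refl = cong₂ _+_ (trans (≡-sym (degree≡deg M u)) d₀) (cong ⟦_⟧ (==-refl u))
      ... | inj₂ u≢w = cong₂ _+_ (trans (≡-sym (degree≡deg M u)) (d₁ u u≢w)) (cong ⟦_⟧ (≢⇒== u≢w))

-- Matchings as involutions, colour classes and round-robin tournaments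

matching : (π : Fin n → Fin n) → (∀ i → π (π i) ≡ i) → Graph n
matching π inv = fromRelation (λ i j → π i == j) λ i j → does-⇔ (mk⇔ (flipped i j) (flipped j i)) (π i ≟ j) (π j ≟ i)
  where
  flipped : ∀ i j → π i ≡ j → π j ≡ i
  flipped i j refl = inv i

matching-adj : (π : Fin n → Fin n) (inv : ∀ i → π (π i) ≡ i) (i j : Fin n) → adj (matching π inv) i j ≡ true → π i ≡ j × i ≢ j
matching-adj π inv i j e = ==⇒≡ (proj₂ (∧-true {not (i == j)} e)) , λ i≡j → true≢false (dec-true (i ≟ j) i≡j) (not-true (proj₁ (∧-true e)))

deg-matching : (π : Fin n → Fin n) (inv : ∀ i → π (π i) ≡ i) {i : Fin n} → π i ≢ i → deg (matching π inv) i ≡ 1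
deg-matching π inv {i} πi≢i = trans (sum-cong cell) (sum-== (π i))
  where
  cell : ∀ j → ⟦ not (i == j) ∧ (π i == j) ⟧ ≡ ⟦ j == π i ⟧
  cell j with toSum (j ≟ π i)
  ... | inj₁ refl rewrite ≢⇒== (πi≢i ∘ ≡-sym) | ==-refl (π i) = refl
  ... | inj₂ j≢πi rewrite ≢⇒== j≢πi | ≢⇒== (j≢πi ∘ ≡-sym) | 𝔹.∧-zeroʳ (not (i == j)) = refl

deg-matching-fixed : (π : Fin n → Fin n) (inv : ∀ i → π (π i) ≡ i) {i : Fin n} → π i ≡ i → deg (matching π inv) i ≡ 0
deg-matching-fixed π inv {i} πi≡i = sum-zero _ λ j → cong ⟦_⟧ (cell j)
  where
  cell : ∀ j → not (i == j) ∧ (π i == j) ≡ false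
  cell j rewrite πi≡i = 𝔹.∧-inverseˡ (i == j)

-- A perfect matching as an involution sending each vertex to its partner. Unlike a subgraph with
-- prescribed degrees, it is easily conjugated by a permutation; in `NearPerfect` the missed vertex
-- is a fixed point.
Perfect : Graph n → Set
Perfect {n} H = Σ (Fin n → Fin n) λ π → (∀ i → π (π i) ≡ i) × (∀ i → adj H i (π i) ≡ true)

NearPerfect : Graph n → Set
NearPerfect {n} H = Σ (Fin n → Fin n) λ π → Σ (Fin n) λ w →
  (∀ i → π (π i) ≡ i) × π w ≡ w × (∀ i → i ≢ w → adj H i (π i) ≡ true)

Perfect⇒PM : (H : Graph n) → Perfect H → HasPMorAPM H
Perfect⇒PM H (π , inv , e) = inj₁ (matching π inv
  , (λ i j a → subst (λ j → adj H i j ≡ true) (proj₁ (matching-adj π inv i j a)) (e i))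
  , λ v → trans (degree≡deg (matching π inv) v) (deg-matching π inv (adj⇒≢ H (e v) ∘ ≡-sym)))

module _ (H : Graph n) (np : NearPerfect H) where
  private
    π = proj₁ np
    w = proj₁ (proj₂ np)
    inv = proj₁ (proj₂ (proj₂ np))
    πw≡w = proj₁ (proj₂ (proj₂ (proj₂ np)))
    π-edge = proj₂ (proj₂ (proj₂ (proj₂ np)))

  nearMatching : Graph n
  nearMatching = matching π inv

  nearMatching-⊆ : nearMatching ⊆G H
  nearMatching-⊆ i j a with matching-adj π inv i j a
  ... | πi≡j , i≢j = subst (λ j → adj H i j ≡ true) πi≡j (π-edge i λ { refl → i≢j (trans (≡-sym πw≡w) πi≡j) })

  deg-nearMatching-hole : deg nearMatching w ≡ 0
  deg-nearMatching-hole = deg-matching-fixed π inv πw≡w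

  deg-nearMatching : ∀ v → v ≢ w → deg nearMatching v ≡ 1
  deg-nearMatching v v≢w = deg-matching π inv (adj⇒≢ H (π-edge v v≢w) ∘ ≡-sym)

  deg-nearMatching≤1 : ∀ v → deg nearMatching v ≤ 1
  deg-nearMatching≤1 v with toSum (v ≟ w)
  ... | inj₁ refl = ≤-trans (≤-reflexive deg-nearMatching-hole) z≤n
  ... | inj₂ v≢w  = ≤-reflexive (deg-nearMatching v v≢w)

  edges-nearMatching : 2 * edges nearMatching + 1 ≡ n
  edges-nearMatching = trans (cong₂ _+_ (handshake nearMatching) (≡-sym (sum-== w)))
    (trans (≡-sym (sum-+ (deg nearMatching) (λ i → ⟦ i == w ⟧))) (trans (sum-cong cell) ∣everywhere∣))
    where
    cell : ∀ i → deg nearMatching i + ⟦ i == w ⟧ ≡ 1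
    cell i with toSum (i ≟ w)
    ... | inj₁ refl = cong₂ _+_ deg-nearMatching-hole (cong ⟦_⟧ (==-refl i))
    ... | inj₂ i≢w = cong₂ _+_ (deg-nearMatching i i≢w) (cong ⟦_⟧ (≢⇒== i≢w))

  NearPerfect⇒APM : HasPMorAPM H
  NearPerfect⇒APM = inj₂ (nearMatching , nearMatching-⊆ , w
    , trans (degree≡deg nearMatching w) deg-nearMatching-hole
    , λ v v≢w → trans (degree≡deg nearMatching v) (deg-nearMatching v v≢w))

  Robust-nearMatching : Robust nearMatching 1
  Robust-nearMatching K K⊆ lt = inj₂ (nearMatching , all-left , w
    , trans (degree≡deg nearMatching w) deg-nearMatching-hole
    , λ v v≢w → trans (degree≡deg nearMatching v) (deg-nearMatching v v≢w))
    where
    none-deleted : edges (delete nearMatching K) ≡ 0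
    none-deleted = n<1⇒n≡0 (+-cancelʳ-< (edges K) _ _
      (subst₂ _<_ (≡-sym (edges-delete nearMatching K K⊆)) (+-comm (edges K) 1) lt))
    all-left : nearMatching ⊆G K
    all-left i j e with true⊎false (adj K i j)
    ... | inj₁ k = k
    ... | inj₂ ¬k = ⊥-elim (true≢false (delete-intro nearMatching K e ¬k) (edges-≡0 (delete nearMatching K) none-deleted i j))

NearPerfect-mono : (H K : Graph n) → H ⊆G K → NearPerfect H → NearPerfect K
NearPerfect-mono H K H⊆K (π , w , inv , πw≡w , e) = π , w , inv , πw≡w , λ i i≢w → H⊆K i (π i) (e i i≢w)

pull : Permutation m n → Graph n → Graph m
pull σ H = record
  { adj    = λ i j → adj H (σ ⟨$⟩ʳ i) (σ ⟨$⟩ʳ j)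
  ; sym    = λ i j → sym H (σ ⟨$⟩ʳ i) (σ ⟨$⟩ʳ j)
  ; irrefl = λ i → irrefl H (σ ⟨$⟩ʳ i)
  }

edges-pull : (σ : Permutation m n) (H : Graph n) → edges (pull σ H) ≡ edges H
edges-pull {m} {n} σ H = *-cancelˡ-≡ _ _ 2 (begin
  2 * edges (pull σ H)                                      ≡⟨ handshake (pull σ H) ⟩
  sumFin (λ i → sumFin (λ j → ⟦ adj H (σ ⟨$⟩ʳ i) (σ ⟨$⟩ʳ j) ⟧)) ≡⟨ sum-cong (λ i → sum-permute (λ j → ⟦ adj H (σ ⟨$⟩ʳ i) j ⟧) σ) ⟩
  sumFin (λ i → deg H (σ ⟨$⟩ʳ i))                           ≡⟨ sum-permute (deg H) σ ⟩
  sumFin (deg H)                                            ≡⟨ handshake H ⟨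
  2 * edges H                                               ∎)
  where open ≡-Reasoning

NearPerfect-push : (σ : Permutation m n) (H : Graph n) → NearPerfect (pull σ H) → NearPerfect H
NearPerfect-push σ H (π , w , inv , πw≡w , e) = (λ i → σ ⟨$⟩ʳ π (σ ⟨$⟩ˡ i)) , σ ⟨$⟩ʳ w
  , (λ i → trans (cong (λ x → σ ⟨$⟩ʳ π x) (inverseˡ σ)) (trans (cong (σ ⟨$⟩ʳ_) (inv _)) (inverseʳ σ)))
  , cong (σ ⟨$⟩ʳ_) (trans (cong π (inverseˡ σ)) πw≡w)
  , λ i i≢w → subst (λ x → adj H x (σ ⟨$⟩ʳ π (σ ⟨$⟩ˡ i)) ≡ true) (inverseʳ σ)
      (e (σ ⟨$⟩ˡ i) λ eq → i≢w (trans (≡-sym (inverseʳ σ)) (cong (σ ⟨$⟩ʳ_) eq)))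

-- Unions of colour classes

⋁ : (Fin k → Bool) → Bool
⋁ {zero}  f = false
⋁ {suc k} f = f zero ∨ ⋁ (f ∘ suc)

⋁-intro : (f : Fin k → Bool) (c : Fin k) → f c ≡ true → ⋁ f ≡ true
⋁-intro f zero    e rewrite e = refl
⋁-intro f (suc c) e rewrite ⋁-intro (f ∘ suc) c e = 𝔹.∨-zeroʳ (f zero)

⋁-cong : {f g : Fin k → Bool} → (∀ c → f c ≡ g c) → ⋁ f ≡ ⋁ g
⋁-cong {zero}  f≡g = refl
⋁-cong {suc k} f≡g = cong₂ _∨_ (f≡g zero) (⋁-cong (f≡g ∘ suc))

⟦⋁⟧≤sum : (f : Fin k → Bool) → ⟦ ⋁ f ⟧ ≤ sumFin (λ c → ⟦ f c ⟧)
⟦⋁⟧≤sum {zero}  f = z≤n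
⟦⋁⟧≤sum {suc k} f with f zero
... | true  = s≤s z≤n
... | false = ⟦⋁⟧≤sum (f ∘ suc)

⋁-false : (f : Fin k → Bool) → (∀ c → f c ≡ false) → ⋁ f ≡ false
⋁-false {zero}  f none = refl
⋁-false {suc k} f none = cong₂ _∨_ (none zero) (⋁-false (f ∘ suc) (none ∘ suc))

union : (Fin k → Graph n) → Graph n
union G = record
  { adj    = λ i j → ⋁ (λ c → adj (G c) i j)
  ; sym    = λ i j → ⋁-cong (λ c → sym (G c) i j)
  ; irrefl = λ i → ⋁-false (λ c → adj (G c) i i) (λ c → irrefl (G c) i)
  }

-- `SIs-intro` asks of the example only an upper bound on its edges, so a union bound on the degrees
-- is enough.
edges-union : (G : Fin k → Graph n) (d : ℕ) → (∀ c v → deg (G c) v ≤ d) → 2 * edges (union G) ≤ n * (k * d)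
edges-union {k} {n} G d deg≤ = begin
  2 * edges (union G)               ≡⟨ handshake (union G) ⟩
  sumFin (deg (union G))            ≤⟨ sum-mono-≤ bound ⟩
  sumFin {n} (λ _ → k * d)          ≡⟨ sum-const n (k * d) ⟩
  n * (k * d)                       ∎
  where
  open ≤-Reasoning
  bound : ∀ v → deg (union G) v ≤ k * d
  bound v = begin
    deg (union G) v                                     ≤⟨ sum-mono-≤ (λ j → ⟦⋁⟧≤sum (λ c → adj (G c) v j)) ⟩
    sumFin (λ j → sumFin (λ c → ⟦ adj (G c) v j ⟧))     ≡⟨ sum-comm (λ j c → ⟦ adj (G c) v j ⟧) ⟩
    sumFin (λ c → deg (G c) v)                          ≤⟨ sum-mono-≤ (λ c → deg≤ c v) ⟩
    sumFin {k} (λ _ → d)                                ≡⟨ sum-const k d ⟩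
    k * d                                               ∎

≡ᵇ-refl : ∀ x → (x ≡ᵇ x) ≡ true
≡ᵇ-refl zero    = refl
≡ᵇ-refl (suc x) = ≡ᵇ-refl x

sum-≡ᵇ≤1 : ∀ x → sumFin {k} (λ c → ⟦ x ≡ᵇ toℕ c ⟧) ≤ 1
sum-≡ᵇ≤1 {zero}  x       = z≤n
sum-≡ᵇ≤1 {suc k} zero    = s≤s (≤-reflexive (sum-zero {k} (λ c → 0) λ _ → refl))
sum-≡ᵇ≤1 {suc k} (suc x) = sum-≡ᵇ≤1 {k} x

-- Pigeonhole over the colours: fewer than k t deleted edges leave some colour class with fewer than t.
union-robust : (col : Fin n → Fin n → ℕ) → (∀ i j → col i j ≡ col j i) →
  (G : Fin k → Graph n) → (∀ c i j → adj (G c) i j ≡ true → col i j ≡ toℕ c) →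
  (t : ℕ) → (∀ c F → edges F < t → HasPMorAPM (delete (G c) F)) → Robust (union G) (k * t)
union-robust {n} {k} col col-sym G coloured t survives H H⊆U lt =
  let c , small = exists-small (λ c → edges (class c)) t (≤-<-trans classes≤ few)
  in HasPMorAPM-mono (delete (G c) (class c)) H (rest c) (survives c (class c) small)
  where
  U F : Graph n
  U = union G
  F = delete U H
  few : edges F < k * t
  few = +-cancelʳ-< (edges H) _ _ (subst₂ _<_ (≡-sym (edges-delete U H H⊆U)) (+-comm (edges H) (k * t)) lt)
  -- The deleted edges of colour c. The colour is a function of the pair, so each deleted edge is
  -- counted in at most one class.
  class : Fin k → Graph n
  class c = restrict F (λ i j → col i j ≡ᵇ toℕ c) (λ i j → cong (_≡ᵇ toℕ c) (col-sym i j))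
  cell : ∀ i j → sumFin (λ c → ⟦ adj (class c) i j ⟧) ≤ ⟦ adj F i j ⟧
  cell i j with adj F i j
  ... | true  = sum-≡ᵇ≤1 {k} (col i j)
  ... | false = ≤-reflexive (sum-zero {k} (λ _ → 0) λ _ → refl)
  classes≤ : sumFin (λ c → edges (class c)) ≤ edges F
  classes≤ = *-cancelˡ-≤ 2 (begin
    2 * sumFin (λ c → edges (class c))                       ≡⟨ sum-*ˡ 2 (λ c → edges (class c)) ⟨
    sumFin (λ c → 2 * edges (class c))                       ≡⟨ sum-cong (λ c → handshake (class c)) ⟩
    sumFin (λ c → sumFin (deg (class c)))                    ≡⟨ sum-comm (λ c → deg (class c)) ⟩
    sumFin (λ i → sumFin (λ c → deg (class c) i))            ≡⟨ sum-cong (λ i → sum-comm (λ c j → ⟦ adj (class c) i j ⟧)) ⟩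
    sumFin (λ i → sumFin (λ j → sumFin (λ c → ⟦ adj (class c) i j ⟧))) ≤⟨ sum-mono-≤ (λ i → sum-mono-≤ (cell i)) ⟩
    sumFin (deg F)                                           ≡⟨ handshake F ⟨
    2 * edges F                                              ∎)
    where open ≤-Reasoning
  rest : ∀ c → delete (G c) (class c) ⊆G H
  rest c i j e with true⊎false (adj H i j)
  ... | inj₁ h = h
  ... | inj₂ ¬h = ⊥-elim (true≢false
    (∧-intro (delete-intro U H (⋁-intro (λ c → adj (G c) i j) c e') ¬h) (trans (cong (_≡ᵇ toℕ c) (coloured c i j e')) (≡ᵇ-refl (toℕ c))))
    (delete-avoids (G c) (class c) e))
    where e' = delete-⊆ (G c) (class c) i j e

-- Rotations of the residues modulo N

module _ (N : ℕ) {{_ : NonZero N}} where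

  %-absorbˡ : ∀ x y → (x % N + y) % N ≡ (x + y) % N
  %-absorbˡ x y = trans (%-distribˡ-+ (x % N) y N) (trans (cong (λ z → (z + y % N) % N) (m%n%n≡m%n x N)) (≡-sym (%-distribˡ-+ x y N)))

  %-absorb₂ : ∀ x y z → (x % N + y % N + z) % N ≡ (x + y + z) % N
  %-absorb₂ x y z = begin
    (x % N + y % N + z) % N   ≡⟨ cong (_% N) (+-assoc (x % N) (y % N) z) ⟩
    (x % N + (y % N + z)) % N ≡⟨ %-absorbˡ x (y % N + z) ⟩
    (x + (y % N + z)) % N     ≡⟨ cong (_% N) (left-comm x (y % N) z) ⟩
    (y % N + (x + z)) % N     ≡⟨ %-absorbˡ y (x + z) ⟩
    (y + (x + z)) % N         ≡⟨ cong (_% N) (left-comm y x z) ⟩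
    (x + (y + z)) % N         ≡⟨ cong (_% N) (+-assoc x y z) ⟨
    (x + y + z) % N           ∎
    where
    open ≡-Reasoning
    left-comm : ∀ a b c → a + (b + c) ≡ b + (a + c)
    left-comm = solve-∀

  abstract
    shift : ℕ → Fin N → Fin N
    shift c a = fromℕ< (m%n<n (toℕ a + c) N)

    toℕ-shift : ∀ c a → toℕ (shift c a) ≡ (toℕ a + c) % N
    toℕ-shift c a = toℕ-fromℕ< (m%n<n (toℕ a + c) N)

  shift-shift : ∀ c d a → (c + d) % N ≡ 0 → shift d (shift c a) ≡ a
  shift-shift c d a c+d≡0 = toℕ-injective (begin
    toℕ (shift d (shift c a))     ≡⟨ toℕ-shift d (shift c a) ⟩
    (toℕ (shift c a) + d) % N     ≡⟨ cong (λ x → (x + d) % N) (toℕ-shift c a) ⟩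
    ((toℕ a + c) % N + d) % N     ≡⟨ %-absorbˡ (toℕ a + c) d ⟩
    (toℕ a + c + d) % N           ≡⟨ cong (_% N) (rearr (toℕ a) c d) ⟩
    ((c + d) + toℕ a) % N         ≡⟨ %-absorbˡ (c + d) (toℕ a) ⟨
    ((c + d) % N + toℕ a) % N     ≡⟨ cong (λ x → (x + toℕ a) % N) c+d≡0 ⟩
    toℕ a % N                     ≡⟨ m<n⇒m%n≡m (toℕ<n a) ⟩
    toℕ a                         ∎)
    where
    open ≡-Reasoning
    rearr : ∀ a c d → a + c + d ≡ (c + d) + a
    rearr = solve-∀

  rotate : ℕ → Permutation′ N
  rotate c = permutation (shift c) (shift d)
    (λ a → shift-shift d c a (trans (cong (_% N) (+-comm d c)) c+d≡0)) (λ a → shift-shift c d a c+d≡0)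
    where
    d = N ∸ c % N
    c+d≡0 : (c + d) % N ≡ 0
    c+d≡0 = begin
      (c + d) % N        ≡⟨ %-absorbˡ c d ⟨
      (c % N + d) % N    ≡⟨ cong (_% N) (m+[n∸m]≡n (m%n≤n c N)) ⟩
      N % N              ≡⟨ n%n≡0 N ⟩
      0                  ∎
      where open ≡-Reasoning

-- Vertex zero plays the role of ∞; its edge to a is coloured as if it were a loop at a.
sumColour : (ℕ → ℕ) → Fin (suc n) → Fin (suc n) → ℕ
sumColour f zero    zero    = 0
sumColour f zero    (suc b) = f (toℕ b + toℕ b)
sumColour f (suc a) zero    = f (toℕ a + toℕ a)
sumColour f (suc a) (suc b) = f (toℕ a + toℕ b)

sumColour-sym : (f : ℕ → ℕ) (i j : Fin (suc n)) → sumColour f i j ≡ sumColour f j i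
sumColour-sym f zero    zero    = refl
sumColour-sym f zero    (suc b) = refl
sumColour-sym f (suc a) zero    = refl
sumColour-sym f (suc a) (suc b) = cong f (+-comm (toℕ a) (toℕ b))

-- The round-robin 1-factorization of the complete graph on ∞ and ℤ/N, N = 2h + 1.
module RoundRobin (h : ℕ) where
  N : ℕ
  N = suc (2 * h)

  -- The summand 1 normalises the colours: the edges of `base` have end sum 2h, which is -1 modulo
  -- N, and so get colour 0.
  colour : Fin (suc N) → Fin (suc N) → ℕ
  colour = sumColour (λ s → (s + 1) % N)

  middle : Fin N
  middle = fromℕ< (s≤s (m≤n*m h 2))

  toℕ-opposite : (a : Fin N) → toℕ a + toℕ (opposite a) ≡ 2 * h
  toℕ-opposite a = trans (cong (toℕ a +_) (opposite-prop a)) (m+[n∸m]≡n (s≤s⁻¹ (toℕ<n a)))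

  fixed⇒middle : ∀ a → opposite a ≡ a → a ≡ middle
  fixed⇒middle a eq = toℕ-injective (trans (*-cancelˡ-≡ _ _ 2 (trans (cong (toℕ a +_) (trans (+-identityʳ _) (cong toℕ (≡-sym eq)))) (toℕ-opposite a)))
    (≡-sym (toℕ-fromℕ< _)))

  opposite-middle : opposite middle ≡ middle
  opposite-middle = toℕ-injective (+-cancelˡ-≡ (toℕ middle) _ _ (trans (toℕ-opposite middle)
    (cong₂ _+_ (≡-sym (toℕ-fromℕ< _)) (trans (+-identityʳ h) (≡-sym (toℕ-fromℕ< _))))))

  -- The reflection a ↦ 2h - a of the residues; its only fixed point h is matched with ∞ instead.
  base : Fin (suc N) → Fin (suc N)
  base zero = suc middle
  base (suc a) = if a == middle then zero else suc (opposite a)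

  base-middle : ∀ a → a ≡ middle → base (suc a) ≡ zero
  base-middle a eq = cong (λ b → if b then zero else suc (opposite a)) (dec-true (a ≟ middle) eq)

  base-suc : ∀ a → a ≢ middle → base (suc a) ≡ suc (opposite a)
  base-suc a ne = cong (λ b → if b then zero else suc (opposite a)) (≢⇒== ne)

  base-involutive : ∀ i → base (base i) ≡ i
  base-involutive zero = base-middle middle refl
  base-involutive (suc a) with toSum (a ≟ middle)
  ... | inj₁ eq = trans (cong base (base-middle a eq)) (cong suc (≡-sym eq))
  ... | inj₂ ne = trans (cong base (base-suc a ne)) (trans (base-suc (opposite a) ne') (cong suc (opposite-involutive a)))
    where
    ne' : opposite a ≢ middle
    ne' eq = ne (trans (≡-sym (opposite-involutive a)) (trans (cong opposite eq) opposite-middle))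

  base≢ : ∀ i → base i ≢ i
  base≢ zero ()
  base≢ (suc a) with toSum (a ≟ middle)
  ... | inj₁ eq = λ e → contradiction (trans (≡-sym (base-middle a eq)) e) λ ()
  ... | inj₂ ne = λ e → ne (fixed⇒middle a (Fin.suc-injective (trans (≡-sym (base-suc a ne)) e)))

  turn : ℕ → Permutation′ (suc N)
  turn c = lift₀ (rotate N (c * suc h))

  -- 2 (h + 1) ≡ 1 mod N, so turning by c (h + 1) adds c to the sum of the ends of an edge.
  turned-sum : ∀ c x y → x + y ≡ 2 * h → ((x + c * suc h) % N + (y + c * suc h) % N + 1) % N ≡ c % N
  turned-sum c x y eq = begin
    ((x + c * suc h) % N + (y + c * suc h) % N + 1) % N   ≡⟨ %-absorb₂ N (x + c * suc h) (y + c * suc h) 1 ⟩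
    (x + c * suc h + (y + c * suc h) + 1) % N             ≡⟨ cong (_% N) (rearr x y c h) ⟩
    (c + (x + y + 1 + c * suc (2 * h))) % N               ≡⟨ cong (λ s → (c + (s + 1 + c * suc (2 * h))) % N) eq ⟩
    (c + (2 * h + 1 + c * suc (2 * h))) % N               ≡⟨ cong (λ s → (c + (s + c * suc (2 * h))) % N) (+-comm (2 * h) 1) ⟩
    (c + suc c * suc (2 * h)) % N                         ≡⟨ [m+kn]%n≡m%n c (suc c) N ⟩
    c % N                                                 ∎
    where
    open ≡-Reasoning
    rearr : ∀ x y c h → x + c * suc h + (y + c * suc h) + 1 ≡ c + (x + y + 1 + c * suc (2 * h))
    rearr = solve-∀

  colour-base : ∀ c y → colour (turn c ⟨$⟩ʳ y) (turn c ⟨$⟩ʳ base y) ≡ c % N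
  colour-base c zero = trans (cong (λ x → (x + x + 1) % N) (toℕ-shift N (c * suc h) middle))
    (turned-sum c (toℕ middle) (toℕ middle) (trans (cong (λ a → toℕ middle + toℕ a) (≡-sym opposite-middle)) (toℕ-opposite middle)))
  colour-base c (suc a) with toSum (a ≟ middle)
  ... | inj₁ refl = trans (cong (λ z → colour (turn c ⟨$⟩ʳ suc a) (turn c ⟨$⟩ʳ z)) (base-middle a refl)) (colour-base c zero)
  ... | inj₂ ne = trans (cong (λ z → colour (turn c ⟨$⟩ʳ suc a) (turn c ⟨$⟩ʳ z)) (base-suc a ne))
    (trans (cong₂ (λ x y → (x + y + 1) % N) (toℕ-shift N (c * suc h) a) (toℕ-shift N (c * suc h) (opposite a)))
      (turned-sum c (toℕ a) (toℕ (opposite a)) (toℕ-opposite a)))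

  partner : ℕ → Fin (suc N) → Fin (suc N)
  partner c i = turn c ⟨$⟩ʳ base (turn c ⟨$⟩ˡ i)

  partner-involutive : ∀ c i → partner c (partner c i) ≡ i
  partner-involutive c i = trans (cong (λ x → turn c ⟨$⟩ʳ base x) (inverseˡ (turn c) {base (turn c ⟨$⟩ˡ i)}))
    (trans (cong (turn c ⟨$⟩ʳ_) (base-involutive (turn c ⟨$⟩ˡ i))) (inverseʳ (turn c)))

  partner≢ : ∀ c i → partner c i ≢ i
  partner≢ c i eq = base≢ (turn c ⟨$⟩ˡ i) (trans (≡-sym (inverseˡ (turn c) {base (turn c ⟨$⟩ˡ i)})) (cong (turn c ⟨$⟩ˡ_) eq))

  colour-partner : ∀ c i → colour i (partner c i) ≡ c % N
  colour-partner c i = subst (λ x → colour x (partner c i) ≡ c % N) (inverseʳ (turn c) {i}) (colour-base c (turn c ⟨$⟩ˡ i))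

  factor : ℕ → Graph (suc N)
  factor c = matching (partner c) (partner-involutive c)

  factors : (k : ℕ) → Graph (suc N)
  factors k = union {k} (factor ∘ toℕ)

  factors-robust : ∀ k → k ≤ N → Robust (factors k) k
  factors-robust k k≤N = subst (Robust (factors k)) (*-identityʳ k)
    (union-robust colour (sumColour-sym (λ s → (s + 1) % N)) (factor ∘ toℕ) coloured 1 survives)
    where
    coloured : ∀ (c : Fin k) i j → adj (factor (toℕ c)) i j ≡ true → colour i j ≡ toℕ c
    coloured c i j e = trans (cong (colour i) (≡-sym (proj₁ (matching-adj (partner (toℕ c)) (partner-involutive (toℕ c)) i j e))))
      (trans (colour-partner (toℕ c) i) (m<n⇒m%n≡m (<-≤-trans (toℕ<n c) k≤N)))
    survives : ∀ (c : Fin k) F → edges F < 1 → HasPMorAPM (delete (factor (toℕ c)) F)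
    survives c F none = Perfect⇒PM (delete (factor (toℕ c)) F) (partner (toℕ c) , partner-involutive (toℕ c) , λ i →
      delete-intro (factor (toℕ c)) F (fromRelation-intro {p = λ i j → partner (toℕ c) i == j} (partner≢ (toℕ c) i ∘ ≡-sym) (==-refl (partner (toℕ c) i)))
        (edges-≡0 F (n<1⇒n≡0 none) i _))

  edges-factors : ∀ k → 2 * edges (factors k) ≤ suc N * k
  edges-factors k = subst (λ x → 2 * edges (factors k) ≤ suc N * x) (*-identityʳ k)
    (edges-union {k} (factor ∘ toℕ) 1 λ c v → ≤-reflexive (deg-matching (partner (toℕ c)) (partner-involutive (toℕ c)) (partner≢ (toℕ c) v)))

-- Hamiltonian cycles and Walecki's decomposition

-- Vertex 0 stands alone, and the others are grouped into the pairs 2i + 1, 2i + 2. Writing 2h as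
-- `h * 2` makes `combine` the enumeration of these pairs.
even odd : ∀ {h} → Fin h → Fin (suc (h * 2))
odd  i = suc (combine i zero)
even i = suc (combine i (suc zero))

data Position {h : ℕ} : Fin (suc (h * 2)) → Set where
  start   : Position zero
  at-odd  : ∀ (i : Fin h) → Position (odd i)
  at-even : ∀ (i : Fin h) → Position (even i)

position : ∀ {h} (j : Fin (suc (h * 2))) → Position {h} j
position zero = start
position {h} (suc a) = subst (λ x → Position {h} (suc x)) (combine-remQuot {h} 2 a) (build (remQuot {h} 2 a))
  where
  build : ((i , b) : Fin h × Fin 2) → Position {h} (suc (combine i b))
  build (i , zero)     = at-odd i
  build (i , suc zero) = at-even i

toℕ-odd : ∀ {h} (i : Fin h) → toℕ (odd i) ≡ 2 * toℕ i + 1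
toℕ-odd i = trans (cong suc (trans (toℕ-combine i zero) (+-identityʳ _))) (+-comm 1 _)

toℕ-even : ∀ {h} (i : Fin h) → toℕ (even i) ≡ 2 * toℕ i + 1 + 1
toℕ-even i = trans (cong suc (toℕ-combine i (suc zero))) (+-comm 1 _)

-- The near perfect matching 0, 1–2, 3–4, … .
module Pairing (h : ℕ) where

  mate : Fin (suc (h * 2)) → Fin (suc (h * 2))
  mate zero    = zero
  mate (suc a) = suc (uncurry (λ i b → combine i (opposite b)) (remQuot {h} 2 a))

  mate-odd : ∀ (i : Fin h) → mate (odd i) ≡ even i
  mate-odd i = cong (λ x → suc (uncurry (λ i b → combine i (opposite b)) x)) (remQuot-combine i zero)

  mate-even : ∀ (i : Fin h) → mate (even i) ≡ odd i
  mate-even i = cong (λ x → suc (uncurry (λ i b → combine i (opposite b)) x)) (remQuot-combine i (suc zero))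

  mate-involutive : ∀ j → mate (mate j) ≡ j
  mate-involutive j with position {h} j
  ... | start     = refl
  ... | at-odd i  = trans (cong mate (mate-odd i)) (mate-even i)
  ... | at-even i = trans (cong mate (mate-even i)) (mate-odd i)

  pairing : (H : Graph (suc (h * 2))) → (∀ (i : Fin h) → adj H (odd i) (even i) ≡ true) → NearPerfect H
  pairing H e = mate , zero , mate-involutive , refl , edge
    where
    edge : ∀ j → j ≢ zero → adj H j (mate j) ≡ true
    edge j j≢0 with position {h} j
    ... | start     = ⊥-elim (j≢0 refl)
    ... | at-odd i  = subst (λ x → adj H (odd i) x ≡ true) (≡-sym (mate-odd i)) (e i)
    ... | at-even i = subst (λ x → adj H (even i) x ≡ true) (≡-sym (mate-even i)) (trans (sym H (even i) (odd i)) (e i))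

  odd≢even : ∀ (i : Fin h) → odd i ≢ even i
  odd≢even i eq = m≢1+m+n _ (trans (≡-sym (toℕ-odd i)) (trans (cong toℕ eq) (trans (toℕ-even i) (eq' (2 * toℕ i + 1)))))
    where
    eq' : ∀ x → x + 1 ≡ suc (x + 0)
    eq' = solve-∀

module Cycle (h : ℕ) (1≤h : 1 ≤ h) where
  n′ : ℕ
  n′ = suc (h * 2)

  next : Fin n′ → Fin n′
  next = shift n′ 1

  cycle : Graph n′
  cycle = fromRelation (λ i j → (next i == j) ∨ (next j == i)) (λ i j → 𝔹.∨-comm (next i == j) (next j == i))

  -- A shift by c fixes a vertex only if n′ divides c, and n′ ≥ 3. The case c = 1 excludes loops; c
  -- = 2 separates the two neighbours of a vertex.
  next≢ : ∀ q c → 1 ≤ c → c ≤ 2 → shift n′ c q ≢ q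
  next≢ q c 1≤c c≤2 eq = absurd ((toℕ q + c) / n′) refl
    where
    key : c ≡ ((toℕ q + c) / n′) * n′
    key = +-cancelˡ-≡ (toℕ q) _ _ (trans (m≡m%n+[m/n]*n (toℕ q + c) n′)
      (cong (_+ ((toℕ q + c) / n′) * n′) (trans (≡-sym (toℕ-shift n′ c q)) (cong toℕ eq))))
    absurd : ∀ d → (toℕ q + c) / n′ ≡ d → ⊥
    absurd zero    eq′ = <⇒≢ 1≤c (≡-sym (trans key (cong (_* n′) eq′)))
    absurd (suc d) eq′ = <⇒≱ (s≤s (*-monoˡ-≤ 2 1≤h)) (≤-trans (≤-trans (m≤m+n n′ (d * n′)) (≤-reflexive (≡-sym (trans key (cong (_* n′) eq′))))) c≤2)

  cycle-edge : ∀ q → adj cycle q (next q) ≡ true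
  cycle-edge q = fromRelation-intro {p = λ i j → (next i == j) ∨ (next j == i)} (next≢ q 1 ≤-refl (s≤s z≤n) ∘ ≡-sym)
    (cong (_∨ (next (next q) == q)) (==-refl (next q)))

  next-next : ∀ q → next (next q) ≡ shift n′ 2 q
  next-next q = toℕ-injective (begin
    toℕ (next (next q))        ≡⟨ toℕ-shift n′ 1 (next q) ⟩
    (toℕ (next q) + 1) % n′    ≡⟨ cong (λ x → (x + 1) % n′) (toℕ-shift n′ 1 q) ⟩
    ((toℕ q + 1) % n′ + 1) % n′ ≡⟨ %-absorbˡ n′ (toℕ q + 1) 1 ⟩
    (toℕ q + 1 + 1) % n′       ≡⟨ cong (_% n′) (+-assoc (toℕ q) 1 1) ⟩
    (toℕ q + 2) % n′           ≡⟨ toℕ-shift n′ 2 q ⟨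
    toℕ (shift n′ 2 q)         ∎)
    where open ≡-Reasoning

  prev : Fin n′ → Fin n′
  prev q = rotate n′ 1 ⟨$⟩ˡ q

  next-prev : ∀ q → next (prev q) ≡ q
  next-prev q = inverseʳ (rotate n′ 1)

  next≢prev : ∀ q → next q ≢ prev q
  next≢prev q eq = next≢ (prev q) 2 (s≤s z≤n) ≤-refl
    (trans (≡-sym (next-next (prev q))) (trans (cong next (next-prev q)) eq))

  deg-cycle : ∀ v → deg cycle v ≤ 2
  deg-cycle v = begin
    deg cycle v                                                ≤⟨ sum-mono-≤ cell ⟩
    sumFin (λ j → ⟦ j == next v ⟧ + ⟦ j == prev v ⟧)           ≡⟨ sum-+ (λ j → ⟦ j == next v ⟧) (λ j → ⟦ j == prev v ⟧) ⟩
    sumFin (λ j → ⟦ j == next v ⟧) + sumFin (λ j → ⟦ j == prev v ⟧) ≡⟨ cong₂ _+_ (sum-== (next v)) (sum-== (prev v)) ⟩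
    2                                                          ∎
    where
    open ≤-Reasoning
    cell : ∀ j → ⟦ adj cycle v j ⟧ ≤ ⟦ j == next v ⟧ + ⟦ j == prev v ⟧
    cell j with toSum (j ≟ next v) | toSum (j ≟ prev v)
    ... | inj₁ eq | _ = ≤-trans (⟦⟧≤1 _) (≤-trans (≤-reflexive (cong ⟦_⟧ (≡-sym (dec-true (j ≟ next v) eq)))) (m≤m+n _ _))
    ... | inj₂ _ | inj₁ eq = ≤-trans (⟦⟧≤1 _) (≤-trans (≤-reflexive (cong ⟦_⟧ (≡-sym (dec-true (j ≟ prev v) eq)))) (m≤n+m _ _))
    ... | inj₂ ne | inj₂ ne′ = ≤-trans (≤-reflexive (cong ⟦_⟧ (trans (cong₂ (λ a b → not (v == j) ∧ (a ∨ b)) (≢⇒== (ne ∘ ≡-sym)) (≢⇒== not-next)) (𝔹.∧-zeroʳ _)))) z≤n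
      where
      not-next : next j ≢ v
      not-next eq = ne′ (trans (≡-sym (inverseˡ (rotate n′ 1))) (cong prev eq))

  -- Each of the n′ rotations of the pairing uses h of the n′ cycle edges, each cycle edge being used h times.
  -- As 2 h < n′, two deleted edges cannot hit all rotations.
  cycle-survives : ∀ F → edges F < 3 → NearPerfect (delete cycle F)
  cycle-survives F few = let p , lt = exists-small hits 1 total in NearPerfect-push (rotate n′ (toℕ p)) (delete cycle F)
    (Pairing.pairing h (pull (rotate n′ (toℕ p)) (delete cycle F)) λ (i : Fin h) → delete-intro cycle F {at p (odd i)} {at p (even i)}
      (subst (λ x → adj cycle (at p (odd i)) x ≡ true) (≡-sym (at-even-next p i)) (cycle-edge (at p (odd i))))
      (⟦⟧≡0 (sum-≡0 {f = λ (i : Fin h) → ⟦ adj F (at p (odd i)) (at p (even i)) ⟧} (n<1⇒n≡0 lt) i)))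
    where
    at : Fin n′ → Fin n′ → Fin n′
    at p j = shift n′ (toℕ p) j
    at-even-next : ∀ p (i : Fin h) → at p (even i) ≡ next (at p (odd i))
    at-even-next p i = toℕ-injective (begin
      toℕ (at p (even i))                  ≡⟨ toℕ-shift n′ (toℕ p) (even i) ⟩
      (toℕ (even i) + toℕ p) % n′          ≡⟨ cong (λ x → (x + toℕ p) % n′) (trans (toℕ-even i) (cong (_+ 1) (≡-sym (toℕ-odd i)))) ⟩
      (toℕ (odd i) + 1 + toℕ p) % n′       ≡⟨ cong (_% n′) (rearr (toℕ (odd i)) (toℕ p)) ⟩
      (toℕ (odd i) + toℕ p + 1) % n′       ≡⟨ %-absorbˡ n′ (toℕ (odd i) + toℕ p) 1 ⟨
      ((toℕ (odd i) + toℕ p) % n′ + 1) % n′ ≡⟨ cong (λ x → (x + 1) % n′) (toℕ-shift n′ (toℕ p) (odd i)) ⟨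
      (toℕ (at p (odd i)) + 1) % n′        ≡⟨ toℕ-shift n′ 1 (at p (odd i)) ⟨
      toℕ (next (at p (odd i)))            ∎)
      where
      open ≡-Reasoning
      rearr : ∀ a b → a + 1 + b ≡ a + b + 1
      rearr = solve-∀
    -- Exchanging the two roles shows that, for a fixed pair of the pairing, its rotated copies run
    -- through every cycle edge exactly once.
    at-comm : ∀ p j → at p j ≡ at j p
    at-comm p j = toℕ-injective (trans (toℕ-shift n′ (toℕ p) j) (trans (cong (_% n′) (+-comm (toℕ j) (toℕ p))) (≡-sym (toℕ-shift n′ (toℕ j) p))))
    x : Fin n′ → ℕ
    x q = ⟦ adj F q (next q) ⟧
    hits : Fin n′ → ℕ
    hits p = sumFin {h} (λ i → ⟦ adj F (at p (odd i)) (at p (even i)) ⟧)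
    Σx≤2 : sumFin x ≤ 2
    Σx≤2 = *-cancelˡ-≤ 2 (begin
      2 * sumFin x                                            ≡⟨ cong (sumFin x +_) (+-identityʳ _) ⟩
      sumFin x + sumFin x                                     ≡⟨ cong (sumFin x +_) (sum-permute x (flip (rotate n′ 1))) ⟨
      sumFin x + sumFin (λ q → x (prev q))                    ≡⟨ sum-+ x (λ q → x (prev q)) ⟨
      sumFin (λ q → x q + x (prev q))                         ≤⟨ sum-mono-≤ cell ⟩
      sumFin (deg F)                                          ≡⟨ handshake F ⟨
      2 * edges F                                             ≤⟨ *-monoʳ-≤ 2 (s≤s⁻¹ few) ⟩
      2 * 2                                                   ∎)
      where
      open ≤-Reasoning
      -- The deleted cycle edges at q lead to `next q` and `prev q`, which are distinct; summed over
      -- q, each of them is counted twice.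
      cell : ∀ q → x q + x (prev q) ≤ deg F q
      cell q = begin
        x q + x (prev q)                                      ≡⟨ cong (λ b → x q + ⟦ b ⟧) (trans (cong (adj F (prev q)) (next-prev q)) (sym F (prev q) q)) ⟩
        ⟦ adj F q (next q) ⟧ + ⟦ adj F q (prev q) ⟧           ≤⟨ two-terms≤sum (λ j → ⟦ adj F q j ⟧) (next≢prev q) ⟩
        deg F q                                               ∎
    total : sumFin hits < n′ * 1
    total = begin-strict
      sumFin hits                                             ≡⟨ sum-comm (λ p (i : Fin h) → ⟦ adj F (at p (odd i)) (at p (even i)) ⟧) ⟩
      sumFin {h} (λ i → sumFin (λ p → ⟦ adj F (at p (odd i)) (at p (even i)) ⟧)) ≡⟨ sum-cong {h} (λ i → sum-cong (λ p → cong (λ y → ⟦ adj F (at p (odd i)) y ⟧) (at-even-next p i))) ⟩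
      sumFin {h} (λ i → sumFin (λ p → x (at p (odd i))))      ≡⟨ sum-cong {h} (λ i → trans (sum-cong (λ p → cong x (at-comm p (odd i)))) (sum-permute x (rotate n′ (toℕ (odd i))))) ⟩
      sumFin {h} (λ i → sumFin x)                             ≡⟨ sum-const h (sumFin x) ⟩
      h * sumFin x                                            ≤⟨ *-monoʳ-≤ h Σx≤2 ⟩
      h * 2                                                   <⟨ n<1+n (h * 2) ⟩
      n′                                                      ≡⟨ *-identityʳ n′ ⟨
      n′ * 1                                                  ∎
      where open ≤-Reasoning

-- Walecki's decomposition of the complete graph on ∞ and ℤ/2h into h Hamiltonian cycles:
-- the zigzag ∞, -1, 0, -2, 1, -3, … , turned by each c < h.
module Walecki (h : ℕ) (1≤h : 1 ≤ h) where
  open Cycle h 1≤h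

  N : ℕ
  N = h + h

  instance
    N-nonZero : NonZero N
    N-nonZero = >-nonZero (≤-trans 1≤h (m≤m+n h h))

  -- The zigzag without ∞: position 2i + 1 carries -(i + 1), written as h + (h - 1 - i), and
  -- position 2i + 2 carries i.
  place : Fin h × Fin 2 → Fin N
  place (i , zero)     = h ↑ʳ opposite i
  place (i , suc zero) = i ↑ˡ h

  zigzag : Permutation (h * 2) N
  zigzag = permutation to from to-from from-to
    where
    to : Fin (h * 2) → Fin N
    to a = place (remQuot {h} 2 a)
    unplace : Fin h ⊎ Fin h → Fin h × Fin 2
    unplace (inj₁ i) = i , suc zero
    unplace (inj₂ i) = opposite i , zero
    from : Fin N → Fin (h * 2)
    from a = uncurry combine (unplace (splitAt h a))
    to-from : ∀ a → to (from a) ≡ a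
    to-from a with splitAt h a in eq
    ... | inj₁ i = trans (cong place (remQuot-combine i (suc zero))) (splitAt⁻¹-↑ˡ eq)
    ... | inj₂ i = trans (cong place (remQuot-combine (opposite i) zero)) (trans (cong (h ↑ʳ_) (opposite-involutive i)) (splitAt⁻¹-↑ʳ {h} eq))
    unplace-place : ∀ x → unplace (splitAt h (place x)) ≡ x
    unplace-place (i , zero)     = trans (cong unplace (splitAt-↑ʳ h h (opposite i))) (cong (_, zero) (opposite-involutive i))
    unplace-place (i , suc zero) = cong unplace (splitAt-↑ˡ h i h)
    from-to : ∀ a → from (to a) ≡ a
    from-to a = trans (cong (uncurry combine) (unplace-place (remQuot {h} 2 a))) (combine-remQuot {h} 2 a)

  toℕ-zigzag-odd : ∀ i → toℕ (zigzag ⟨$⟩ʳ combine i zero) + suc (toℕ i) ≡ N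
  toℕ-zigzag-odd i = begin
    toℕ (zigzag ⟨$⟩ʳ combine i zero) + suc (toℕ i)    ≡⟨ cong (λ x → toℕ (place x) + suc (toℕ i)) (remQuot-combine i zero) ⟩
    toℕ (h ↑ʳ opposite i) + suc (toℕ i)               ≡⟨ cong (_+ suc (toℕ i)) (trans (toℕ-↑ʳ h (opposite i)) (cong (h +_) (opposite-prop i))) ⟩
    h + (h ∸ suc (toℕ i)) + suc (toℕ i)               ≡⟨ +-assoc h _ _ ⟩
    h + (h ∸ suc (toℕ i) + suc (toℕ i))               ≡⟨ cong (h +_) (m∸n+n≡m (toℕ<n i)) ⟩
    N                                                 ∎
    where open ≡-Reasoning

  toℕ-zigzag-even : ∀ i → toℕ (zigzag ⟨$⟩ʳ combine i (suc zero)) ≡ toℕ i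
  toℕ-zigzag-even i = trans (cong (toℕ ∘ place) (remQuot-combine i (suc zero))) (toℕ-↑ˡ i h)

  -- Turning by c adds 2c to every end sum, so the edges of the turned zigzag have sums 2c - 1 and
  -- 2c - 2 modulo N. Adding 2 and halving the residue recovers c.
  f : ℕ → ℕ
  f s = ((s + 2) % N) / 2

  colour : Fin (suc N) → Fin (suc N) → ℕ
  colour = sumColour f

  tour : ℕ → Permutation (suc (h * 2)) (suc N)
  tour c = lift₀ (zigzag ∘ₚ rotate N c)

  -- The ends of the edges of the unturned zigzag have sum -1 or -2.
  turned-f : ∀ c → c < h → ∀ x y b → b ≤ 1 → x + y + 2 ≡ N + b ⊎ x + y + 2 ≡ N + N →
    f ((x + c) % N + (y + c) % N) ≡ c
  turned-f c c<h x y b b≤1 sums = begin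
    ((x + c) % N + (y + c) % N + 2) % N / 2 ≡⟨ cong (_/ 2) (%-absorb₂ N (x + c) (y + c) 2) ⟩
    (x + c + (y + c) + 2) % N / 2           ≡⟨ cong (λ s → s % N / 2) (rearr x y c) ⟩
    (2 * c + (x + y + 2)) % N / 2           ≡⟨ reduce sums ⟩
    c                                       ∎
    where
    open ≡-Reasoning
    rearr : ∀ x y c → x + c + (y + c) + 2 ≡ 2 * c + (x + y + 2)
    rearr = solve-∀
    -- The hypothesis c < h keeps 2c + b below N, so it is its own residue and halving returns c.
    small : ∀ b → b ≤ 1 → b + c * 2 < N
    small b b≤1 = subst (b + c * 2 <_) (trans (*-comm h 2) (cong (h +_) (+-identityʳ h)))
      (≤-trans (s≤s (+-monoˡ-≤ (c * 2) b≤1)) (*-monoˡ-≤ 2 c<h))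
    half : ∀ b → b ≤ 1 → (b + c * 2) / 2 ≡ c
    half zero _ = m*n/n≡m c 2
    half (suc zero) _ = trans (cong (_/ 2) (+-comm 1 (c * 2))) (trans (+-distrib-/ (c * 2) 1 (s≤s (≤-reflexive (cong (_+ 1) (m*n%n≡0 c 2)))))
      (trans (cong (_+ 0) (m*n/n≡m c 2)) (+-identityʳ c)))
    half (suc (suc _)) (s≤s ())
    reduce : x + y + 2 ≡ N + b ⊎ x + y + 2 ≡ N + N → (2 * c + (x + y + 2)) % N / 2 ≡ c
    reduce (inj₁ eq) = trans (cong (λ s → (2 * c + s) % N / 2) eq)
      (trans (cong (λ s → s % N / 2) (eq₁ c N b)) (trans (cong (_/ 2) ([m+kn]%n≡m%n (b + c * 2) 1 N))
      (trans (cong (_/ 2) (m<n⇒m%n≡m (small b b≤1))) (half b b≤1))))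
      where
      eq₁ : ∀ c N b → 2 * c + (N + b) ≡ b + c * 2 + 1 * N
      eq₁ = solve-∀
    reduce (inj₂ eq) = trans (cong (λ s → (2 * c + s) % N / 2) eq)
      (trans (cong (λ s → s % N / 2) (eq₁ c N)) (trans (cong (_/ 2) ([m+kn]%n≡m%n (0 + c * 2) 2 N))
      (trans (cong (_/ 2) (m<n⇒m%n≡m (small 0 z≤n))) (half 0 z≤n))))
      where
      eq₁ : ∀ c N → 2 * c + (N + N) ≡ 0 + c * 2 + 2 * N
      eq₁ = solve-∀

  toℕ-tour : ∀ c a → toℕ (rotate N c ⟨$⟩ʳ (zigzag ⟨$⟩ʳ a)) ≡ (toℕ (zigzag ⟨$⟩ʳ a) + c) % N
  toℕ-tour c a = toℕ-shift N c (zigzag ⟨$⟩ʳ a)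

  toℕ-next : ∀ q → suc (toℕ q) < n′ → toℕ (next q) ≡ toℕ q + 1
  toℕ-next q lt = trans (toℕ-shift n′ 1 q) (m<n⇒m%n≡m (subst (_< n′) (+-comm 1 _) lt))

  odd<n′ : ∀ (i : Fin h) → suc (toℕ (odd i)) < n′
  odd<n′ i = subst (_< n′) (trans (toℕ-even i) (trans (cong (_+ 1) (≡-sym (toℕ-odd i))) (+-comm _ 1))) (toℕ<n (even i))

  next-odd : ∀ (i : Fin h) → next (odd i) ≡ even i
  next-odd i = toℕ-injective (trans (toℕ-next (odd i) (odd<n′ i)) (trans (cong (_+ 1) (toℕ-odd i)) (≡-sym (toℕ-even i))))

  next-start : ∀ (i : Fin h) → toℕ i ≡ 0 → next zero ≡ odd i
  next-start i i≡0 = toℕ-injective (trans (toℕ-next zero (s≤s (≤-trans (s≤s z≤n) (*-monoˡ-≤ 2 1≤h))))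
    (≡-sym (trans (toℕ-odd i) (cong (λ x → 2 * x + 1) i≡0))))

  next-even : ∀ (i j : Fin h) → toℕ j ≡ suc (toℕ i) → next (even i) ≡ odd j
  next-even i j j≡ = toℕ-injective (trans (toℕ-next (even i) lt) (trans (cong (_+ 1) (toℕ-even i)) (≡-sym eq)))
    where
    eq : toℕ (odd j) ≡ 2 * toℕ i + 1 + 1 + 1
    eq = trans (toℕ-odd j) (trans (cong (λ x → 2 * x + 1) j≡) (eq′ (toℕ i)))
      where
      eq′ : ∀ i → 2 * suc i + 1 ≡ 2 * i + 1 + 1 + 1
      eq′ = solve-∀
    lt : suc (toℕ (even i)) < n′
    lt = subst (_< n′) (trans eq (trans (cong (_+ 1) (≡-sym (toℕ-even i))) (+-comm _ 1))) (toℕ<n (odd j))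

  next-last : ∀ (i : Fin h) → suc (toℕ i) ≡ h → next (even i) ≡ zero
  next-last i i+1≡h = toℕ-injective (trans (toℕ-shift n′ 1 (even i)) (trans (cong (_% n′) eq) (n%n≡0 n′)))
    where
    eq : toℕ (even i) + 1 ≡ n′
    eq = trans (cong (_+ 1) (toℕ-even i)) (trans (eq′ (toℕ i)) (cong (λ x → suc (x * 2)) i+1≡h))
      where
      eq′ : ∀ i → 2 * i + 1 + 1 + 1 ≡ suc (suc i * 2)
      eq′ = solve-∀

  colour-next : ∀ c → c < h → ∀ q → colour (tour c ⟨$⟩ʳ q) (tour c ⟨$⟩ʳ next q) ≡ c
  colour-next c c<h q with position {h} q
  ... | start = subst (λ z → colour zero (tour c ⟨$⟩ʳ z) ≡ c) (≡-sym (next-start i₀ (toℕ-fromℕ< 1≤h)))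
    (trans (cong₂ (λ x y → f (x + y)) (toℕ-tour c (combine i₀ zero)) (toℕ-tour c (combine i₀ zero)))
      (turned-f c c<h x₀ x₀ 0 z≤n (inj₂ (trans (eq₁ x₀) (cong₂ _+_ x₀+1 x₀+1)))))
    where
    i₀ = fromℕ< 1≤h
    x₀ = toℕ (zigzag ⟨$⟩ʳ combine i₀ zero)
    x₀+1 : x₀ + 1 ≡ N
    x₀+1 = trans (cong (λ z → x₀ + suc z) (≡-sym (toℕ-fromℕ< 1≤h))) (toℕ-zigzag-odd i₀)
    eq₁ : ∀ x → x + x + 2 ≡ (x + 1) + (x + 1)
    eq₁ = solve-∀
  ... | at-odd i = subst (λ z → colour (tour c ⟨$⟩ʳ odd i) (tour c ⟨$⟩ʳ z) ≡ c) (≡-sym (next-odd i))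
    (trans (cong₂ (λ x y → f (x + y)) (toℕ-tour c (combine i zero)) (toℕ-tour c (combine i (suc zero))))
      (turned-f c c<h _ _ 1 ≤-refl (inj₁ (trans (cong (λ y → x + y + 2) (toℕ-zigzag-even i)) (trans (eq₁ x (toℕ i)) (cong (_+ 1) (toℕ-zigzag-odd i)))))))
    where
    x = toℕ (zigzag ⟨$⟩ʳ combine i zero)
    eq₁ : ∀ x i → x + i + 2 ≡ x + suc i + 1
    eq₁ = solve-∀
  ... | at-even i with m≤n⇒m<n∨m≡n (toℕ<n i)
  ...   | inj₁ lt = subst (λ z → colour (tour c ⟨$⟩ʳ even i) (tour c ⟨$⟩ʳ z) ≡ c) (≡-sym (next-even i j (toℕ-fromℕ< lt)))
    (trans (cong₂ (λ x y → f (x + y)) (toℕ-tour c (combine i (suc zero))) (toℕ-tour c (combine j zero)))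
      (turned-f c c<h _ _ 0 z≤n (inj₁ (trans (cong (λ y → y + x + 2) (toℕ-zigzag-even i)) (trans (eq₁ x (toℕ i))
        (trans (cong (_+ 0) (trans (cong (λ z → x + suc z) (≡-sym (toℕ-fromℕ< lt))) (toℕ-zigzag-odd j))) refl))))))
    where
    j = fromℕ< lt
    x = toℕ (zigzag ⟨$⟩ʳ combine j zero)
    eq₁ : ∀ x i → i + x + 2 ≡ x + suc (suc i) + 0
    eq₁ = solve-∀
  -- The last residue h - 1 closes the tour at ∞; coloured as a loop, this edge has sum 2h - 2,
  -- again -2 modulo N.
  ...   | inj₂ eq = subst (λ z → colour (tour c ⟨$⟩ʳ even i) (tour c ⟨$⟩ʳ z) ≡ c) (≡-sym (next-last i eq))
    (trans (cong₂ (λ x y → f (x + y)) (toℕ-tour c (combine i (suc zero))) (toℕ-tour c (combine i (suc zero))))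
      (turned-f c c<h _ _ 0 z≤n (inj₁ (trans (cong (λ y → y + y + 2) (toℕ-zigzag-even i)) (trans (eq₁ (toℕ i))
        (cong (λ z → z + z + 0) eq))))))
    where
    eq₁ : ∀ i → i + i + 2 ≡ suc i + suc i + 0
    eq₁ = solve-∀

  hamiltonian : ℕ → Graph (suc N)
  hamiltonian c = pull (flip (tour c)) cycle

  hamiltonians : (m : ℕ) → Graph (suc N)
  hamiltonians m = union {m} (hamiltonian ∘ toℕ)

  hamiltonian-coloured : ∀ c → c < h → ∀ i j → adj (hamiltonian c) i j ≡ true → colour i j ≡ c
  hamiltonian-coloured c c<h i j e = case
    where
    p = tour c ⟨$⟩ˡ i
    q = tour c ⟨$⟩ˡ j
    along : ∀ {i j} → next (tour c ⟨$⟩ˡ i) ≡ tour c ⟨$⟩ˡ j → colour i j ≡ c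
    along {i} {j} eq = subst₂ (λ x y → colour x y ≡ c) (inverseʳ (tour c) {i})
      (trans (cong (tour c ⟨$⟩ʳ_) eq) (inverseʳ (tour c) {j})) (colour-next c c<h (tour c ⟨$⟩ˡ i))
    case : colour i j ≡ c
    case with true⊎false (next p == q) | true⊎false (next q == p)
    ... | inj₁ pq | _ = along {i} {j} (==⇒≡ pq)
    ... | inj₂ _ | inj₁ qp = trans (sumColour-sym f i j) (along {j} {i} (==⇒≡ qp))
    ... | inj₂ ¬pq | inj₂ ¬qp = ⊥-elim (true≢false (proj₂ (∧-true {not (p == q)} e)) (cong₂ _∨_ ¬pq ¬qp))

  hamiltonian-survives : ∀ c F → edges F < 3 → HasPMorAPM (delete (hamiltonian c) F)
  hamiltonian-survives c F few = NearPerfect⇒APM D (NearPerfect-push (tour c) D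
    (NearPerfect-mono (delete cycle (pull (tour c) F)) (pull (tour c) D) include
      (cycle-survives (pull (tour c) F) (subst (_< 3) (≡-sym (edges-pull (tour c) F)) few))))
    where
    D = delete (hamiltonian c) F
    include : delete cycle (pull (tour c) F) ⊆G pull (tour c) D
    include i j = subst₂ (λ x y → adj cycle x y ∧ not (adj F (tour c ⟨$⟩ʳ i) (tour c ⟨$⟩ʳ j)) ≡ true)
      (≡-sym (inverseˡ (tour c) {i})) (≡-sym (inverseˡ (tour c) {j}))

  hamiltonians-robust : ∀ m → m ≤ h → Robust (hamiltonians m) (m * 3)
  hamiltonians-robust m m≤h = union-robust colour (sumColour-sym f) (hamiltonian ∘ toℕ)
    (λ c → hamiltonian-coloured (toℕ c) (<-≤-trans (toℕ<n c) m≤h)) 3 (λ c → hamiltonian-survives (toℕ c))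

  deg-hamiltonian : ∀ c v → deg (hamiltonian c) v ≤ 2
  deg-hamiltonian c v = subst (_≤ 2) (≡-sym (sum-permute (λ j → ⟦ adj cycle (tour c ⟨$⟩ˡ v) j ⟧) (flip (tour c)))) (deg-cycle (tour c ⟨$⟩ˡ v))

  edges-hamiltonians : ∀ m → 2 * edges (hamiltonians m) ≤ suc N * (m * 2)
  edges-hamiltonians m = edges-union {m} (hamiltonian ∘ toℕ) 2 λ c → deg-hamiltonian (toℕ c)

-- Near perfect matchings in dense graphs

complement-⊥ : (B : Graph n) {i j : Fin n} → adj (complement B) i j ≡ true → adj B i j ≡ false
complement-⊥ B {i} {j} e = not-true (proj₂ (∧-true {not (i == j)} e))

singleEdge-ends : (u v : Fin n) {i j : Fin n} → adj (singleEdge u v) i j ≡ true → (i ≡ u × j ≡ v) ⊎ (j ≡ u × i ≡ v)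
singleEdge-ends u v {i} {j} e with true⊎false ((i == u) ∧ (j == v)) | true⊎false ((j == u) ∧ (i == v))
... | inj₁ p | _ = inj₁ (==⇒≡ (proj₁ (∧-true p)) , ==⇒≡ (proj₂ (∧-true {i == u} p)))
... | inj₂ _ | inj₁ q = inj₂ (==⇒≡ (proj₁ (∧-true q)) , ==⇒≡ (proj₂ (∧-true {j == u} q)))
... | inj₂ ¬p | inj₂ ¬q = ⊥-elim (true≢false (proj₂ (∧-true {not (i == j)} e)) (cong₂ _∨_ ¬p ¬q))

module _ (v a : Fin n) where

  transpose-left : transpose v a ⟨$⟩ʳ v ≡ a
  transpose-left rewrite ==-refl v = refl

  transpose-right : transpose v a ⟨$⟩ʳ a ≡ v
  transpose-right with toSum (a ≟ v)
  ... | inj₁ refl rewrite ==-refl a = refl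
  ... | inj₂ a≢v rewrite ≢⇒== a≢v | ==-refl a = refl

  transpose-other : ∀ {i} → i ≢ v → i ≢ a → transpose v a ⟨$⟩ʳ i ≡ i
  transpose-other i≢v i≢a rewrite ≢⇒== i≢v | ≢⇒== i≢a = refl

-- A near perfect matching π avoiding B except for the pair u v is repaired by exchanging v with a:
-- the pairs u v and a (π a) become u a and v (π a), and if a is the uncovered vertex w, then v takes its place.
module Repair (B : Graph n) {u v : Fin n} (uv : adj B u v ≡ true)
  (π : Fin n → Fin n) (w : Fin n) (inv : ∀ i → π (π i) ≡ i) (πw≡w : π w ≡ w) (πu≡v : π u ≡ v)
  (good : ∀ i → i ≢ w → i ≢ u → i ≢ v → adj (complement B) i (π i) ≡ true) where

  private
    C = complement B
    u≢v : u ≢ v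
    u≢v = adj⇒≢ B uv
    πv≡u : π v ≡ u
    πv≡u = trans (cong π (≡-sym πu≡v)) (inv u)
    π-injective : ∀ {i j} → π i ≡ π j → i ≡ j
    π-injective {i} {j} eq = trans (≡-sym (inv i)) (trans (cong π eq) (inv j))

  u≢w : u ≢ w
  u≢w refl = u≢v (trans (≡-sym πw≡w) πu≡v)

  v≢w : v ≢ w
  v≢w refl = u≢v (trans (≡-sym πv≡u) πw≡w)

  exchange : ∀ a → a ≢ u → adj B u a ≡ false → (a ≡ w ⊎ adj B v (π a) ≡ false) → NearPerfect C
  exchange a a≢u ua other = NearPerfect-push τ C (π , w , inv , πw≡w , edge)
    where
    τ : Permutation′ n
    τ = transpose v a
    a≢v : a ≢ v
    a≢v refl = true≢false uv ua
    u~a : adj C u a ≡ true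
    u~a = complement-intro B (a≢u ∘ ≡-sym) ua
    v~πa : a ≢ w → adj C v (π a) ≡ true
    v~πa a≢w = [ ⊥-elim ∘ a≢w , avoids ]′ other
      where
      avoids : adj B v (π a) ≡ false → adj C v (π a) ≡ true
      avoids e = complement-intro B (λ eq → a≢u (π-injective (trans (≡-sym eq) (≡-sym πu≡v)))) e
    via : ∀ {x y x' y'} → x ≡ x' → y ≡ y' → adj C x' y' ≡ true → adj C x y ≡ true
    via refl refl e = e
    edge : ∀ i → i ≢ w → adj C (τ ⟨$⟩ʳ i) (τ ⟨$⟩ʳ π i) ≡ true
    edge i i≢w with toSum (i ≟ u) | toSum (i ≟ v) | toSum (i ≟ a) | toSum (π i ≟ a)
    ... | inj₁ refl | _ | _ | _ = via (transpose-other v a u≢v (a≢u ∘ ≡-sym)) (trans (cong (τ ⟨$⟩ʳ_) πu≡v) (transpose-left v a)) u~a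
    ... | inj₂ _ | inj₁ refl | _ | _ = via (transpose-left v a) (trans (cong (τ ⟨$⟩ʳ_) πv≡u) (transpose-other v a u≢v (a≢u ∘ ≡-sym)))
                                         (trans (sym C a u) u~a)
    ... | inj₂ i≢u | inj₂ i≢v | inj₁ refl | inj₁ πi≡a = ⊥-elim (adj⇒≢ C (good i i≢w i≢u i≢v) (≡-sym πi≡a))
    ... | inj₂ i≢u | inj₂ i≢v | inj₁ refl | inj₂ πi≢a = via (transpose-right v a)
      (transpose-other v a (λ eq → i≢u (π-injective (trans eq (≡-sym πu≡v)))) πi≢a) (v~πa i≢w)
    ... | inj₂ i≢u | inj₂ i≢v | inj₂ i≢a | inj₁ refl = via (transpose-other v a i≢v i≢a) (transpose-right v a)
      (trans (sym C i v) (subst (λ x → adj C v x ≡ true) (inv i) (v~πa λ eq → i≢w (π-injective (trans eq (≡-sym πw≡w))))))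
    ... | inj₂ i≢u | inj₂ i≢v | inj₂ i≢a | inj₂ πi≢a = via (transpose-other v a i≢v i≢a)
      (transpose-other v a (λ eq → i≢u (π-injective (trans eq (≡-sym πu≡v)))) πi≢a) (good i i≢w i≢u i≢v)

-- The Bondy–Chvátal closure step for near perfect matchings, read in the complement.
closure-step : (B : Graph n) {u v : Fin n} → adj B u v ≡ true → deg B u + deg B v ≤ n →
  NearPerfect (complement (eraseEdge B u v)) → NearPerfect (complement B)
closure-step {n} B {u} {v} uv small (π , w , inv , πw≡w , e) = by-partner (π u ≟ v)
  where
  old : ∀ i → i ≢ w → ¬ ((i ≡ u × π i ≡ v) ⊎ (π i ≡ u × i ≡ v)) → adj (complement B) i (π i) ≡ true
  old i i≢w not-uv with true⊎false (adj B i (π i)) | true⊎false (adj (singleEdge u v) i (π i))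
  ... | inj₂ ¬b | _ = complement-intro B (adj⇒≢ (complement (eraseEdge B u v)) (e i i≢w)) ¬b
  ... | inj₁ b | inj₂ ¬s = ⊥-elim (true≢false (delete-intro B (singleEdge u v) b ¬s) (complement-⊥ (eraseEdge B u v) (e i i≢w)))
  ... | inj₁ _ | inj₁ s = ⊥-elim (not-uv (singleEdge-ends u v {i} {π i} s))
  module _ (πu≡v : π u ≡ v) where
    vu : adj B v u ≡ true
    vu = trans (sym B v u) uv
    πv≡u : π v ≡ u
    πv≡u = trans (cong π (≡-sym πu≡v)) (inv u)
    good : ∀ i → i ≢ w → i ≢ u → i ≢ v → adj (complement B) i (π i) ≡ true
    good i i≢w i≢u i≢v = old i i≢w [ i≢u ∘ proj₁ , i≢v ∘ proj₂ ]′
    module R = Repair B uv π w inv πw≡w πu≡v good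
    module R′ = Repair B vu π w inv πw≡w πv≡u (λ i i≢w i≢v i≢u → good i i≢w i≢u i≢v)
    Exchangeable : Fin n → Set
    Exchangeable a = a ≢ u × adj B u a ≡ false × adj B v (π a) ≡ false
    -- If no exchange is possible, each a other than u is a B-neighbour of u or has its partner
    -- among those of v. Both hold for a = v and a = w, so the two degrees add up to at least (n -
    -- 1) + 2.
    crowded : (∀ a → ¬ Exchangeable a) → adj B u w ≡ true → adj B v w ≡ true → suc n ≤ deg B u + deg B v
    crowded none uw vw = +-cancelʳ-≤ 1 _ _ (begin
      suc n + 1                                                       ≡⟨ eq₁ n ⟩
      n + 1 + 1                                                       ≡⟨ cong₂ _+_ (cong₂ _+_ (∣everywhere∣ {n}) (sum-== v)) (sum-== w) ⟨
      sumFin {n} (λ _ → 1) + sumFin (λ a → ⟦ a == v ⟧) + sumFin (λ a → ⟦ a == w ⟧) ≡⟨ cong (_+ sumFin (λ a → ⟦ a == w ⟧)) (sum-+ {n} (λ _ → 1) (λ a → ⟦ a == v ⟧)) ⟨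
      sumFin (λ a → 1 + ⟦ a == v ⟧) + sumFin (λ a → ⟦ a == w ⟧)       ≡⟨ sum-+ (λ a → 1 + ⟦ a == v ⟧) (λ a → ⟦ a == w ⟧) ⟨
      sumFin (λ a → 1 + ⟦ a == v ⟧ + ⟦ a == w ⟧)                      ≤⟨ sum-mono-≤ cell ⟩
      sumFin (λ a → ⟦ adj B u a ⟧ + ⟦ adj B v (π a) ⟧ + ⟦ a == u ⟧)   ≡⟨ sum-+ (λ a → ⟦ adj B u a ⟧ + ⟦ adj B v (π a) ⟧) (λ a → ⟦ a == u ⟧) ⟩
      sumFin (λ a → ⟦ adj B u a ⟧ + ⟦ adj B v (π a) ⟧) + sumFin (λ a → ⟦ a == u ⟧) ≡⟨ cong₂ _+_ (sum-+ (λ a → ⟦ adj B u a ⟧) (λ a → ⟦ adj B v (π a) ⟧)) (sum-== u) ⟩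
      deg B u + sumFin (λ a → ⟦ adj B v (π a) ⟧) + 1                  ≡⟨ cong (λ s → deg B u + s + 1) (sum-permute (λ a → ⟦ adj B v a ⟧) (permutation π π inv inv)) ⟩
      deg B u + deg B v + 1                                           ∎)
      where
      open ≤-Reasoning
      eq₁ : ∀ n → suc n + 1 ≡ n + 1 + 1
      eq₁ = solve-∀
      by : ∀ {p q r x y : Bool} {p' q' r' x' y' : Bool} → p ≡ p' → q ≡ q' → x ≡ x' → y ≡ y' → r ≡ r' →
        1 + ⟦ p' ⟧ + ⟦ q' ⟧ ≤ ⟦ x' ⟧ + ⟦ y' ⟧ + ⟦ r' ⟧ → 1 + ⟦ p ⟧ + ⟦ q ⟧ ≤ ⟦ x ⟧ + ⟦ y ⟧ + ⟦ r ⟧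
      by refl refl refl refl refl le = le
      cell : ∀ a → 1 + ⟦ a == v ⟧ + ⟦ a == w ⟧ ≤ ⟦ adj B u a ⟧ + ⟦ adj B v (π a) ⟧ + ⟦ a == u ⟧
      cell a with toSum (a ≟ u) | toSum (a ≟ v) | toSum (a ≟ w)
      ... | inj₁ refl | _ | _ = by (≢⇒== (adj⇒≢ B uv)) (≢⇒== R.u≢w) (refl {x = adj B u a}) (refl {x = adj B v (π a)}) (==-refl a) (m≤n+m 1 _)
      ... | inj₂ _ | inj₁ refl | _ = by (==-refl a) (≢⇒== R.v≢w) uv (trans (cong (adj B a) πv≡u) vu) refl (m≤m+n 2 _)
      ... | inj₂ _ | inj₂ a≢v | inj₁ refl = by (≢⇒== a≢v) (==-refl a) uw (trans (cong (adj B v) πw≡w) vw) refl (m≤m+n 2 _)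
      ... | inj₂ a≢u | inj₂ a≢v | inj₂ a≢w with true⊎false (adj B u a) | true⊎false (adj B v (π a))
      ...   | inj₁ ua | _ = by (≢⇒== a≢v) (≢⇒== a≢w) ua refl refl (s≤s z≤n)
      ...   | inj₂ _ | inj₁ vπa = by (≢⇒== a≢v) (≢⇒== a≢w) (refl {x = adj B u a}) vπa (refl {x = a == u}) (≤-trans (m≤n+m 1 ⟦ adj B u a ⟧) (m≤m+n _ _))
      ...   | inj₂ ua | inj₂ vπa = ⊥-elim (none a (a≢u , ua , vπa))
    repair : NearPerfect (complement B)
    repair with any? (λ a → ¬? (a ≟ u) ×-dec (adj B u a 𝔹.≟ false) ×-dec (adj B v (π a) 𝔹.≟ false))
              | true⊎false (adj B u w) | true⊎false (adj B v w)
    ... | yes (a , a≢u , ua , vπa) | _ | _ = R.exchange a a≢u ua (inj₂ vπa)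
    ... | no _ | inj₂ uw | _ = R.exchange w (R.u≢w ∘ ≡-sym) uw (inj₁ refl)
    -- Here the uncovered vertex takes part with the roles of u and v interchanged.
    ... | no _ | inj₁ _ | inj₂ vw = R′.exchange w (R.v≢w ∘ ≡-sym) vw (inj₁ refl)
    ... | no none | inj₁ uw | inj₁ vw = ⊥-elim (<⇒≱ (crowded (λ a x → none (a , x)) uw vw) small)
  by-partner : Dec (π u ≡ v) → NearPerfect (complement B)
  by-partner (yes πu≡v) = repair πu≡v
  by-partner (no πu≢v) = π , w , inv , πw≡w , λ i i≢w → old i i≢w
    [ (λ (i≡u , πi≡v) → πu≢v (trans (cong π (≡-sym i≡u)) πi≡v))
    , (λ (πi≡u , i≡v) → πu≢v (trans (cong π (≡-sym πi≡u)) (trans (inv i) i≡v))) ]′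

-- Counting edges in a graph closed under the closure step

positive-argmin : (f : Fin n → ℕ) {a : Fin n} → 0 < f a → ∃ λ v → 0 < f v × (∀ w → 0 < f w → f v ≤ f w)
positive-argmin f {a} = go (f a) a ≤-refl
  where
  go : ∀ fuel a → f a ≤ fuel → 0 < f a → ∃ λ v → 0 < f v × (∀ w → 0 < f w → f v ≤ f w)
  go fuel a le pos with any? (λ w → (0 <? f w) ×-dec (f w <? f a))
  ... | no none = a , pos , λ w pos-w → ≮⇒≥ λ lt → none (w , pos-w , lt)
  go zero a le pos | yes (w , _ , lt) = ⊥-elim (<⇒≱ (<-≤-trans lt le) z≤n)
  go (suc fuel) a le pos | yes (w , pos-w , lt) = go fuel w (s≤s⁻¹ (≤-trans lt le)) pos-w

second-neighbour : (G : Graph n) {v a : Fin n} → 2 ≤ deg G v → ∃ λ b → adj G v b ≡ true × b ≢ a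
second-neighbour G {v} {a} 2≤ with any? (λ b → (adj G v b 𝔹.≟ true) ×-dec ¬? (b ≟ a))
... | yes x = x
... | no none = ⊥-elim (<⇒≱ 2≤ (≤-trans (sum-mono-≤ cell) (≤-reflexive (sum-== a))))
  where
  cell : ∀ b → ⟦ adj G v b ⟧ ≤ ⟦ b == a ⟧
  cell b = ⟦⟧-mono λ e → dec-true (b ≟ a) (decidable-stable (b ≟ a) λ b≢a → none (b , e , b≢a))

-- The stars at a and b share at most the edge between them.
two-degrees≤edges : (F : Graph n) {a b : Fin n} → a ≢ b → deg F a + deg F b ≤ edges F + 1
two-degrees≤edges F {a} {b} a≢b = begin
  deg F a + deg F b                                 ≡⟨ cong (deg F a +_) (deg-isolate F (a≢b ∘ ≡-sym)) ⟨
  deg F a + (deg F' b + ⟦ adj F a b ⟧)              ≤⟨ +-monoʳ-≤ (deg F a) (+-mono-≤ (m≤n+m (deg F' b) (edges (isolate F' b))) (⟦⟧≤1 _)) ⟩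
  deg F a + (edges (isolate F' b) + deg F' b + 1)   ≡⟨ cong (λ e → deg F a + (e + 1)) (edges-isolate F' b) ⟩
  deg F a + (edges F' + 1)                          ≡⟨ +-assoc (deg F a) (edges F') 1 ⟨
  deg F a + edges F' + 1                            ≡⟨ cong (_+ 1) (trans (+-comm (deg F a) (edges F')) (edges-isolate F a)) ⟩
  edges F + 1                                       ∎
  where
  open ≤-Reasoning
  F' = isolate F a

deg<n : (G : Graph n) (v : Fin n) → deg G v < n
deg<n G v = subst (deg G v <_) (deg+complement G v) (≤-<-trans (m≤m+n _ _) (m<m+n _ z<s))

-- Counting edges in a nonempty graph B closed under the closure step: if δ is its least positive degree,
-- the neighbours of a vertex of degree δ have degree at least n + 1 - δ.
module Stuck (h : ℕ) (B F : Graph (suc (h * 2))) (μ : ℕ) (μ≤1 : μ ≤ 1)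
  (B≤F : ∀ v → deg B v ≤ deg F v + μ) (few : edges F + 2 * μ + 2 ≤ 4 * h) (large : 6 ≤ h + μ)
  (stuck : ∀ u v → adj B u v ≡ true → suc (suc (h * 2)) ≤ deg B u + deg B v)
  (v : Fin (suc (h * 2))) (v>0 : 0 < deg B v) (minimal : ∀ w → 0 < deg B w → deg B v ≤ deg B w) where

  private
    N : ℕ
    N = suc (h * 2)
    δ = deg B v
    u = proj₁ (deg>0⇒adj B v>0)
    vu = proj₂ (deg>0⇒adj B v>0)

  -- The neighbour u has degree at most N - 1, while `stuck` requires a sum of at least N + 1.
  many : 2 ≤ δ
  many = +-cancelʳ-≤ (deg B u) _ _ (≤-trans (s≤s (deg<n B u)) (stuck v u vu))

  -- If δ = 2, both neighbours of v have degree at least N - 1 in B, so up to μ their full stars lie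
  -- in F. This costs at least 4h - 1 - 2μ edges, one more than `few` allows: it is the obstruction
  -- of `two-stars`, and the tight case.
  not-two : δ ≢ 2
  not-two δ≡2 = <⇒≱ (≤-trans (≤-reflexive (eq₃ (edges F) μ)) few) (linear (4 * h) (edges F + 1 + 2 * μ) 0 bound (eq₂ h (edges F) μ))
    where
    snd = second-neighbour B {v} {u} many
    x = proj₁ snd
    full : ∀ y → adj B v y ≡ true → h * 2 ≤ deg F y + μ
    full y vy = ≤-trans (s≤s⁻¹ (s≤s⁻¹ (subst (λ d → suc N ≤ d + deg B y) δ≡2 (stuck v y vy)))) (B≤F y)
    bound : h * 2 + h * 2 ≤ edges F + 1 + 2 * μ
    bound = begin
      h * 2 + h * 2                   ≤⟨ +-mono-≤ (full u vu) (full x (proj₁ (proj₂ snd))) ⟩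
      deg F u + μ + (deg F x + μ)     ≡⟨ eq₁ (deg F u) (deg F x) μ ⟩
      deg F u + deg F x + 2 * μ       ≤⟨ +-monoˡ-≤ (2 * μ) (two-degrees≤edges F (proj₂ (proj₂ snd) ∘ ≡-sym)) ⟩
      edges F + 1 + 2 * μ             ∎
      where
      open ≤-Reasoning
      eq₁ : ∀ a b m → a + m + (b + m) ≡ a + b + 2 * m
      eq₁ = solve-∀
    eq₂ : ∀ h e m → 4 * h + (e + 1 + 2 * m) + 0 ≡ e + 1 + 2 * m + (h * 2 + h * 2)
    eq₂ = solve-∀
    eq₃ : ∀ e m → suc (e + 1 + 2 * m) ≡ e + 2 * m + 2
    eq₃ = solve-∀

  support : Fin N → ℕ
  support x = ⟦ does (0 <? deg B x) ⟧

  support≥ : ∀ y → 0 < deg B y → deg B y + 1 ≤ sumFin support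
  support≥ y pos = begin
    deg B y + 1                                        ≡⟨ cong (deg B y +_) (sum-== y) ⟨
    deg B y + sumFin (λ x → ⟦ x == y ⟧)                ≡⟨ sum-+ (λ x → ⟦ adj B y x ⟧) (λ x → ⟦ x == y ⟧) ⟨
    sumFin (λ x → ⟦ adj B y x ⟧ + ⟦ x == y ⟧)          ≤⟨ sum-mono-≤ cell ⟩
    sumFin support                                     ∎
    where
    open ≤-Reasoning
    cell : ∀ x → ⟦ adj B y x ⟧ + ⟦ x == y ⟧ ≤ support x
    cell x with toSum (x ≟ y) | true⊎false (adj B y x)
    ... | inj₁ refl | _ = ≤-reflexive (trans (cong₂ (λ a b → ⟦ a ⟧ + ⟦ b ⟧) (irrefl B x) (==-refl x)) (cong ⟦_⟧ (≡-sym (dec-true (0 <? deg B x) pos))))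
    ... | inj₂ x≢y | inj₁ yx = ≤-reflexive (trans (cong₂ (λ a b → ⟦ a ⟧ + ⟦ b ⟧) yx (≢⇒== x≢y))
      (cong ⟦_⟧ (≡-sym (dec-true (0 <? deg B x) (adj⇒deg>0 B (trans (sym B x y) yx))))))
    ... | inj₂ x≢y | inj₂ ¬yx = ≤-trans (≤-reflexive (cong₂ (λ a b → ⟦ a ⟧ + ⟦ b ⟧) ¬yx (≢⇒== x≢y))) z≤n

  B≤F+1 : ∀ x → deg B x ≤ deg F x + 1
  B≤F+1 x = ≤-trans (B≤F x) (+-monoʳ-≤ (deg F x) μ≤1)

  -- d = δ - 1 and g bounds the excess degree of the neighbours of v.
  degree-count : ∀ d g → δ ≡ d + 1 → (∀ x → adj B v x ≡ true → d + 1 + g ≤ deg B x) → d * sumFin support + g * δ ≤ 2 * edges F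
  degree-count d g δ≡ excess = begin
    d * sumFin support + g * δ                                      ≡⟨ cong₂ _+_ (sum-*ˡ d support) (sum-*ˡ g (λ x → ⟦ adj B v x ⟧)) ⟨
    sumFin (λ x → d * support x) + sumFin (λ x → g * ⟦ adj B v x ⟧) ≡⟨ sum-+ (λ x → d * support x) (λ x → g * ⟦ adj B v x ⟧) ⟨
    sumFin (λ x → d * support x + g * ⟦ adj B v x ⟧)                ≤⟨ sum-mono-≤ cell ⟩
    sumFin (deg F)                                                  ≡⟨ handshake F ⟨
    2 * edges F                                                     ∎
    where
    open ≤-Reasoning
    by : ∀ {p q p' q' : Bool} {b} → p ≡ p' → q ≡ q' → d * ⟦ p' ⟧ + g * ⟦ q' ⟧ ≤ b → d * ⟦ p ⟧ + g * ⟦ q ⟧ ≤ b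
    by refl refl le = le
    cell : ∀ x → d * support x + g * ⟦ adj B v x ⟧ ≤ deg F x
    cell x with toSum (0 <? deg B x) | true⊎false (adj B v x)
    ... | inj₁ pos | inj₁ vx = by (dec-true (0 <? deg B x) pos) vx (+-cancelʳ-≤ 1 _ _
      (≤-trans (≤-reflexive (eq d g)) (≤-trans (excess x vx) (B≤F+1 x))))
      where
      eq : ∀ d g → d * 1 + g * 1 + 1 ≡ d + 1 + g
      eq = solve-∀
    ... | inj₁ pos | inj₂ ¬vx = by (dec-true (0 <? deg B x) pos) ¬vx (+-cancelʳ-≤ 1 _ _
      (≤-trans (≤-reflexive (eq d g)) (≤-trans (subst (_≤ deg B x) δ≡ (minimal x pos)) (B≤F+1 x))))
      where
      eq : ∀ d g → d * 1 + g * 0 + 1 ≡ d + 1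
      eq = solve-∀
    ... | inj₂ ¬pos | inj₁ vx = ⊥-elim (¬pos (adj⇒deg>0 B (trans (sym B x v) vx)))
    ... | inj₂ ¬pos | inj₂ ¬vx = by (dec-false (0 <? deg B x) ¬pos) ¬vx (≤-trans (≤-reflexive (eq d g)) z≤n)
      where
      eq : ∀ d g → d * 0 + g * 0 ≡ 0
      eq = solve-∀

  few₂ : 2 * edges F + 4 * μ + 4 ≤ 8 * h
  few₂ = subst₂ _≤_ (eq₁ (edges F) μ) (eq₂ h) (*-monoʳ-≤ 2 few)
    where
    eq₁ : ∀ e m → 2 * (e + 2 * m + 2) ≡ 2 * e + 4 * m + 4
    eq₁ = solve-∀
    eq₂ : ∀ h → 2 * (4 * h) ≡ 8 * h
    eq₂ = solve-∀

  -- The range 3 ≤ δ ≤ h + 1. Here 2g = N + 1 - 2δ is the amount by which the neighbours of v exceed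
  -- δ in degree, and one neighbour with its own neighbours shows that at least δ + 2g + 1 vertices
  -- have positive degree.
  small-δ : ∀ d g → δ ≡ d + 3 → h ≡ 2 + d + g → ⊥
  small-δ d g δ≡ h≡ = arith d (linear _ _ 0 combined (eq₃ d g μ)) (subst (λ h → 6 ≤ h + μ) h≡ large)
    where
    excess : ∀ x → adj B v x ≡ true → d + 2 + 1 + 2 * g ≤ deg B x
    excess x vx = +-cancelˡ-≤ (d + 3) _ _ (subst₂ _≤_ (trans (cong (λ h → suc (suc (h * 2))) h≡) (eq₁ d g)) (cong (_+ deg B x) δ≡) (stuck v x vx))
      where
      eq₁ : ∀ d g → suc (suc ((2 + d + g) * 2)) ≡ d + 3 + (d + 2 + 1 + 2 * g)
      eq₁ = solve-∀
    combined : (d + 2) * (d + 2 + 1 + 2 * g + 1) + 2 * g * (d + 3) + 4 * μ + 4 ≤ 8 * (2 + d + g)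
    combined = begin
      (d + 2) * (d + 2 + 1 + 2 * g + 1) + 2 * g * (d + 3) + 4 * μ + 4
        ≤⟨ +-monoˡ-≤ 4 (+-monoˡ-≤ (4 * μ) (+-monoˡ-≤ (2 * g * (d + 3)) (*-monoʳ-≤ (d + 2)
             (≤-trans (+-monoˡ-≤ 1 (excess u vu)) (support≥ u (adj⇒deg>0 B (trans (sym B u v) vu))))))) ⟩
      (d + 2) * sumFin support + 2 * g * (d + 3) + 4 * μ + 4
        ≡⟨ cong (λ x → (d + 2) * sumFin support + 2 * g * x + 4 * μ + 4) δ≡ ⟨
      (d + 2) * sumFin support + 2 * g * δ + 4 * μ + 4
        ≤⟨ +-monoˡ-≤ 4 (+-monoˡ-≤ (4 * μ) (degree-count (d + 2) (2 * g) (trans δ≡ (≡-sym (+-assoc d 2 1))) excess)) ⟩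
      2 * edges F + 4 * μ + 4
        ≤⟨ few₂ ⟩
      8 * h
        ≡⟨ cong (8 *_) h≡ ⟩
      8 * (2 + d + g) ∎
      where open ≤-Reasoning
    eq₃ : ∀ d g m → d * d + 4 * (d * g) + 2 * g + 4 * m + 8 * (2 + d + g) + 0
      ≡ 4 + 2 * d + ((d + 2) * (d + 2 + 1 + 2 * g + 1) + 2 * g * (d + 3) + 4 * m + 4)
    eq₃ = solve-∀
    -- With d + g + μ ≥ 4, the left-hand side exceeds the right-hand side for every d.
    arith : ∀ d → d * d + 4 * (d * g) + 2 * g + 4 * μ ≤ 4 + 2 * d → 6 ≤ 2 + d + g + μ → ⊥
    arith 0 le lg = <⇒≱ {0} z<s (linear 1 0 (2 * μ + 3) (+-mono-≤ le (*-monoʳ-≤ 2 lg)) (eq g μ))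
      where
      eq : ∀ g m → 1 + (4 + 2 * 0 + 2 * (2 + 0 + g + m)) + (2 * m + 3) ≡ 0 + (0 * 0 + 4 * (0 * g) + 2 * g + 4 * m + 2 * 6)
      eq = solve-∀
    arith 1 le lg = <⇒≱ {0} z<s (linear 1 0 (6 + 2 * g) (+-mono-≤ le (*-monoʳ-≤ 4 lg)) (eq g μ))
      where
      eq : ∀ g m → 1 + (4 + 2 * 1 + 4 * (2 + 1 + g + m)) + (6 + 2 * g) ≡ 0 + (1 * 1 + 4 * (1 * g) + 2 * g + 4 * m + 4 * 6)
      eq = solve-∀
    arith 2 le lg = <⇒≱ {0} z<s (linear 1 0 (3 + 6 * g) (+-mono-≤ le (*-monoʳ-≤ 4 lg)) (eq g μ))
      where
      eq : ∀ g m → 1 + (4 + 2 * 2 + 4 * (2 + 2 + g + m)) + (3 + 6 * g) ≡ 0 + (2 * 2 + 4 * (2 * g) + 2 * g + 4 * m + 4 * 6)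
      eq = solve-∀
    arith 3 le lg = <⇒≱ {0} z<s (linear 1 0 (2 + 10 * g) (+-mono-≤ le (*-monoʳ-≤ 4 lg)) (eq g μ))
      where
      eq : ∀ g m → 1 + (4 + 2 * 3 + 4 * (2 + 3 + g + m)) + (2 + 10 * g) ≡ 0 + (3 * 3 + 4 * (3 * g) + 2 * g + 4 * m + 4 * 6)
      eq = solve-∀
    arith (suc (suc (suc (suc d)))) le _ = <⇒≱ {0} z<s (linear 1 0 (3 + 6 * d + d * d + 18 * g + 4 * (d * g) + 4 * μ) le (eq d g μ))
      where
      eq : ∀ d g m → 1 + (4 + 2 * (4 + d)) + (3 + 6 * d + d * d + 18 * g + 4 * (d * g) + 4 * m)
        ≡ 0 + ((4 + d) * (4 + d) + 4 * ((4 + d) * g) + 2 * g + 4 * m)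
      eq = solve-∀

  -- In this range N + 1 - δ is below δ, so minimality alone is used: at least δ + 1 vertices have
  -- degree at least δ in B, hence at least δ - 1 in F.
  large-δ : h + 2 ≤ δ → ⊥
  large-δ h+2≤δ = arith h (begin
    (h + 1) * (h + 3) + 4                                   ≤⟨ +-monoˡ-≤ 4 (*-mono-≤ h+1≤ (≤-trans (≤-reflexive (≡-sym (+-assoc h 2 1))) (+-monoˡ-≤ 1 h+2≤δ))) ⟩
    (δ ∸ 1) * (δ + 1) + 4                                   ≤⟨ +-monoˡ-≤ 4 (*-monoʳ-≤ (δ ∸ 1) (support≥ v v>0)) ⟩
    (δ ∸ 1) * sumFin support + 4                            ≡⟨ cong (_+ 4) (+-identityʳ _) ⟨
    (δ ∸ 1) * sumFin support + 0 * δ + 4                    ≤⟨ +-monoˡ-≤ 4 (degree-count (δ ∸ 1) 0 δ≡ excess) ⟩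
    2 * edges F + 4                                         ≤⟨ +-monoˡ-≤ 4 (m≤m+n _ (4 * μ)) ⟩
    2 * edges F + 4 * μ + 4                                 ≤⟨ few₂ ⟩
    8 * h                                                   ∎)
    where
    open ≤-Reasoning
    δ≡ : δ ≡ δ ∸ 1 + 1
    δ≡ = ≡-sym (m∸n+n≡m v>0)
    h+1≤ : h + 1 ≤ δ ∸ 1
    h+1≤ = +-cancelʳ-≤ 1 _ _ (≤-trans (≤-reflexive (+-assoc h 1 1)) (≤-trans h+2≤δ (≤-reflexive δ≡)))
    excess : ∀ x → adj B v x ≡ true → δ ∸ 1 + 1 + 0 ≤ deg B x
    excess x vx = subst (_≤ deg B x) (trans δ≡ (≡-sym (+-identityʳ _))) (minimal x (adj⇒deg>0 B (trans (sym B x v) vx)))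
    arith : ∀ h → (h + 1) * (h + 3) + 4 ≤ 8 * h → ⊥
    arith zero ()
    arith (suc zero) le = <⇒≱ {8} (s≤s (m≤m+n 8 3)) le
    arith (suc (suc z)) le = <⇒≱ {0} z<s (linear 1 0 (2 + z * z) le (eq z))
      where
      eq : ∀ z → 1 + 8 * (2 + z) + (2 + z * z) ≡ 0 + ((2 + z + 1) * (2 + z + 3) + 4)
      eq = solve-∀

  impossible : ⊥
  -- The division is between δ ≤ h + 1 and δ ≥ h + 2; at δ = h + 1 the bounds N + 1 - δ and δ
  -- coincide.
  impossible with d + 2 ≤? h
    where d = δ ∸ 3
  ... | yes le = small-δ (δ ∸ 3) (h ∸ (2 + (δ ∸ 3))) (≡-sym (m∸n+n≡m 3≤δ)) (≡-sym (m+[n∸m]≡n (subst (_≤ h) (+-comm _ 2) le)))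
    where
    3≤δ : 3 ≤ δ
    3≤δ = ≤∧≢⇒< many (not-two ∘ ≡-sym)
  ... | no ¬le = large-δ (subst (h + 2 ≤_) (m∸n+n≡m 3≤δ) (≤-trans (+-monoˡ-≤ 2 (s≤s⁻¹ (≰⇒> ¬le′))) (≤-reflexive (+-assoc (δ ∸ 3) 1 2))))
    where
    3≤δ : 3 ≤ δ
    3≤δ = ≤∧≢⇒< many (not-two ∘ ≡-sym)
    ¬le′ : ¬ (suc (δ ∸ 3 + 1) ≤ h)
    ¬le′ = ¬le ∘ ≤-trans (≤-reflexive (+-suc (δ ∸ 3) 1))

-- B shrinks by closure steps while F stays fixed, so the degree bound persists. The process ends
-- either with B empty, where any pairing will do, or in a closed nonempty graph, which `Stuck`
-- excludes.
complement-nearPerfect : ∀ h (B F : Graph (suc (h * 2))) (μ : ℕ) → μ ≤ 1 → (∀ v → deg B v ≤ deg F v + μ) →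
  edges F + 2 * μ + 2 ≤ 4 * h → 6 ≤ h + μ → NearPerfect (complement B)
complement-nearPerfect h B₀ F μ μ≤1 B₀≤F few large = go (edges B₀) B₀ ≤-refl B₀≤F
  where
  N = suc (h * 2)
  go : ∀ fuel (B : Graph N) → edges B ≤ fuel → (∀ v → deg B v ≤ deg F v + μ) → NearPerfect (complement B)
  go fuel B le B≤F with any? (λ u → any? λ v → (adj B u v 𝔹.≟ true) ×-dec (deg B u + deg B v ≤? N))
  go zero B le B≤F | yes (u , v , uv , _) = ⊥-elim (true≢false uv (edges-≡0 B (n≤0⇒n≡0 le) u v))
  go (suc fuel) B le B≤F | yes (u , v , uv , small) = closure-step B uv small
    (go fuel (eraseEdge B u v) (+-cancelʳ-≤ 1 _ _ (subst₂ _≤_ (≡-sym (edges-eraseEdge B uv)) (+-comm 1 fuel) le))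
      λ x → ≤-trans (deg-mono (eraseEdge B u v) B (delete-⊆ B (singleEdge u v)) x) (B≤F x))
  ... | no closed with any? (λ a → 0 <? deg B a)
  ...   | no isolated = Pairing.pairing h (complement B) λ i → complement-intro B (Pairing.odd≢even h i)
    (𝔹.¬-not λ e → isolated (odd i , adj⇒deg>0 B e))
  ...   | yes (a , a>0) with positive-argmin (deg B) a>0
  ...     | v , v>0 , minimal = ⊥-elim (Stuck.impossible h B F μ μ≤1 B≤F few large
    (λ x y xy → ≰⇒> λ le → closed (x , y , xy , le)) v v>0 minimal)

-- Extremal graphs

Robust-≤ : {l : ℕ} (G : Graph n) → k ≤ l → Robust G l → Robust G k
Robust-≤ G k≤l rob H H⊆G lt = rob H H⊆G (<-≤-trans lt (+-monoʳ-≤ (edges H) k≤l))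

half-≤ : ∀ {x e} → x ≤ 2 * e → x / 2 ≤ e
half-≤ {x} {e} le = subst (x / 2 ≤_) (trans (cong (_/ 2) (*-comm 2 e)) (m*n/n≡m e 2)) (/-monoˡ-≤ 2 le)

≤-half : ∀ {x e} → 2 * e ≤ x → e ≤ x / 2
≤-half {x} {e} le = subst (_≤ x / 2) (trans (cong (_/ 2) (*-comm 2 e)) (m*n/n≡m e 2)) (/-monoˡ-≤ 2 le)

emptyGraph : Graph n
emptyGraph = record { adj = λ _ _ → false ; sym = λ _ _ → refl ; irrefl = λ _ → refl }

deg-emptyGraph : (v : Fin n) → deg emptyGraph v ≡ 0
deg-emptyGraph {n} v = sum-zero {n} (λ _ → 0) λ _ → refl

edges-emptyGraph : edges (emptyGraph {n}) ≡ 0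
edges-emptyGraph {n} = *-cancelˡ-≡ _ 0 2 (trans (handshake {n} emptyGraph) (sum-zero {n} (deg emptyGraph) deg-emptyGraph))

s-even : ∀ h → k ≤ suc (2 * h) → SIs (suc (suc (2 * h))) k ((suc (suc (2 * h)) * k) / 2)
s-even {k} h k≤ = SIs-intro _ (λ G rob → half-≤ (lower-even (suc h) G (cong suc (≡-sym (+-suc h (h + 0)))) rob))
  (factors k) (factors-robust k k≤) (≤-half (edges-factors k))
  where open RoundRobin h

complement-complement-⊆ : (H : Graph n) → complement (complement H) ⊆G H
complement-complement-⊆ H i j e with true⊎false (adj H i j)
... | inj₁ h = h
... | inj₂ ¬h = ⊥-elim (true≢false (complement-intro H (adj⇒≢ (complement (complement H)) e) ¬h) (complement-⊥ (complement H) e))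

-- A pair absent from H was absent already, as an edge of B, or has been deleted, as an edge of F.
-- With N = 2h + 1 the last numerical condition says k ≤ 2N - 3 - 2μ.
complement-robust : ∀ h (B : Graph (suc (h * 2))) μ → μ ≤ 1 → (∀ v → deg B v ≤ μ) → 6 ≤ h + μ →
  k + 2 * μ + 1 ≤ 4 * h → Robust (complement B) k
complement-robust {k} h B μ μ≤1 B≤ large k≤ H H⊆ lt = NearPerfect⇒APM H (NearPerfect-mono (complement (complement H)) H (complement-complement-⊆ H)
  (complement-nearPerfect h (complement H) F μ μ≤1 bound (≤-trans few k≤) large))
  where
  F = delete (complement B) H
  few : edges F + 2 * μ + 2 ≤ k + 2 * μ + 1
  few = begin
    edges F + 2 * μ + 2      ≡⟨ eq (edges F) μ ⟩
    suc (edges F) + 2 * μ + 1 ≤⟨ +-monoˡ-≤ 1 (+-monoˡ-≤ (2 * μ) F<k) ⟩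
    k + 2 * μ + 1            ∎
    where
    open ≤-Reasoning
    eq : ∀ e m → e + 2 * m + 2 ≡ suc e + 2 * m + 1
    eq = solve-∀
    F<k : edges F < k
    F<k = +-cancelʳ-< (edges H) _ _ (subst₂ _<_ (≡-sym (edges-delete (complement B) H H⊆)) (+-comm (edges H) k) lt)
  cell : ∀ v j → ⟦ adj (complement H) v j ⟧ ≤ ⟦ adj F v j ⟧ + ⟦ adj B v j ⟧
  cell v j with true⊎false (adj (complement H) v j) | true⊎false (adj B v j)
  ... | inj₂ ¬c | _ = ≤-trans (≤-reflexive (cong ⟦_⟧ ¬c)) z≤n
  ... | inj₁ _ | inj₁ b = ≤-trans (⟦⟧≤1 _) (≤-trans (≤-reflexive (cong ⟦_⟧ (≡-sym b))) (m≤n+m _ _))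
  ... | inj₁ c | inj₂ ¬b = ≤-trans (⟦⟧≤1 _) (≤-trans (≤-reflexive (cong ⟦_⟧ (≡-sym (delete-intro (complement B) H
    (complement-intro B (adj⇒≢ (complement H) c) ¬b) (complement-⊥ H c))))) (m≤m+n _ _))
  bound : ∀ v → deg (complement H) v ≤ deg F v + μ
  bound v = begin
    deg (complement H) v                            ≤⟨ sum-mono-≤ (cell v) ⟩
    sumFin (λ j → ⟦ adj F v j ⟧ + ⟦ adj B v j ⟧)    ≡⟨ sum-+ (λ j → ⟦ adj F v j ⟧) (λ j → ⟦ adj B v j ⟧) ⟩
    deg F v + deg B v                               ≤⟨ +-monoʳ-≤ (deg F v) (B≤ v) ⟩
    deg F v + μ                                     ∎
    where open ≤-Reasoning

-- Values and bounds for odd order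

module Odd (h-1 : ℕ) where
  h N : ℕ
  h = suc h-1
  N = suc (h * 2)

  2N≡ : 2 * N ≡ 4 * h + 2
  2N≡ = eq h
    where
    eq : ∀ h → 2 * suc (h * 2) ≡ 4 * h + 2
    eq = solve-∀

  half-pairs : (N * (N ∸ 1)) / 2 ≡ N * h
  half-pairs = trans (cong (_/ 2) (≡-sym (*-assoc N h 2))) (m*n/n≡m (N * h) 2)

  half-N : (N ∸ 1) / 2 ≡ h
  half-N = m*n/n≡m h 2

  complementary : (G : Graph N) → edges G + edges (complement G) ≡ N * h
  complementary G = *-cancelˡ-≡ _ _ 2 (+-cancelʳ-≡ N _ _ (trans (edges+complement G) (eq h)))
    where
    eq : ∀ h → suc (h * 2) * suc (h * 2) ≡ 2 * (suc (h * 2) * h) + suc (h * 2)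
    eq = solve-∀

  hamiltonian-union : ∀ m → m ≤ h → Σ (Graph N) λ G → Robust G (m * 3) × edges G ≤ N * m
  hamiltonian-union m m≤h = subst (λ n → Σ (Graph n) λ G → Robust G (m * 3) × edges G ≤ n * m) (cong suc (eq h))
    (hamiltonians m , hamiltonians-robust m m≤h , *-cancelˡ-≤ 2 (≤-trans (edges-hamiltonians m) (≤-reflexive (eq₂ (h + h) m))))
    where
    open Walecki h (s≤s z≤n)
    eq : ∀ h → h + h ≡ h * 2
    eq = solve-∀
    eq₂ : ∀ a m → suc a * (m * 2) ≡ 2 * (suc a * m)
    eq₂ = solve-∀

  complete : Graph N
  complete = complement emptyGraph

  edges-complete : edges complete ≡ N * h
  edges-complete = trans (cong (_+ edges complete) (≡-sym (edges-emptyGraph {N}))) (complementary emptyGraph)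

  complete-nearPerfect : NearPerfect complete
  complete-nearPerfect = Pairing.pairing h complete λ i → complement-intro emptyGraph (Pairing.odd≢even h i) refl

  complete-robust : 6 ≤ h → Robust complete (2 * N ∸ 3)
  complete-robust 6≤h = complement-robust h emptyGraph 0 z≤n (λ v → ≤-reflexive (deg-emptyGraph v)) (≤-trans 6≤h (m≤m+n h 0))
    (+-cancelʳ-≤ 2 _ _ (≤-reflexive (trans (eq (2 * N ∸ 3)) (trans (m∸n+n≡m 3≤2N) 2N≡))))
    where
    eq : ∀ x → x + 2 * 0 + 1 + 2 ≡ x + 3
    eq = solve-∀
    3≤2N : 3 ≤ 2 * N
    3≤2N = ≤-trans (s≤s (s≤s (s≤s z≤n))) (m≤m+n N (N + 0))

  -- Since k stays below 2N - 5, μ = 1 may be chosen although nothing is missing; this lowers the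
  -- demand on h from 6 to 5, as `upper-graph` requires.
  complete-robust-5 : 5 ≤ h → Robust complete (2 * N ∸ 6)
  complete-robust-5 5≤h = complement-robust h emptyGraph 1 ≤-refl (λ v → ≤-trans (≤-reflexive (deg-emptyGraph v)) z≤n) (+-monoˡ-≤ 1 5≤h)
    (+-cancelʳ-≤ 2 _ _ (begin
      2 * N ∸ 6 + 2 * 1 + 1 + 2  ≤⟨ m≤m+n _ 1 ⟩
      2 * N ∸ 6 + 2 * 1 + 1 + 2 + 1 ≡⟨ eq (2 * N ∸ 6) ⟩
      2 * N ∸ 6 + 6              ≡⟨ m∸n+n≡m 6≤2N ⟩
      2 * N                      ≡⟨ 2N≡ ⟩
      4 * h + 2                  ∎))
    where
    open ≤-Reasoning
    eq : ∀ x → x + 2 * 1 + 1 + 2 + 1 ≡ x + 6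
    eq = solve-∀
    6≤2N : 6 ≤ 2 * N
    6≤2N = *-monoʳ-≤ 2 (s≤s (s≤s (s≤s z≤n)))

  missing-matching : Graph N
  missing-matching = complement (nearMatching complete complete-nearPerfect)

  missing-matching-robust : 5 ≤ h → Robust missing-matching (2 * N ∸ 5)
  missing-matching-robust 5≤h = complement-robust h (nearMatching complete complete-nearPerfect) 1 ≤-refl
    (deg-nearMatching≤1 complete complete-nearPerfect) (+-monoˡ-≤ 1 5≤h)
    (+-cancelʳ-≤ 2 _ _ (≤-reflexive (trans (eq (2 * N ∸ 5)) (trans (m∸n+n≡m 5≤2N) 2N≡))))
    where
    eq : ∀ x → x + 2 * 1 + 1 + 2 ≡ x + 5
    eq = solve-∀
    5≤2N : 5 ≤ 2 * N
    5≤2N = ≤-trans (n≤1+n 5) (*-monoʳ-≤ 2 {3} {N} (s≤s (s≤s (s≤s z≤n))))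

  edges-nearMatching≡h : edges (nearMatching complete complete-nearPerfect) ≡ h
  edges-nearMatching≡h = *-cancelˡ-≡ _ _ 2 (+-cancelʳ-≡ 1 _ _ (trans (edges-nearMatching complete complete-nearPerfect) (eq h)))
    where
    eq : ∀ h → suc (h * 2) ≡ 2 * h + 1
    eq = solve-∀

  lower-from-complement : (G : Graph N) (s : ℕ) → edges (complement G) ≤ s → N * h ∸ s ≤ edges G
  lower-from-complement G s le = m≤n+o⇒m∸n≤o _ s (≤-trans (≤-reflexive (trans (≡-sym (complementary G)) (+-comm (edges G) _))) (+-monoˡ-≤ (edges G) le))

  sparse : ∀ s → s + 3 ≤ 2 * N → (G : Graph N) → Robust G (2 * N ∸ (s + 3)) → SparsePairs (complement G) s
  sparse s le G = robust⇒sparse-complement G s (trans (eq (2 * N ∸ (s + 3)) s) (m∸n+n≡m le))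
    where
    eq : ∀ x s → x + 3 + s ≡ x + (s + 3)
    eq = solve-∀

  s-2n-3 : 6 ≤ h → SIs N (2 * N ∸ 3) ((N * (N ∸ 1)) / 2)
  s-2n-3 6≤h = subst (SIs N (2 * N ∸ 3)) (≡-sym half-pairs) (SIs-intro (N * h)
    (λ G rob → lower-from-complement G 0 (sparse≤1 (complement G) z≤n (sparse 0 3≤2N G rob)))
    complete (complete-robust 6≤h) (≤-reflexive edges-complete))
    where
    3≤2N : 3 ≤ 2 * N
    3≤2N = ≤-trans (s≤s (s≤s (s≤s z≤n))) (m≤m+n N (N + 0))

  s-2n-4 : 6 ≤ h → SIs N (2 * N ∸ 4) ((N * (N ∸ 1)) / 2 ∸ 1)
  s-2n-4 6≤h = subst (SIs N (2 * N ∸ 4)) (cong (_∸ 1) (≡-sym half-pairs)) (SIs-intro (N * h ∸ 1)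
    (λ G rob → lower-from-complement G 1 (sparse≤1 (complement G) ≤-refl (sparse 1 4≤2N G rob)))
    (eraseEdge complete zero (suc zero))
    (Robust-eraseEdge complete refl (subst (Robust complete) (+-∸-assoc 1 {2 * N} {4} 4≤2N) (complete-robust 6≤h)))
    (≤-reflexive (trans (≡-sym (m+n∸n≡m (edges (eraseEdge complete zero (suc zero))) 1))
      (cong (_∸ 1) (trans (edges-eraseEdge complete {zero} {suc zero} refl) edges-complete)))))
    where
    4≤2N : 4 ≤ 2 * N
    4≤2N = *-monoʳ-≤ 2 {2} {N} (s≤s (s≤s z≤n))

  s-2n-5 : 6 ≤ h → SIs N (2 * N ∸ 5) ((N * (N ∸ 1)) / 2 ∸ (N ∸ 1) / 2)
  s-2n-5 6≤h = subst (SIs N (2 * N ∸ 5)) (cong₂ _∸_ (≡-sym half-pairs) (≡-sym half-N)) (SIs-intro (N * h ∸ h)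
    (λ G rob → lower-from-complement G h (≤h (complement G) (sparse-2 (complement G) 4≤N (sparse 2 5≤2N G rob))))
    missing-matching (missing-matching-robust (<⇒≤ 6≤h))
    (≤-reflexive (trans (≡-sym (m+n∸m≡n h _)) (cong (_∸ h) (trans (cong (_+ edges missing-matching) (≡-sym edges-nearMatching≡h))
      (complementary (nearMatching complete complete-nearPerfect)))))))
    where
    4≤N : 4 ≤ N
    4≤N = s≤s (≤-trans (s≤s (s≤s (s≤s z≤n))) (*-monoˡ-≤ 2 6≤h))
    5≤2N : 5 ≤ 2 * N
    5≤2N = ≤-trans (n≤1+n 5) (*-monoʳ-≤ 2 {3} {N} (s≤s (s≤s (s≤s z≤n))))
    ≤h : (C : Graph N) → 2 * edges C ≤ N → edges C ≤ h
    ≤h C le = s≤s⁻¹ (*-cancelˡ-< 2 _ _ (≤-trans (s≤s le) (≤-reflexive (eq h))))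
      where
      eq : ∀ h → suc (suc (h * 2)) ≡ 2 * suc h
      eq = solve-∀

  s-0 : SIs N 0 0
  s-0 = SIs-intro 0 (λ _ _ → z≤n) emptyGraph
    (λ H H⊆ lt → ⊥-elim (<⇒≱ lt (≤-trans (≤-reflexive (+-identityʳ (edges H))) (edges-mono H emptyGraph H⊆))))
    (≤-reflexive (edges-emptyGraph {N}))

  s-1 : SIs N 1 ((N ∸ 1) / 2)
  s-1 = subst (SIs N 1) (≡-sym half-N) (SIs-intro h
    (λ G rob → *-cancelˡ-≤ 2 (+-cancelʳ-≤ 1 _ _ (≤-trans (≤-reflexive (eq h)) (lower-1 G rob))))
    (nearMatching complete complete-nearPerfect) (Robust-nearMatching complete complete-nearPerfect) (≤-reflexive edges-nearMatching≡h))
    where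
    eq : ∀ h → 2 * h + 1 ≡ suc (h * 2)
    eq = solve-∀

  -- A Hamiltonian cycle survives two deletions; with one edge erased in advance it still survives
  -- one.
  s-2 : SIs N 2 (N ∸ 1)
  s-2 = from-cycle (hamiltonian-union 1 (s≤s z≤n))
    where
    from-edge : (G : Graph N) → Robust G 3 → edges G ≤ N * 1 → (∃₂ λ u v → adj G u v ≡ true) → SIs N 2 (N ∸ 1)
    from-edge G rob le (u , v , uv) = SIs-intro (N ∸ 1) (λ G rob → s≤s⁻¹ (≤-trans (lower-2 G rob) (≤-reflexive (+-comm (edges G) 1))))
      (eraseEdge G u v) (Robust-eraseEdge G uv rob)
      (s≤s⁻¹ (≤-trans (≤-reflexive (trans (+-comm 1 _) (edges-eraseEdge G uv))) (≤-trans le (≤-reflexive (*-identityʳ N)))))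
    from-cycle : (Σ (Graph N) λ G → Robust G 3 × edges G ≤ N * 1) → SIs N 2 (N ∸ 1)
    from-cycle (G , rob , le) = from-edge G rob le
      (∃-edge G (HasPMorAPM⇒edge G (rob G (λ _ _ e → e) (m<m+n (edges G) z<s))))

  s-3 : SIs N 3 N
  s-3 = from-cycle (hamiltonian-union 1 (s≤s z≤n))
    where
    from-cycle : (Σ (Graph N) λ G → Robust G 3 × edges G ≤ N * 1) → SIs N 3 N
    from-cycle (G , rob , le) = SIs-intro N (λ G → lower-3 G (s≤s (s≤s (s≤s z≤n)))) G rob (≤-trans le (≤-reflexive (*-identityʳ N)))

  lower-bound : (G : Graph N) → Robust G k → N * (N ∸ 1) * k ≤ (4 * N ∸ 6) * edges G
  lower-bound {k} G rob = ≤-trans (m+n≤o⇒m≤o∸n _ (+-cancelʳ-≤ (N * k) _ _ (begin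
    N * (h * 2) * k + 6 * edges G + N * k   ≡⟨ eq (h * 2) k (edges G) ⟩
    N * (N * k) + 6 * edges G               ≤⟨ lower-average G rob ⟩
    4 * (N * edges G) + N * k               ≡⟨ cong (_+ N * k) (*-assoc 4 N (edges G)) ⟨
    4 * N * edges G + N * k                 ∎)))
    (≤-reflexive (≡-sym (*-distribʳ-∸ (edges G) (4 * N) 6)))
    where
    open ≤-Reasoning
    eq : ∀ a k e → suc a * a * k + 6 * e + suc a * k ≡ suc a * (suc a * k) + 6 * e
    eq = solve-∀

  upper-graph : k ≤ 2 * N ∸ 6 → Σ (Graph N) λ G → Robust G k × edges G ≤ (((k + 2) / 3) ⊓ ((N ∸ 1) / 2)) * N
  upper-graph {k} k≤ = subst (λ x → Σ (Graph N) λ G → Robust G k × edges G ≤ ((k + 2) / 3 ⊓ x) * N) (≡-sym half-N) (by-size ((k + 2) / 3 ≤? h))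
    where
    by-size : Dec ((k + 2) / 3 ≤ h) → Σ (Graph N) λ G → Robust G k × edges G ≤ ((k + 2) / 3 ⊓ h) * N
    by-size (yes m≤h) = weaken (hamiltonian-union ((k + 2) / 3) m≤h)
      where
      k≤3m : k ≤ (k + 2) / 3 * 3
      k≤3m = +-cancelʳ-≤ 2 _ _ (begin
        k + 2                                 ≡⟨ m≡m%n+[m/n]*n (k + 2) 3 ⟩
        (k + 2) % 3 + (k + 2) / 3 * 3         ≤⟨ +-monoˡ-≤ _ (s≤s⁻¹ (m%n<n (k + 2) 3)) ⟩
        2 + (k + 2) / 3 * 3                   ≡⟨ +-comm 2 _ ⟩
        (k + 2) / 3 * 3 + 2                   ∎)
        where open ≤-Reasoning
      weaken : (Σ (Graph N) λ G → Robust G ((k + 2) / 3 * 3) × edges G ≤ N * ((k + 2) / 3)) → Σ (Graph N) λ G → Robust G k × edges G ≤ ((k + 2) / 3 ⊓ h) * N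
      weaken (G , rob , le) = G , Robust-≤ G k≤3m rob
        , ≤-trans le (≤-reflexive (trans (*-comm N ((k + 2) / 3)) (cong (_* N) (≡-sym (m≤n⇒m⊓n≡m m≤h)))))
    -- The minimum is now h, and `N * h` is the size of the complete graph. Here k ≥ 3h + 1, which
    -- together with k ≤ 2N - 6 = 4h - 4 forces h ≥ 5.
    by-size (no m≰h) = complete , Robust-≤ complete k≤ (complete-robust-5 5≤h)
      , ≤-reflexive (trans edges-complete (trans (*-comm N h) (cong (_* N) (≡-sym (m≥n⇒m⊓n≡n (<⇒≤ (≰⇒> m≰h)))))))
      where
      5≤h : 5 ≤ h
      5≤h = linear 5 h 0 (+-mono-≤ (≤-trans (*-monoˡ-≤ 3 (≰⇒> m≰h)) (m/n*n≤m (k + 2) 3)) (≤-trans (+-monoˡ-≤ 6 k≤) (≤-reflexive (trans (m∸n+n≡m 6≤2N) 2N≡))))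
        (eq h k)
        where
        6≤2N : 6 ≤ 2 * N
        6≤2N = *-monoʳ-≤ 2 (s≤s (s≤s (s≤s z≤n)))
        eq : ∀ h k → 5 + (k + 2 + (4 * h + 2)) + 0 ≡ h + (suc h * 3 + (k + 6))
        eq = solve-∀

  bounds : k ≤ 2 * N ∸ 6 → SBounds N k (λ e → N * (N ∸ 1) * k ≤ (4 * N ∸ 6) * e) ((((k + 2) / 3) ⊓ ((N ∸ 1) / 2)) * N)
  bounds {k} k≤ = (λ H mpH → lower-bound H (MP⇒Robust H mpH)) , from-robust (upper-graph k≤)
    where
    U : ℕ
    U = (((k + 2) / 3) ⊓ ((N ∸ 1) / 2)) * N
    from-robust : (Σ (Graph N) λ G → Robust G k × edges G ≤ U) → Σ (Graph N) λ G → MP G k × edges G ≤ U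
    from-robust (G , rob , le) = shrink (exactSubgraph G rob)
      where
      shrink : (Σ (Graph N) λ G' → MP G' k × edges G' ≤ edges G) → Σ (Graph N) λ G → MP G k × edges G ≤ U
      shrink (G' , mp , le') = G' , mp , ≤-trans le' le

theorem4p2 : (∀ (n k : ℕ) → (∃ λ h → n ≡ 2 * h) → 2 ≤ n → k ≤ n ∸ 1 → SIs n k ((n * k) / 2))
    × (∀ (n k h : ℕ) → n ≡ 2 * h + 1 → 5 ≤ n → 4 ≤ k → k ≤ 2 * n ∸ 6 →
    SBounds n k (λ e → n * (n ∸ 1) * k ≤ (4 * n ∸ 6) * e)
    ((((k + 2) / 3) ⊓ ((n ∸ 1) / 2)) * n))
    × (∀ (n h : ℕ) → n ≡ 2 * h + 1 → 13 ≤ n →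
    SIs n (2 * n ∸ 3) ((n * (n ∸ 1)) / 2)
    × SIs n (2 * n ∸ 4) ((n * (n ∸ 1)) / 2 ∸ 1)
    × SIs n (2 * n ∸ 5) ((n * (n ∸ 1)) / 2 ∸ (n ∸ 1) / 2)
    × SIs n 0 0
    × SIs n 1 ((n ∸ 1) / 2)
    × SIs n 2 (n ∸ 1)
    × SIs n 3 n)
theorem4p2 = even-case , odd-case , extreme-cases
  where
  Even Middle : ℕ → ℕ → Set
  Even n k = k ≤ n ∸ 1 → SIs n k ((n * k) / 2)
  Middle n k = k ≤ 2 * n ∸ 6 → SBounds n k (λ e → n * (n ∸ 1) * k ≤ (4 * n ∸ 6) * e) ((((k + 2) / 3) ⊓ ((n ∸ 1) / 2)) * n)
  Extreme : ℕ → Set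
  Extreme n = 13 ≤ n →
    SIs n (2 * n ∸ 3) ((n * (n ∸ 1)) / 2)
    × SIs n (2 * n ∸ 4) ((n * (n ∸ 1)) / 2 ∸ 1)
    × SIs n (2 * n ∸ 5) ((n * (n ∸ 1)) / 2 ∸ (n ∸ 1) / 2)
    × SIs n 0 0
    × SIs n 1 ((n ∸ 1) / 2)
    × SIs n 2 (n ∸ 1)
    × SIs n 3 n
  2h≡ : ∀ h → suc (suc (2 * h)) ≡ 2 * suc h
  2h≡ = solve-∀
  2h+1≡ : ∀ h → suc (h * 2) ≡ 2 * h + 1
  2h+1≡ = solve-∀
  even-case : ∀ n k → (∃ λ h → n ≡ 2 * h) → 2 ≤ n → Even n k
  even-case n k (zero , n≡0) 2≤n = ⊥-elim (<⇒≱ (subst (2 ≤_) n≡0 2≤n) z≤n)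
  even-case n k (suc h , n≡) _ = subst (λ n → Even n k) (trans (2h≡ h) (≡-sym n≡)) (s-even h)
  odd-case : ∀ n k h → n ≡ 2 * h + 1 → 5 ≤ n → 4 ≤ k → Middle n k
  odd-case n k zero n≡1 5≤n _ = ⊥-elim (<⇒≱ (subst (5 ≤_) n≡1 5≤n) (s≤s z≤n))
  odd-case n k (suc h) n≡ _ _ = subst (λ n → Middle n k) (trans (2h+1≡ (suc h)) (≡-sym n≡)) (Odd.bounds h)
  extreme-cases : ∀ n h → n ≡ 2 * h + 1 → Extreme n
  extreme-cases n zero n≡1 13≤n = ⊥-elim (<⇒≱ (subst (13 ≤_) n≡1 13≤n) (s≤s z≤n))
  extreme-cases n (suc h) n≡ = subst Extreme (trans (2h+1≡ (suc h)) (≡-sym n≡)) λ 13≤N →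
    let 6≤h = *-cancelʳ-≤ 6 (suc h) 2 (s≤s⁻¹ 13≤N)
    in s-2n-3 6≤h , s-2n-4 6≤h , s-2n-5 6≤h , s-0 , s-1 , s-2 , s-3
    where open Odd h using (s-2n-3; s-2n-4; s-2n-5; s-0; s-1; s-2; s-3)
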